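{- Let $\Gamma=(G,\sigma)$ be a connected signed graph on $n\geq 2$ vertices $1,\ldots,n$ and $m$ edges $e_1,\ldots,e_m$ with Laplacian matrix $L$. \begin{enumerate} \item[(a)] If $\Gamma$ is balanced, then \[(L^\dagger)_{ij}=\frac{1}{n^2\tau(\Gamma)^2}\sum_{k=1}^m\ \sum_{T_r,T_s\in\mathcal S(\Gamma),\ e_k\in T_r,\,e_k\in T_s}\mathrm{sgn}(P_{T_r}(e_k-i))\,\mathrm{sgn}(P_{T_s}(e_k-j))\,\Psi(e_k,i,j),\] where (sum over ordered pairs of spanning trees) \[\Psi(e_k,i,j)=\begin{cases}|T^{T_r}_h(e_k)|\,|T^{T_s}_h(e_k)| & \text{if } i\in T^{T_r}_t(e_k),\ j\in T^{T_s}_t(e_k),\\ |T^{T_r}_t(e_k)|\,|T^{T_s}_t(e_k)| & \text{if } i\in T^{T_r}_h(e_k),\ j\in T^{T_s}_h(e_k),\\ -\sigma(e_k)\,|T^{T_r}_h(e_k)|\,|T^{T_s}_t(e_k)| & \text{if } i\in T^{T_r}_t(e_k),\ j\in T^{T_s}_h(e_k),\\ -\sigma(e_k)\,|T^{T_r}_t(e_k)|\,|T^{T_s}_h(e_k)| & \text{if } i\in T^{T_r}_h(e_k),\ j\in T^{T_s}_t(e_k).\end{cases}\] \item[(b)] If $\Gamma$ is unbalanced, then $L$ is invertible and \[(L^{ -1})_{ij}=\frac{1}{\big(\sum_{H\in\mathcal{TU}_n(\Gamma)}4^{c(H)}\big)^2}\sum_{k=1}^m\Big(\sum_{H\in\mathcal{TU}_n(\Gamma),\,e_k\in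 H}4^{c(H)}(N_H^\dagger)_{ki}\Big)\Big(\sum_{H\in\mathcal{TU}_n(\Gamma),\,e_k\in H}4^{c(H)}(N_H^\dagger)_{kj}\Big),\] where for $e_k$ in the component $U=U^H_r$ of $H$ with cycle $C=C^H_r$ and a vertex $v$: $(N_H^\dagger)_{kv}=0$ if $v\notin V(U)$, and for $v\in V(U)$, \[(N_H^\dagger)_{kv}=w(e_k)\begin{cases}\tfrac12\mathrm{sgn}(P_{e_k^t-v}) & \text{if } e_k\in C,\\ 0 & \text{if } e_k\notin C,\ v\in U\setminus e_k[C],\\ -\mathrm{sgn}(P_{e_k-v}) & \text{if } e_k \text{ positive}, e_k\notin E(C),\ v\notin U\setminus e_k[C],\ v\in U_h(e_k),\\ \mathrm{sgn}(P_{e_k-v}) & \text{otherwise.}\end{cases}\] \end{enumerate}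
   Context: Signed graph $\Gamma=(G,\sigma)$: simple graph $G=(V,E)$, $V=\{1,\ldots,n\}$, with $\sigma:E\to\{ -1,1\}$; $e$ positive if $\sigma(e)=1$, negative if $\sigma(e)=-1$. Its Laplacian is $L=D(G)-A(\Gamma)$, where $D(G)$ is the diagonal degree matrix and $A(\Gamma)_{ij}=\sigma(\{i,j\})$ if $\{i,j\}\in E$ and $0$ otherwise. $\mathrm{sgn}(P)$ is the product of $\sigma$ over a path's edges (1 if empty). A cycle is balanced if it has an even number of negative edges; $\Gamma$ is balanced if all cycles are balanced, otherwise unbalanced. An incidence matrix $N=[n_{k\ell}]$ is an $n\times m$ matrix (rows = vertices, columns = edges) with, for $e_\ell=\{i,j\}$, exactly two nonzero entries $n_{i\ell},n_{j\ell}\in\{\pm1\}$ in column $\ell$, $n_{i\ell}=n_{j\ell}$ if $e_\ell$ negative, $n_{i\ell}=-n_{j\ell}$ if positive; fix one such $N$ (then $L=NN^\intercal$). Head/tail: a positive edge $\{l,m\}$ with $n_{l\ell}=1,n_{m\ell}=-1$ has tail $l$, head $m$; a negative edge $\{l,m\}$ with $l<m$ has tail $l$, head $m$. $w(e_\ell)=-1$ if $e_\ell$ is negative with both nonzero entries of column $\ell$ equal to $-1$, else $1$. $\mathcal S(\Gamma)$ is the set of spanning trees, $\tau(\Gamma)=|\mathcal S(\Gamma)|$. For a spanning tree $T\ni e_k$, $T^T_h(e_k)$, $T^T_t(e_k)$ are the components of $T\setminus e_k$ containing the head and tail of $e_k$ ($|\cdot|$ = number of vertices), and $P_T(e_k-i)$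 is the shortest path in $T$ between vertex $i$ and edge $e_k$ not containing $e_k$. $\mathcal{TU}_n(\Gamma)$ is the set of spanning subgraphs $H$ with exactly $n$ edges each of whose components is a tree or an unbalanced unicyclic graph; $c(H)$ is the number of unbalanced unicyclic components $U^H_r$ (with cycles $C^H_r$). For unicyclic $U$ with cycle $C$ and $e_k\notin C$: $U\setminus e_k[C]$ is the component of $U\setminus e_k$ containing $C$, $U_h(e_k)$ the component of $U\setminus e_k$ containing the head of $e_k$, and $P_{e_k-v}$ the shortest path in $U$ between $v$ and $e_k$ not containing $e_k$; for $e_k\in C$, $e_k^t$ is its tail and $P_{e_k^t-v}$ the path between $e_k^t$ and $v$ in the tree $U\setminus e_k$. -}

module Defs where

open import Data.Bool using (Bool; true; false; _∧_; _∨_; not; if_then_else_)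
open import Data.Nat as ℕ using (ℕ; zero; suc)
open import Data.Fin as Fin using (Fin; toℕ)
open import Data.Fin.Properties using (_≟_)
open import Data.Integer as ℤ using (ℤ)
open import Data.Rational as ℚ using (ℚ; 0ℚ; 1ℚ; ½; _+_; _*_; _-_; -_; 1/_)
import Data.Rational.Properties as ℚP
open import Data.Sign as Sign using (Sign)
open import Data.List as List using (List; []; _∷_; _++_; length; filterᵇ; allFin; foldr)
open import Data.Bool.ListAction using (any; all)
open import Data.List.Relation.Unary.Unique.Propositional using (Unique)
open import Data.Vec as Vec using (Vec; lookup; updateAt)
open import Data.Maybe using (Maybe; just; nothing; fromMaybe)
open import Data.Product using (Σ; _×_; _,_; proj₁; proj₂; ∃)
open import Data.Sum using (_⊎_)
open import Relation.Nullary using (¬_; yes; no)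
open import Relation.Nullary.Decidable using (⌊_⌋)
open import Relation.Binary.PropositionalEquality using (_≡_; _≢_)

-- total reciprocal on ℚ (0⁻¹ := 0); only ever applied to nonzero values here
inv : ℚ → ℚ
inv q with q ℚP.≟ 0ℚ
... | yes _ = 0ℚ
... | no q≢0 = 1/_ q {{ℚ.≢-nonZero q≢0}}

sumL : List ℚ → ℚ
sumL = foldr _+_ 0ℚ

sumFin : (k : ℕ) → (Fin k → ℚ) → ℚ
sumFin k f = sumL (List.map f (allFin k))

count : (k : ℕ) → (Fin k → Bool) → ℕ
count k p = length (filterᵇ p (allFin k))

ℕtoℚ : ℕ → ℚ
ℕtoℚ k = ℤ.+ k ℚ./ 1

ℤtoℚ : ℤ → ℚ
ℤtoℚ z = z ℚ./ 1

signℚ : Sign → ℚ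
signℚ Sign.+ = 1ℚ
signℚ Sign.- = - 1ℚ

isPlus : Sign → Bool
isPlus Sign.+ = true
isPlus Sign.- = false

_==_ : ∀ {k} → Fin k → Fin k → Bool
x == y = ⌊ x ≟ y ⌋

_==ℤ_ : ℤ → ℤ → Bool
a ==ℤ b = ⌊ a ℤ.≟ b ⌋

infixl 7 _⊗_
infix 4 _≐_

Mat : ℕ → Set
Mat n = Fin n → Fin n → ℚ

_⊗_ : ∀ {n} → Mat n → Mat n → Mat n
(A ⊗ B) i j = sumFin _ (λ k → A i k * B k j)

transpose : ∀ {n} → Mat n → Mat n
transpose A i j = A j i

_≐_ : ∀ {n} → Mat n → Mat n → Set
A ≐ B = ∀ i j → A i j ≡ B i j

idMat : ∀ {n} → Mat n
idMat i j = if i == j then 1ℚ else 0ℚ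

IsPseudoInverse : ∀ {n} → Mat n → Mat n → Set
IsPseudoInverse A X =
  ((A ⊗ X) ⊗ A ≐ A) × ((X ⊗ A) ⊗ X ≐ X) ×
  (transpose (A ⊗ X) ≐ (A ⊗ X)) × (transpose (X ⊗ A) ≐ (X ⊗ A))

IsInverse : ∀ {n} → Mat n → Mat n → Set
IsInverse A X = (A ⊗ X ≐ idMat) × (X ⊗ A ≐ idMat)

-- Signed simple graphs on vertices Fin n with edges e : Fin m.
-- Edge e is {src e, dst e} with src e < dst e (so no loops);
-- distinct edge labels give distinct vertex pairs (simple graph).

record SignedGraph (n m : ℕ) : Set where
  field
    ends    : Fin m → Fin n × Fin n
    ordered : ∀ e → proj₁ (ends e) Fin.< proj₂ (ends e)
    simple  : ∀ e f → ends e ≡ ends f → e ≡ f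
    σ       : Fin m → Sign

  src dst : Fin m → Fin n
  src e = proj₁ (ends e)
  dst e = proj₂ (ends e)

-- spanning subgraphs = sets of edges
EdgeSet : ℕ → Set
EdgeSet m = Vec Bool m

allSets : (m : ℕ) → List (EdgeSet m)
allSets zero = Vec.[] ∷ []
allSets (suc m) = List.map (true Vec.∷_) (allSets m) ++ List.map (false Vec.∷_) (allSets m)

module _ {n m : ℕ} (Γ : SignedGraph n m) where
  open SignedGraph Γ

  -- Walk x y es vs : walk from x to y using edge list es,
  -- vs = list of vertices left at each step
  data Walk : Fin n → Fin n → List (Fin m) → List (Fin n) → Set where
    stop : ∀ {x} → Walk x x [] []
    fwd  : ∀ {z es vs} e → Walk (dst e) z es vs → Walk (src e) z (e ∷ es) (src e ∷ vs)
    bwd  : ∀ {z es vs} e → Walk (src e) z es vs → Walk (dst e) z (e ∷ es) (dst e ∷ vs)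

  sgnEdges : List (Fin m) → Sign
  sgnEdges = foldr (λ e s → σ e Sign.* s) Sign.+

  Connected : Set
  Connected = ∀ x y → ∃ λ es → ∃ λ vs → Walk x y es vs

  -- a cycle = closed walk of length ≥ 3 with no repeated vertex;
  -- balanced = every cycle has an even number of negative edges
  Balanced : Set
  Balanced = ∀ x es vs → Walk x x es vs → 3 ℕ.≤ length es → Unique vs →
             sgnEdges es ≡ Sign.+

  degree : Fin n → ℕ
  degree i = count m (λ e → (src e == i) ∨ (dst e == i))

  adjacency : Mat n
  adjacency i j = sumFin m (λ e →
    if ((src e == i) ∧ (dst e == j)) ∨ ((src e == j) ∧ (dst e == i))
    then signℚ (σ e) else 0ℚ)

  laplacian : Mat n
  laplacian i j = (if i == j then ℕtoℚ (degree i) else 0ℚ) - adjacency i j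

  IsIncidence : (Fin n → Fin m → ℤ) → Set
  IsIncidence N =
    (∀ v e → v ≢ src e → v ≢ dst e → N v e ≡ ℤ.0ℤ) ×
    (∀ e → (N (src e) e ≡ ℤ.1ℤ ⊎ N (src e) e ≡ ℤ.-1ℤ)) ×
    (∀ e → (N (dst e) e ≡ ℤ.1ℤ ⊎ N (dst e) e ≡ ℤ.-1ℤ)) ×
    (∀ e → σ e ≡ Sign.- → N (src e) e ≡ N (dst e) e) ×
    (∀ e → σ e ≡ Sign.+ → N (src e) e ≡ ℤ.- N (dst e) e)

  module WithN (N : Fin n → Fin m → ℤ) where

    -- tail/head: positive edge: tail has entry 1, head entry −1;
    -- negative edge {l,m} with l<m: tail l, head m
    tail head : Fin m → Fin n
    tail e = if isPlus (σ e)
             then (if N (src e) e ==ℤ ℤ.1ℤ then src e else dst e)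
             else src e
    head e = if isPlus (σ e)
             then (if N (src e) e ==ℤ ℤ.1ℤ then dst e else src e)
             else dst e

    w : Fin m → ℚ
    w e = if (not (isPlus (σ e))) ∧ (N (src e) e ==ℤ ℤ.-1ℤ) then - 1ℚ else 1ℚ

  mem : EdgeSet m → Fin m → Bool
  mem S e = lookup S e

  remove : EdgeSet m → Fin m → EdgeSet m
  remove S e = updateAt S e (λ _ → false)

  reachK : ℕ → EdgeSet m → Fin n → Fin n → Bool
  reachK zero S x y = x == y
  reachK (suc k) S x y = reachK k S x y ∨
    any (λ e → mem S e ∧ (((src e == x) ∧ reachK k S (dst e) y) ∨
                          ((dst e == x) ∧ reachK k S (src e) y))) (allFin m)

  -- same connected component of S (walks of length ≤ n suffice)
  reach : EdgeSet m → Fin n → Fin n → Bool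
  reach S = reachK n S

  onCycle : EdgeSet m → Fin m → Bool
  onCycle S e = mem S e ∧ reach (remove S e) (src e) (dst e)

  isSpanningTree : EdgeSet m → Bool
  isSpanningTree T =
    all (λ x → all (λ y → reach T x y) (allFin n)) (allFin n) ∧
    not (any (onCycle T) (allFin m))

  spanningTrees : List (EdgeSet m)
  spanningTrees = filterᵇ isSpanningTree (allSets m)

  τ : ℕ
  τ = length spanningTrees

  compSize : EdgeSet m → Fin n → ℕ
  compSize S x = count n (reach S x)

  firstJust : ∀ {A : Set} → List (Maybe A) → Maybe A
  firstJust [] = nothing
  firstJust (just a ∷ _) = just a
  firstJust (nothing ∷ xs) = firstJust xs

  -- sign of some walk of length ≤ k from x to y in S (nothing if none);
  -- in a forest every such walk has the sign of the unique path
  walkSignK : ℕ → EdgeSet m → Fin n → Fin n → Maybe Sign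
  walkSignK zero S x y = if x == y then just Sign.+ else nothing
  walkSignK (suc k) S x y with walkSignK k S x y
  ... | just s = just s
  ... | nothing = firstJust (List.map step (allFin m))
    where
    ext : Fin n → Fin m → Maybe Sign
    ext z e with walkSignK k S x z
    ... | just s = just (s Sign.* σ e)
    ... | nothing = nothing
    step : Fin m → Maybe Sign
    step e = if mem S e
             then (if dst e == y then ext (src e) e
                   else if src e == y then ext (dst e) e else nothing)
             else nothing

  pathSign : EdgeSet m → Fin n → Fin n → ℚ
  pathSign S x y = signℚ (fromMaybe Sign.+ (walkSignK n S x y))

  module Formulas (N : Fin n → Fin m → ℤ) where
    open WithN N

    -- sgn(P_S(e_k − v)): path from v to the endpoint of e_k in its
    -- component of S ∖ e_k (S a forest containing e_k, or the tree side)
    sgnToEdge : EdgeSet m → Fin m → Fin n → ℚ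
    sgnToEdge S k v =
      if reach (remove S k) (tail k) v
      then pathSign (remove S k) (tail k) v
      else pathSign (remove S k) (head k) v

    Ψ : Fin m → Fin n → Fin n → EdgeSet m → EdgeSet m → ℚ
    Ψ k i j Tr Ts =
      let Tr' = remove Tr k
          Ts' = remove Ts k
          hr = ℕtoℚ (compSize Tr' (head k))
          tr = ℕtoℚ (compSize Tr' (tail k))
          hs = ℕtoℚ (compSize Ts' (head k))
          ts = ℕtoℚ (compSize Ts' (tail k))
          iT = reach Tr' (tail k) i     -- i ∈ T^{Tr}_t(e_k), else i ∈ T^{Tr}_h(e_k)
          jT = reach Ts' (tail k) j
      in if iT
         then (if jT then hr * hs else - (signℚ (σ k)) * hr * ts)
         else (if jT then - (signℚ (σ k)) * tr * hs else tr * ts)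

    treesWith : Fin m → List (EdgeSet m)
    treesWith k = filterᵇ (λ T → mem T k) spanningTrees

    formulaA : Fin n → Fin n → ℚ
    formulaA i j =
      inv (ℕtoℚ n * ℕtoℚ n * ℕtoℚ τ * ℕtoℚ τ) *
      sumFin m (λ k →
        sumL (List.map (λ Tr →
          sumL (List.map (λ Ts →
            sgnToEdge Tr k i * sgnToEdge Ts k j * Ψ k i j Tr Ts)
          (treesWith k)))
        (treesWith k)))

    compEdge : EdgeSet m → Fin n → Fin m → Bool
    compEdge H x e = mem H e ∧ reach H x (src e)

    compIsTree : EdgeSet m → Fin n → Bool
    compIsTree H x = not (any (λ e → compEdge H x e ∧ onCycle H e) (allFin m))

    -- unicyclic: connected with as many edges as vertices
    compIsUnicyclic : EdgeSet m → Fin n → Bool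
    compIsUnicyclic H x = count m (compEdge H x) ℕ.≡ᵇ compSize H x

    compCycleSign : EdgeSet m → Fin n → Sign
    compCycleSign H x =
      sgnEdges (filterᵇ (λ e → compEdge H x e ∧ onCycle H e) (allFin m))

    compUnbalancedUnicyclic : EdgeSet m → Fin n → Bool
    compUnbalancedUnicyclic H x =
      compIsUnicyclic H x ∧ not (isPlus (compCycleSign H x))

    isTU : EdgeSet m → Bool
    isTU H = (length (filterᵇ (mem H) (allFin m)) ℕ.≡ᵇ n) ∧
             all (λ x → compIsTree H x ∨ compUnbalancedUnicyclic H x) (allFin n)

    TU : List (EdgeSet m)
    TU = filterᵇ isTU (allSets m)

    isRep : EdgeSet m → Fin n → Bool
    isRep H x = all (λ y → not ((toℕ y ℕ.<ᵇ toℕ x) ∧ reach H x y)) (allFin n)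

    c : EdgeSet m → ℕ
    c H = count n (λ x → isRep H x ∧ compUnbalancedUnicyclic H x)

    weight : EdgeSet m → ℚ
    weight H = ℕtoℚ (4 ℕ.^ c H)

    NHdag : EdgeSet m → Fin m → Fin n → ℚ
    NHdag H k v =
      let t = tail k
          H' = remove H k
          inU = reach H t v
          -- v ∈ U ∖ e_k [C]
          inCside = any (λ e → compEdge H t e ∧ onCycle H e ∧ reach H' (src e) v)
                        (allFin m)
      in if not inU then 0ℚ
         else w k * (if onCycle H k then ½ * pathSign H' t v
                     else if inCside then 0ℚ
                     else if isPlus (σ k) ∧ reach H' (head k) v
                          then - sgnToEdge H k v
                          else sgnToEdge H k v)

    TUWith : Fin m → List (EdgeSet m)
    TUWith k = filterᵇ (λ H → mem H k) TU

    formulaB : Fin n → Fin n → ℚ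
    formulaB i j =
      inv (sumL (List.map weight TU) * sumL (List.map weight TU)) *
      sumFin m (λ k →
        sumL (List.map (λ H → weight H * NHdag H k i) (TUWith k)) *
        sumL (List.map (λ H → weight H * NHdag H k j) (TUWith k)))

{-# OPTIONS --safe #-}
module Submission where

-- Let M = ν† for the incidence matrix ν, so that L† = MᵗM. A weighted average M of the
-- pseudoinverses of the maximal nonsingular column submatrices ν_H (spanning trees, resp. members
-- of 𝒯𝒰ₙ) satisfies ν M = P, the projection onto the range of ν. If the weights are the squared
-- maximal minors, the columns of M are also orthogonal to ker ν, and both facts determine M. No
-- determinant is needed: it suffices that the rows R(H,k), k ∈ H, satisfy the exchange rule
-- weight(S ∪ k) = p² weight(S ∪ k₀) with p = R(S ∪ k₀, k₀) · ν_k. Since R(S ∪ k₀, k₀) is constant up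
-- to signs on each component of S, this is a statement about which components k joins.

open import Defs
open import Data.Nat using (ℕ; zero; suc; _≤_; z≤n; s≤s)
import Data.Nat as ℕ
import Data.Nat.Properties as ℕP
open import Data.Bool using (Bool; true; false; _∧_; _∨_; not; if_then_else_; T)
import Data.Bool.Properties as BP
open import Data.Bool.ListAction using (any; all)
open import Data.Fin using (Fin; zero; suc; toℕ)
import Data.Fin as Fin
open import Data.Fin.Properties using (_≟_)
import Data.Fin.Properties as FP
open import Data.Integer using (ℤ)
import Data.Integer as ℤ
import Data.Integer.Properties as ℤP
open import Data.Rational using (ℚ; 0ℚ; 1ℚ; ½; _+_; _*_; _-_; -_)
import Data.Rational as ℚ
import Data.Rational.Properties as ℚP
open import Data.Rational.Solver using (module +-*-Solver)
import Data.Rational.Unnormalised as ℚᵘ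
import Data.Rational.Unnormalised.Properties as ℚᵘP
open import Data.Sign using (Sign)
import Data.Sign as Sign
import Data.Sign.Properties as SP
open import Data.List using (List; []; _∷_; _++_; length; filterᵇ; allFin)
import Data.List as List
import Data.List.Properties as LP
open import Data.List.Relation.Unary.All using (All; []; _∷_)
import Data.List.Relation.Unary.All as All
import Data.List.Relation.Unary.All.Properties as AllP
open import Data.List.Relation.Unary.AllPairs using ([]; _∷_)
open import Data.List.Relation.Unary.Any using (here; there)
open import Data.List.Relation.Unary.Unique.Propositional using (Unique)
open import Data.List.Membership.Propositional using (_∈_)
import Data.List.Membership.Propositional.Properties as MemP
import Data.List.Membership.DecPropositional as DecMem
open import Data.Vec using (Vec; lookup; updateAt)
import Data.Vec as Vec
import Data.Vec.Properties as VP
open import Data.Maybe using (Maybe; just; nothing)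
open import Data.Product using (Σ; _×_; _,_; proj₁; proj₂; ∃)
open import Data.Sum using (_⊎_; inj₁; inj₂; [_,_]′; swap)
open import Data.Empty using (⊥; ⊥-elim)
open import Function using (_∘_; id; case_of_)
open import Relation.Nullary using (¬_; yes; no; Dec; contradiction)
open import Relation.Nullary.Decidable using (⌊_⌋; T?)
open import Relation.Binary.Definitions using (tri<; tri≈; tri>)
open import Relation.Binary.PropositionalEquality
  using (_≡_; _≢_; refl; sym; trans; cong; cong₂; subst; subst₂)
open +-*-Solver

-- Finite sums and booleans

-- Signs of paths and cycles are awkward to handle directly: `walkSignK` returns the sign of some
-- walk, and `onCycle` is a reachability test. Both are read through potentials, sign functions g
-- with g (src e) · σ e = g (dst e) along the edges of a component. A potential determines every
-- walk sign. It exists on a unicyclic component exactly when the cycle is positive, and on a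
-- connected Γ exactly when Γ is balanced. It is also a left null vector of the columns of ν, so it
-- decides which ν_H are nonsingular. The rank of ν separates the two parts. In the unbalanced case
-- P is the identity, and the base 4 comes from an edge that closes a negative cycle: its column
-- pairs with a row of size α to ±2α. In the balanced case one global potential θ spans the left
-- kernel. Rows must be orthogonal to θ, which forces values proportional to the opposite component
-- sizes on the two sides of k, and a division by n; the nonzero exchange factors are then ±1, so
-- every tree has weight 1. The four cases of Ψ are products of two such rows.

ι : Bool → ℚ
ι true  = 1ℚ
ι false = 0ℚ

private variable
  I J : Set

∑ : List I → (I → ℚ) → ℚ
∑ xs f = sumL (List.map f xs)

∑-cong : (xs : List I) {f g : I → ℚ} → (∀ x → f x ≡ g x) → ∑ xs f ≡ ∑ xs g
∑-cong []       h = refl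
∑-cong (x ∷ xs) h = cong₂ _+_ (h x) (∑-cong xs h)

∑-zero : (xs : List I) {f : I → ℚ} → (∀ x → f x ≡ 0ℚ) → ∑ xs f ≡ 0ℚ
∑-zero []       h = refl
∑-zero (x ∷ xs) h = trans (cong₂ _+_ (h x) (∑-zero xs h)) refl

∑-+ : (xs : List I) (f g : I → ℚ) → ∑ xs (λ x → f x + g x) ≡ ∑ xs f + ∑ xs g
∑-+ []       f g = refl
∑-+ (x ∷ xs) f g = trans (cong (f x + g x +_) (∑-+ xs f g))
  (solve 4 (λ a b c d → (a :+ b) :+ (c :+ d) := (a :+ c) :+ (b :+ d)) refl
     (f x) (g x) (∑ xs f) (∑ xs g))

∑-*ˡ : (xs : List I) (c : ℚ) (f : I → ℚ) → c * ∑ xs f ≡ ∑ xs (λ x → c * f x)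
∑-*ˡ []       c f = ℚP.*-zeroʳ c
∑-*ˡ (x ∷ xs) c f = trans (ℚP.*-distribˡ-+ c (f x) (∑ xs f)) (cong (c * f x +_) (∑-*ˡ xs c f))

∑-*ʳ : (xs : List I) (c : ℚ) (f : I → ℚ) → ∑ xs f * c ≡ ∑ xs (λ x → f x * c)
∑-*ʳ xs c f = trans (ℚP.*-comm (∑ xs f) c)
  (trans (∑-*ˡ xs c f) (∑-cong xs (λ x → ℚP.*-comm c (f x))))

∑-linear : (xs : List I) (a b : ℚ) (f g : I → ℚ) →
  ∑ xs (λ x → a * f x + b * g x) ≡ a * ∑ xs f + b * ∑ xs g
∑-linear xs a b f g = trans (∑-+ xs (λ x → a * f x) (λ x → b * g x))
  (sym (cong₂ _+_ (∑-*ˡ xs a f) (∑-*ˡ xs b g)))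

∑-neg : (xs : List I) (f : I → ℚ) → ∑ xs (λ x → - f x) ≡ - ∑ xs f
∑-neg []       f = refl
∑-neg (x ∷ xs) f = trans (cong (- f x +_) (∑-neg xs f)) (sym (ℚP.neg-distrib-+ (f x) (∑ xs f)))

∑-minus : (xs : List I) (f g : I → ℚ) → ∑ xs (λ x → f x - g x) ≡ ∑ xs f - ∑ xs g
∑-minus xs f g = trans (∑-+ xs f (λ x → - g x)) (cong (∑ xs f +_) (∑-neg xs g))

∑-swap : (xs : List I) (ys : List J) (f : I → J → ℚ) →
  ∑ xs (λ x → ∑ ys (f x)) ≡ ∑ ys (λ y → ∑ xs (λ x → f x y))
∑-swap []       ys f = sym (∑-zero ys (λ _ → refl))
∑-swap (x ∷ xs) ys f = trans (cong (∑ ys (f x) +_) (∑-swap xs ys f))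
  (sym (∑-+ ys (f x) (λ y → ∑ xs (λ x' → f x' y))))

∑-product : (xs : List I) (ys : List J) (f : I → ℚ) (g : J → ℚ) →
  ∑ xs (λ x → ∑ ys (λ y → f x * g y)) ≡ ∑ xs f * ∑ ys g
∑-product xs ys f g = trans (∑-cong xs (λ x → sym (∑-*ˡ ys (f x) g)))
  (sym (∑-*ʳ xs (∑ ys g) f))

∑-filter : (p : I → Bool) (xs : List I) (f : I → ℚ) →
  ∑ (filterᵇ p xs) f ≡ ∑ xs (λ x → ι (p x) * f x)
∑-filter p [] f = refl
∑-filter p (x ∷ xs) f with p x
... | true  = cong₂ _+_ (sym (ℚP.*-identityˡ (f x))) (∑-filter p xs f)
... | false = trans (∑-filter p xs f)
  (trans (sym (ℚP.+-identityˡ _)) (cong (_+ _) (sym (ℚP.*-zeroˡ (f x)))))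

∑-++ : (xs ys : List I) (f : I → ℚ) → ∑ (xs ++ ys) f ≡ ∑ xs f + ∑ ys f
∑-++ []       ys f = sym (ℚP.+-identityˡ _)
∑-++ (x ∷ xs) ys f = trans (cong (f x +_) (∑-++ xs ys f)) (sym (ℚP.+-assoc (f x) _ _))

∑-map : (h : I → J) (xs : List I) (f : J → ℚ) → ∑ (List.map h xs) f ≡ ∑ xs (f ∘ h)
∑-map h xs f = cong sumL (sym (LP.map-∘ xs))

∑-suc : ∀ {n} (f : Fin (suc n) → ℚ) →
  ∑ (allFin (suc n)) f ≡ f zero + ∑ (allFin n) (f ∘ suc)
∑-suc f = cong (λ l → f zero + sumL l)
  (trans (LP.map-tabulate suc f) (sym (LP.map-tabulate id (f ∘ suc))))

∑-point : ∀ {n} (f : Fin n → ℚ) j → (∀ k → k ≢ j → f k ≡ 0ℚ) → ∑ (allFin n) f ≡ f j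
∑-point {suc n} f zero    h = trans (∑-suc f)
  (trans (cong (f zero +_) (∑-zero (allFin n) (λ k → h (suc k) λ ()))) (ℚP.+-identityʳ _))
∑-point {suc n} f (suc j) h = trans (∑-suc f)
  (trans (cong₂ _+_ (h zero λ ())
     (∑-point (f ∘ suc) j (λ k k≢j → h (suc k) (λ { refl → k≢j refl }))))
   (ℚP.+-identityˡ _))

==-refl : ∀ {n} (i : Fin n) → (i == i) ≡ true
==-refl i with i ≟ i
... | yes _ = refl
... | no ¬p = contradiction refl ¬p

==-true : ∀ {n} {i j : Fin n} → (i == j) ≡ true → i ≡ j
==-true {i = i} {j} h with i ≟ j
... | yes p = p

==-≢ : ∀ {n} {i j : Fin n} → i ≢ j → (i == j) ≡ false
==-≢ {i = i} {j} h with i ≟ j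
... | yes p = contradiction p h
... | no  _ = refl

==-sym : ∀ {n} (i j : Fin n) → (i == j) ≡ (j == i)
==-sym i j with i ≟ j
... | yes refl = sym (==-refl i)
... | no  ¬p   = sym (==-≢ (¬p ∘ sym))

∑-δ : ∀ {n} (f : Fin n → ℚ) j → ∑ (allFin n) (λ k → ι (k == j) * f k) ≡ f j
∑-δ f j = trans
  (∑-point (λ k → ι (k == j) * f k) j
     (λ k k≢j → trans (cong (λ b → ι b * f k) (==-≢ k≢j)) (ℚP.*-zeroˡ (f k))))
  (trans (cong (λ b → ι b * f j) (==-refl j)) (ℚP.*-identityˡ (f j)))

∑-two-points : ∀ {n} (f : Fin n → ℚ) a b → a ≢ b → (∀ k → k ≢ a → k ≢ b → f k ≡ 0ℚ) →
  ∑ (allFin n) f ≡ f a + f b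
∑-two-points {n} f a b a≢b h = trans (∑-cong (allFin n) split)
  (trans (∑-+ (allFin n) (λ k → ι (k == a) * f k) (λ k → ι (k == b) * f k))
         (cong₂ _+_ (∑-δ f a) (∑-δ f b)))
  where
  split : ∀ k → f k ≡ ι (k == a) * f k + ι (k == b) * f k
  split k with k ≟ a | k ≟ b
  ... | yes refl | yes refl = contradiction refl a≢b
  ... | yes _    | no  _    = solve 1 (λ x → x := con 1ℚ :* x :+ con 0ℚ :* x) refl (f k)
  ... | no  _    | yes _    = solve 1 (λ x → x := con 0ℚ :* x :+ con 1ℚ :* x) refl (f k)
  ... | no  p    | no  q    = trans (h k p q)
        (solve 1 (λ x → con 0ℚ := con 0ℚ :* x :+ con 0ℚ :* x) refl (f k))

-- `_/_` cancels a gcd that does not reduce for variables. On unnormalised fractions over 1 the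
-- claim becomes an identity of integers.
ℕtoℚ-+ : ∀ a b → ℕtoℚ (a ℕ.+ b) ≡ ℕtoℚ a + ℕtoℚ b
ℕtoℚ-+ a b = ℚP.toℚᵘ-injective (ℚᵘP.≃-trans (ℚP.toℚᵘ-fromℚᵘ (ℚᵘ.mkℚᵘ (ℤ.+ (a ℕ.+ b)) 0))
  (ℚᵘP.≃-trans
    (ℚᵘ.*≡* (cong (ℤ._* ℤ.1ℤ) (sym (cong₂ ℤ._+_ (ℤP.*-identityʳ (ℤ.+ a)) (ℤP.*-identityʳ (ℤ.+ b))))))
    (ℚᵘP.≃-trans
      (ℚᵘP.≃-sym (ℚᵘP.+-cong (ℚP.toℚᵘ-fromℚᵘ (ℚᵘ.mkℚᵘ (ℤ.+ a) 0)) (ℚP.toℚᵘ-fromℚᵘ (ℚᵘ.mkℚᵘ (ℤ.+ b) 0))))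
      (ℚᵘP.≃-sym (ℚP.toℚᵘ-homo-+ (ℕtoℚ a) (ℕtoℚ b))))))

ℕtoℚ-suc : ∀ a → ℕtoℚ (suc a) ≡ 1ℚ + ℕtoℚ a
ℕtoℚ-suc = ℕtoℚ-+ 1

ℕtoℚ-nonNeg : ∀ a → 0ℚ ℚ.≤ ℕtoℚ a
ℕtoℚ-nonNeg zero    = ℚP.≤-refl
ℕtoℚ-nonNeg (suc a) = subst (0ℚ ℚ.≤_) (sym (ℕtoℚ-suc a))
  (ℚP.+-mono-≤ {0ℚ} {1ℚ} {0ℚ} (ℚP.nonNegative⁻¹ 1ℚ) (ℕtoℚ-nonNeg a))

ℕtoℚ-pos : ∀ a → 0ℚ ℚ.< ℕtoℚ (suc a)
ℕtoℚ-pos a = subst (0ℚ ℚ.<_) (sym (ℕtoℚ-suc a))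
  (ℚP.+-mono-<-≤ {0ℚ} {1ℚ} {0ℚ} (ℚP.positive⁻¹ 1ℚ) (ℕtoℚ-nonNeg a))

+-cancelˡ : ∀ c {x y} → c + x ≡ c + y → x ≡ y
+-cancelˡ c {x} {y} h = trans (lem x) (trans (cong (- c +_) h) (sym (lem y)))
  where
  lem : ∀ z → z ≡ - c + (c + z)
  lem z = solve 2 (λ c z → z := :- c :+ (c :+ z)) refl c z

ℕtoℚ-injective : ∀ {a b} → ℕtoℚ a ≡ ℕtoℚ b → a ≡ b
ℕtoℚ-injective {zero}  {zero}  h = refl
ℕtoℚ-injective {zero}  {suc b} h = contradiction h (ℚP.<⇒≢ (ℕtoℚ-pos b))
ℕtoℚ-injective {suc a} {zero}  h = contradiction (sym h) (ℚP.<⇒≢ (ℕtoℚ-pos a))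
ℕtoℚ-injective {suc a} {suc b} h = cong suc (ℕtoℚ-injective
  (+-cancelˡ 1ℚ (trans (sym (ℕtoℚ-suc a)) (trans h (ℕtoℚ-suc b)))))

ℕtoℚ-length : (p : I → Bool) (xs : List I) → ℕtoℚ (length (filterᵇ p xs)) ≡ ∑ xs (ι ∘ p)
ℕtoℚ-length p [] = refl
ℕtoℚ-length p (x ∷ xs) with p x
... | true  = trans (ℕtoℚ-suc (length (filterᵇ p xs))) (cong (1ℚ +_) (ℕtoℚ-length p xs))
... | false = trans (ℕtoℚ-length p xs) (sym (ℚP.+-identityˡ _))

ℕtoℚ-count : ∀ n (p : Fin n → Bool) → ℕtoℚ (count n p) ≡ ∑ (allFin n) (ι ∘ p)
ℕtoℚ-count n p = ℕtoℚ-length p (allFin n)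

∑-nonNeg : (xs : List I) {f : I → ℚ} → (∀ x → 0ℚ ℚ.≤ f x) → 0ℚ ℚ.≤ ∑ xs f
∑-nonNeg []       h = ℚP.≤-refl
∑-nonNeg (x ∷ xs) h = ℚP.+-mono-≤ {0ℚ} {_} {0ℚ} (h x) (∑-nonNeg xs h)

-- Turns a global count into information about each summand: a vanishing total excess forces as many
-- edges as vertices in every component, and a sum of positive weights over a nonempty list cannot
-- vanish.
∑-nonNeg-zero : (xs : List I) {f : I → ℚ} → (∀ x → 0ℚ ℚ.≤ f x) → ∑ xs f ≡ 0ℚ →
  ∀ {x} → x ∈ xs → f x ≡ 0ℚ
∑-nonNeg-zero (y ∷ xs) {f} h s x∈ = go x∈
  where
  le : f y ℚ.≤ 0ℚ
  le = subst₂ ℚ._≤_ (ℚP.+-identityʳ (f y)) s (ℚP.+-monoʳ-≤ (f y) (∑-nonNeg xs h))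
  y0 : f y ≡ 0ℚ
  y0 = ℚP.≤-antisym le (h y)
  go : ∀ {x} → x ∈ y ∷ xs → f x ≡ 0ℚ
  go (here refl) = y0
  go (there p)   = ∑-nonNeg-zero xs h
    (trans (sym (ℚP.+-identityˡ _)) (trans (cong (_+ ∑ xs f) (sym y0)) s)) p

inv-* : ∀ {q} → q ≢ 0ℚ → q * inv q ≡ 1ℚ
inv-* {q} q≢0 with q ℚP.≟ 0ℚ
... | yes p = contradiction p q≢0
... | no  p = ℚP.*-inverseʳ q {{ℚ.≢-nonZero p}}

*-cancelˡ : ∀ {c x y} → c ≢ 0ℚ → c * x ≡ c * y → x ≡ y
*-cancelˡ {c} {x} {y} c≢0 h = trans (lem x) (trans (cong (inv c *_) h) (sym (lem y)))
  where
  lem : ∀ z → z ≡ inv c * (c * z)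
  lem z = trans (sym (ℚP.*-identityˡ z)) (trans (cong (_* z) (sym (inv-* c≢0)))
    (solve 3 (λ a b z → (a :* b) :* z := b :* (a :* z)) refl c (inv c) z))

*-≢0 : ∀ {a b} → a ≢ 0ℚ → b ≢ 0ℚ → a * b ≢ 0ℚ
*-≢0 {a} a≢0 b≢0 h = b≢0 (*-cancelˡ a≢0 (trans h (sym (ℚP.*-zeroʳ a))))

inv-*-distrib : ∀ {a b} → a ≢ 0ℚ → b ≢ 0ℚ → inv (a * b) ≡ inv a * inv b
inv-*-distrib {a} {b} a≢0 b≢0 = *-cancelˡ (*-≢0 a≢0 b≢0) (trans (inv-* (*-≢0 a≢0 b≢0))
  (trans (sym (cong₂ _*_ (inv-* a≢0) (inv-* b≢0)))
    (solve 4 (λ a b x y → (a :* x) :* (b :* y) := (a :* b) :* (x :* y)) refl a b (inv a) (inv b))))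

any-intro : (p : I → Bool) {xs : List I} {x : I} → x ∈ xs → p x ≡ true → any p xs ≡ true
any-intro p {y ∷ xs} (here refl) h rewrite h = refl
any-intro p {y ∷ xs} (there q)   h with p y
... | true  = refl
... | false = any-intro p q h

any-elim : (p : I → Bool) (xs : List I) → any p xs ≡ true → ∃ λ x → p x ≡ true
any-elim p (y ∷ xs) h with p y in eq
... | true  = y , eq
... | false = any-elim p xs h

any-false : (p : I → Bool) {xs : List I} {x : I} → any p xs ≡ false → x ∈ xs → p x ≡ false
any-false p {x = x} h x∈ with p x in eq
... | false = refl
... | true  = case trans (sym (any-intro p x∈ eq)) h of λ ()

all-intro : (p : I → Bool) (xs : List I) → (∀ x → p x ≡ true) → all p xs ≡ true
all-intro p []       h = refl
all-intro p (x ∷ xs) h rewrite h x = all-intro p xs h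

all-elim : (p : I → Bool) {xs : List I} {x : I} → all p xs ≡ true → x ∈ xs → p x ≡ true
all-elim p {y ∷ xs} h (here refl) with p y
... | true = refl
all-elim p {y ∷ xs} h (there q) with p y
... | true = all-elim p h q

∧-true : ∀ {a b} → a ∧ b ≡ true → a ≡ true × b ≡ true
∧-true {true} {true} h = refl , refl

true≢false : ∀ {b : Bool} {C : Set} → b ≡ true → b ≡ false → C
true≢false refl ()

¬true⇒false : ∀ {b : Bool} → ¬ (b ≡ true) → b ≡ false
¬true⇒false {true}  h = contradiction refl h
¬true⇒false {false} h = refl

bool-≡ : ∀ {a b} → (a ≡ true → b ≡ true) → (b ≡ true → a ≡ true) → a ≡ b
bool-≡ {true}  {b}     f g = sym (f refl)
bool-≡ {false} {true}  f g = g refl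
bool-≡ {false} {false} f g = refl

add : ∀ {m} → EdgeSet m → Fin m → EdgeSet m
add S e = updateAt S e (λ _ → true)

lookup-add : ∀ {m} (S : EdgeSet m) k → lookup (add S k) k ≡ true
lookup-add S k = VP.lookup∘updateAt k S

lookup-add-≢ : ∀ {m} (S : EdgeSet m) {k e} → e ≢ k → lookup (add S k) e ≡ lookup S e
lookup-add-≢ S {k} {e} e≢k = VP.lookup∘updateAt′ e k e≢k S

lookup-add-⊇ : ∀ {m} (S : EdgeSet m) {k e} → lookup S e ≡ true → lookup (add S k) e ≡ true
lookup-add-⊇ S {k} {e} h with e ≟ k
... | yes refl = lookup-add S k
... | no  p    = trans (lookup-add-≢ S p) h

-- Moore–Penrose inverses as averages

infixl 7 _∙_
infix 4 _≈_

Rect : ℕ → ℕ → Set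
Rect a b = Fin a → Fin b → ℚ

_∙_ : ∀ {a b c} → Rect a b → Rect b c → Rect a c
(A ∙ B) i j = ∑ (allFin _) (λ k → A i k * B k j)

_≈_ : ∀ {a b} → Rect a b → Rect a b → Set
A ≈ B = ∀ i j → A i j ≡ B i j

_ᵗ : ∀ {a b} → Rect a b → Rect b a
(A ᵗ) i j = A j i

≈-refl : ∀ {a b} {A : Rect a b} → A ≈ A
≈-refl i j = refl

≈-sym : ∀ {a b} {A B : Rect a b} → A ≈ B → B ≈ A
≈-sym h i j = sym (h i j)

≈-trans : ∀ {a b} {A B C : Rect a b} → A ≈ B → B ≈ C → A ≈ C
≈-trans g h i j = trans (g i j) (h i j)

∙-cong : ∀ {a b c} {A A' : Rect a b} {B B' : Rect b c} → A ≈ A' → B ≈ B' → A ∙ B ≈ A' ∙ B'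
∙-cong g h i j = ∑-cong (allFin _) (λ k → cong₂ _*_ (g i k) (h k j))

∙-congˡ : ∀ {a b c} (A : Rect a b) {B B' : Rect b c} → B ≈ B' → A ∙ B ≈ A ∙ B'
∙-congˡ A h = ∙-cong (≈-refl {A = A}) h

∙-congʳ : ∀ {a b c} {A A' : Rect a b} (B : Rect b c) → A ≈ A' → A ∙ B ≈ A' ∙ B
∙-congʳ B h = ∙-cong h (≈-refl {A = B})

∙-assoc : ∀ {a b c d} (A : Rect a b) (B : Rect b c) (C : Rect c d) → (A ∙ B) ∙ C ≈ A ∙ (B ∙ C)
∙-assoc A B C i j =
  trans (∑-cong (allFin _) (λ k → ∑-*ʳ (allFin _) (C k j) (λ l → A i l * B l k)))
  (trans (∑-swap (allFin _) (allFin _) (λ k l → A i l * B l k * C k j))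
  (∑-cong (allFin _) (λ l → trans
    (∑-cong (allFin _) (λ k → ℚP.*-assoc (A i l) (B l k) (C k j)))
    (sym (∑-*ˡ (allFin _) (A i l) (λ k → B l k * C k j))))))

ᵗ-∙ : ∀ {a b c} (A : Rect a b) (B : Rect b c) → (A ∙ B) ᵗ ≈ (B ᵗ) ∙ (A ᵗ)
ᵗ-∙ A B i j = ∑-cong (allFin _) (λ k → ℚP.*-comm (A j k) (B k i))

idMat-∙ : ∀ {a b} (A : Rect a b) → idMat ∙ A ≈ A
idMat-∙ A i j = trans (∑-cong (allFin _) (λ k → cong (_* A k j) (flip-ι k)))
  (∑-δ (λ k → A k j) i)
  where
  flip-ι : ∀ k → idMat i k ≡ ι (k == i)
  flip-ι k rewrite ==-sym i k with k == i
  ... | true  = refl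
  ... | false = refl

∙-idMat : ∀ {a b} (A : Rect a b) → A ∙ idMat ≈ A
∙-idMat A i j = trans (∑-cong (allFin _) (λ k → trans (ℚP.*-comm (A i k) _) (cong (_* A i k) (to-ι k))))
  (∑-δ (A i) j)
  where
  to-ι : ∀ k → idMat k j ≡ ι (k == j)
  to-ι k with k == j
  ... | true  = refl
  ... | false = refl

-- Penrose's argument: (A X)(A Y) = A Y and (A Y)(A X) = A X, and transposing the first, with all
-- factors symmetric, gives A X = A Y; likewise X A = Y A. Then X = X A X = X A Y = Y A Y = Y.
pseudoInverse-unique : ∀ {n} {A X Y : Mat n} → IsPseudoInverse A X → IsPseudoInverse A Y → X ≐ Y
pseudoInverse-unique {A = A} {X} {Y} (axa , xax , ax , xa) (aya , yay , ay , ya) =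
  ≈-trans (≈-sym xax) (≈-trans (∙-assoc X A X) (≈-trans (∙-congˡ X AX≈AY)
    (≈-trans (≈-sym (∙-assoc X A Y)) (≈-trans (∙-congʳ Y XA≈YA) yay))))
  where
  AXAY : (A ∙ X) ∙ (A ∙ Y) ≈ A ∙ Y
  AXAY = ≈-trans (≈-sym (∙-assoc (A ∙ X) A Y)) (∙-congʳ Y axa)
  AYAX : (A ∙ Y) ∙ (A ∙ X) ≈ A ∙ X
  AYAX = ≈-trans (≈-sym (∙-assoc (A ∙ Y) A X)) (∙-congʳ X aya)
  AX≈AY : A ∙ X ≈ A ∙ Y
  AX≈AY = ≈-trans (≈-sym AYAX) (≈-trans (∙-cong (≈-sym ay) (≈-sym ax))
    (≈-trans (≈-sym (ᵗ-∙ (A ∙ X) (A ∙ Y))) (≈-trans (λ i j → AXAY j i) ay)))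
  XAYA : (X ∙ A) ∙ (Y ∙ A) ≈ X ∙ A
  XAYA = ≈-trans (∙-assoc X A (Y ∙ A)) (∙-congˡ X (≈-trans (≈-sym (∙-assoc A Y A)) aya))
  YAXA : (Y ∙ A) ∙ (X ∙ A) ≈ Y ∙ A
  YAXA = ≈-trans (∙-assoc Y A (X ∙ A)) (∙-congˡ Y (≈-trans (≈-sym (∙-assoc A X A)) axa))
  XA≈YA : X ∙ A ≈ Y ∙ A
  XA≈YA = ≈-trans (≈-sym xa) (≈-trans (λ i j → sym (XAYA j i)) (≈-trans (ᵗ-∙ (X ∙ A) (Y ∙ A))
    (≈-trans (∙-cong ya xa) YAXA)))

-- Reindexing along the bijection `add S k` from sets avoiding `k` to sets containing it. Afterwards
-- the terms for different `k` share the same `S` and can be compared.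
∑-exchange : ∀ m (k : Fin m) (F : EdgeSet m → ℚ) →
  ∑ (allSets m) (λ H → ι (lookup H k) * F H) ≡
  ∑ (allSets m) (λ S → ι (not (lookup S k)) * F (add S k))
∑-exchange (suc m) k F = trans (halves (λ H → ι (lookup H k) * F H))
  (trans (go k) (sym (halves (λ S → ι (not (lookup S k)) * F (add S k)))))
  where
  halves : ∀ (G : EdgeSet (suc m) → ℚ) → ∑ (allSets (suc m)) G ≡
    ∑ (allSets m) (G ∘ (true Vec.∷_)) + ∑ (allSets m) (G ∘ (false Vec.∷_))
  halves G = trans (∑-++ (List.map (true Vec.∷_) (allSets m)) _ G)
    (cong₂ _+_ (∑-map (true Vec.∷_) (allSets m) G) (∑-map (false Vec.∷_) (allSets m) G))
  go : ∀ k → ∑ (allSets m) (λ H → ι (lookup (true Vec.∷ H) k) * F (true Vec.∷ H)) +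
             ∑ (allSets m) (λ H → ι (lookup (false Vec.∷ H) k) * F (false Vec.∷ H)) ≡
             ∑ (allSets m) (λ H → ι (not (lookup (true Vec.∷ H) k)) * F (add (true Vec.∷ H) k)) +
             ∑ (allSets m) (λ H → ι (not (lookup (false Vec.∷ H) k)) * F (add (false Vec.∷ H) k))
  -- On the first coordinate the two halves trade places: the nonzero terms sit with `true` on the
  -- left and with `false` on the right.
  go zero = trans (cong (∑ (allSets m) (λ H → 1ℚ * F (true Vec.∷ H)) +_)
      (∑-zero (allSets m) (λ H → ℚP.*-zeroˡ (F (false Vec.∷ H)))))
    (trans (ℚP.+-comm (∑ (allSets m) (λ H → 1ℚ * F (true Vec.∷ H))) 0ℚ)
      (cong (_+ ∑ (allSets m) (λ H → 1ℚ * F (true Vec.∷ H)))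
        (sym (∑-zero (allSets m) (λ H → ℚP.*-zeroˡ (F (true Vec.∷ H)))))))
  go (suc k) = cong₂ _+_ (∑-exchange m k (F ∘ (true Vec.∷_))) (∑-exchange m k (F ∘ (false Vec.∷_)))

-- R H k stands for row k of the pseudoinverse of the columns of ν in H, and M below is the weighted
-- average of these rows. M ⟂ ker ν holds because the terms can be regrouped by S = H ∖ k: by
-- exchange, all rows R (S ∪ k) k with fixed S are multiples of one functional φ that kills S.
module Averaging {n m} (ν : Rect n m) (P : Mat n)
  (good : EdgeSet m → Bool) (weight : EdgeSet m → ℚ) (R : EdgeSet m → Rect m n)
  (P-sym : P ᵗ ≈ P)
  (Pν : P ∙ ν ≈ ν)
  (dual : ∀ {H k e} → good H ≡ true → lookup H k ≡ true → lookup H e ≡ true →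
          (R H ∙ ν) k e ≡ ι (k == e))
  (RP : ∀ {H k} → good H ≡ true → lookup H k ≡ true → ∀ v → (R H ∙ P) k v ≡ R H k v)
  (nondegenerate : ∀ {H} → good H ≡ true → (y : Fin n → ℚ) →
     (∀ e → lookup H e ≡ true → ∑ (allFin n) (λ v → y v * ν v e) ≡ 0ℚ) →
     ∀ v → ∑ (allFin n) (λ u → y u * P u v) ≡ 0ℚ)
  (exchange : ∀ {S k₀ k} → lookup S k₀ ≡ false → lookup S k ≡ false → good (add S k₀) ≡ true →
     (R (add S k₀) ∙ ν) k₀ k ≢ 0ℚ → good (add S k) ≡ true ×
     weight (add S k) ≡ (R (add S k₀) ∙ ν) k₀ k * (R (add S k₀) ∙ ν) k₀ k * weight (add S k₀))
  where

  family : List (EdgeSet m)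
  family = filterᵇ good (allSets m)

  W : ℚ
  W = ∑ family weight

  numerator : Rect m n
  numerator k i = ∑ (filterᵇ (λ H → lookup H k) family) (λ H → weight H * R H k i)

  term : EdgeSet m → Rect m n
  term H k i = ι (good H) * (weight H * R H k i)

  numerator-allSets : ∀ k i → numerator k i ≡ ∑ (allSets m) (λ H → ι (lookup H k) * term H k i)
  numerator-allSets k i = trans (∑-filter (λ H → lookup H k) family (λ H → weight H * R H k i))
    (trans (∑-filter good (allSets m) (λ H → ι (lookup H k) * (weight H * R H k i)))
      (∑-cong (allSets m) (λ H → solve 3 (λ a b c → a :* (b :* c) := b :* (a :* c)) refl
         (ι (good H)) (ι (lookup H k)) (weight H * R H k i))))

  -- The row identities below go through this principle: form the difference of both sides, check
  -- that `P` fixes it and that the columns in one good `H` annihilate it.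
  killed : ∀ {H} → good H ≡ true → (y : Fin n → ℚ) →
    (∀ v → ∑ (allFin n) (λ u → y u * P u v) ≡ y v) →
    (∀ e → lookup H e ≡ true → ∑ (allFin n) (λ v → y v * ν v e) ≡ 0ℚ) → ∀ v → y v ≡ 0ℚ
  killed gH y yP h v = trans (sym (yP v)) (nondegenerate gH y h v)

  -- Each row of P - I vanishes on all columns of `ν` by `Pν`, so `nondegenerate` yields (P - I) P =
  -- 0.
  P-idem : ∀ {H} → good H ≡ true → P ∙ P ≈ P
  P-idem {H} gH v w = trans (solve 2 (λ a b → a := (a :- b) :+ b) refl ((P ∙ P) v w) (P v w))
    (trans (cong (_+ P v w) diff) (ℚP.+-identityˡ (P v w)))
    where
    y : Fin n → ℚ
    y u = P v u - idMat v u
    y-mult : ∀ {c} (B : Rect n c) w → ∑ (allFin n) (λ u → y u * B u w) ≡ (P ∙ B) v w - B v w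
    y-mult B w = trans (∑-cong (allFin n) (λ u → solve 3 (λ a b c → (a :- b) :* c := a :* c :- b :* c)
                          refl (P v u) (idMat v u) (B u w)))
      (trans (∑-minus (allFin n) (λ u → P v u * B u w) (λ u → idMat v u * B u w))
        (cong (λ q → (P ∙ B) v w - q) (idMat-∙ B v w)))
    diff : (P ∙ P) v w - P v w ≡ 0ℚ
    diff = trans (sym (y-mult P w)) (nondegenerate gH y
      (λ e _ → trans (y-mult ν e) (trans (cong (_- ν v e) (Pν v e)) (ℚP.+-inverseʳ (ν v e)))) w)

  -- By `dual` and `Pν` both sides, as rows in `u`, have the same product with each column in `H`;
  -- by `RP` and `P-idem` both are fixed by `P`. Hence `killed` applies to the difference.
  restricted-inverse : ∀ {H} → good H ≡ true → ∀ v u →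
    ∑ (allFin m) (λ k → ν v k * (ι (lookup H k) * R H k u)) ≡ P v u
  restricted-inverse {H} gH v u = trans
    (solve 2 (λ a b → a := (a :- b) :+ b) refl (Z u) (P v u))
    (trans (cong (_+ P v u) (killed gH y yP yν u)) (ℚP.+-identityˡ (P v u)))
    where
    Z : Fin n → ℚ
    Z u = ∑ (allFin m) (λ k → ν v k * (ι (lookup H k) * R H k u))
    y : Fin n → ℚ
    y u = Z u - P v u
    y-mult : ∀ {c} (B : Rect n c) w → ∑ (allFin n) (λ u → y u * B u w) ≡
      ∑ (allFin m) (λ k → ν v k * (ι (lookup H k) * (R H ∙ B) k w)) - (P ∙ B) v w
    y-mult B w = trans (∑-cong (allFin n) (λ u → solve 3 (λ a b c → (a :- b) :* c := a :* c :- b :* c)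
                          refl (Z u) (P v u) (B u w)))
      (trans (∑-minus (allFin n) (λ u → Z u * B u w) (λ u → P v u * B u w))
       (cong (_- (P ∙ B) v w)
        (trans (∑-cong (allFin n) (λ u → ∑-*ʳ (allFin m) (B u w) (λ k → ν v k * (ι (lookup H k) * R H k u))))
        (trans (∑-swap (allFin n) (allFin m) (λ u k → ν v k * (ι (lookup H k) * R H k u) * B u w))
        (∑-cong (allFin m) (λ k → trans
           (∑-cong (allFin n) (λ u → solve 4 (λ a b c d → a :* (b :* c) :* d := (a :* b) :* (c :* d)) refl
              (ν v k) (ι (lookup H k)) (R H k u) (B u w)))
           (trans (sym (∑-*ˡ (allFin n) (ν v k * ι (lookup H k)) (λ u → R H k u * B u w)))
             (ℚP.*-assoc (ν v k) (ι (lookup H k)) ((R H ∙ B) k w)))))))))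
    yP : ∀ w → ∑ (allFin n) (λ u → y u * P u w) ≡ y w
    yP w = trans (y-mult P w) (cong₂ _-_ (∑-cong (allFin m) row) (P-idem gH v w))
      where
      row : ∀ k → ν v k * (ι (lookup H k) * (R H ∙ P) k w) ≡ ν v k * (ι (lookup H k) * R H k w)
      row k with lookup H k in eq
      ... | true  = cong (λ q → ν v k * (1ℚ * q)) (RP gH eq w)
      ... | false = cong (ν v k *_) (trans (ℚP.*-zeroˡ ((R H ∙ P) k w)) (sym (ℚP.*-zeroˡ (R H k w))))
    yν : ∀ e → lookup H e ≡ true → ∑ (allFin n) (λ u → y u * ν u e) ≡ 0ℚ
    yν e e∈ = trans (y-mult ν e) (trans (cong₂ _-_
      (trans (∑-cong (allFin m) row) (∑-δ (ν v) e)) (Pν v e)) (ℚP.+-inverseʳ (ν v e)))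
      where
      row : ∀ k → ν v k * (ι (lookup H k) * (R H ∙ ν) k e) ≡ ι (k == e) * ν v k
      row k with lookup H k in eq
      ... | true  = trans (cong (λ q → ν v k * (1ℚ * q)) (dual gH eq e∈))
                      (solve 2 (λ a b → a :* (con 1ℚ :* b) := b :* a) refl (ν v k) (ι (k == e)))
      ... | false = trans (cong (ν v k *_) (ℚP.*-zeroˡ ((R H ∙ ν) k e))) (trans (ℚP.*-zeroʳ (ν v k))
          (sym (trans (cong (λ b → ι b * ν v k) (==-≢ {i = k} {e} λ { refl → true≢false e∈ eq }))
                      (ℚP.*-zeroˡ (ν v k)))))

  -- Summing over `k` inside each `H` first leaves `weight H` times `restricted-inverse`, and the
  -- weights add up to `W`.
  ν-numerator : ∀ v u → (ν ∙ numerator) v u ≡ W * P v u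
  ν-numerator v u =
    trans (∑-cong (allFin m) (λ k → trans (cong (ν v k *_) (numerator-allSets k u))
                                          (∑-*ˡ (allSets m) (ν v k) (λ H → ι (lookup H k) * term H k u))))
    (trans (∑-swap (allFin m) (allSets m) (λ k H → ν v k * (ι (lookup H k) * term H k u)))
    (trans (∑-cong (allSets m) perSet)
    (trans (sym (∑-*ʳ (allSets m) (P v u) (λ H → ι (good H) * weight H)))
           (cong (_* P v u) (sym (∑-filter good (allSets m) weight))))))
    where
    perSet : ∀ H → ∑ (allFin m) (λ k → ν v k * (ι (lookup H k) * term H k u)) ≡
                   ι (good H) * weight H * P v u
    perSet H = trans
      (∑-cong (allFin m) (λ k → solve 5 (λ a b c d e → a :* (b :* (c :* (d :* e))) := (c :* d) :* (a :* (b :* e)))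
         refl (ν v k) (ι (lookup H k)) (ι (good H)) (weight H) (R H k u)))
      (trans (sym (∑-*ˡ (allFin m) (ι (good H) * weight H) (λ k → ν v k * (ι (lookup H k) * R H k u)))) last)
      where
      last : ι (good H) * weight H * ∑ (allFin m) (λ k → ν v k * (ι (lookup H k) * R H k u)) ≡
             ι (good H) * weight H * P v u
      last with good H in eq
      ... | true  = cong (1ℚ * weight H *_) (restricted-inverse eq v u)
      ... | false = solve 3 (λ a b c → (con 0ℚ :* a) :* b := (con 0ℚ :* a) :* c) refl (weight H) _ (P v u)

  module _ (f : Fin m → ℚ) (νf : ∀ v → ∑ (allFin m) (λ k → ν v k * f k) ≡ 0ℚ) (i : Fin n) where

    perRemoved : ∀ S → ∑ (allFin m) (λ k → f k * (ι (not (lookup S k)) * term (add S k) k i)) ≡ 0ℚ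
    perRemoved S with any (λ k → not (lookup S k) ∧ good (add S k)) (allFin m) in eq
    ... | false = ∑-zero (allFin m) zero-term
      where
      zero-term : ∀ k → f k * (ι (not (lookup S k)) * term (add S k) k i) ≡ 0ℚ
      zero-term k with not (lookup S k) | good (add S k) |
                       any-false (λ k → not (lookup S k) ∧ good (add S k)) eq (MemP.∈-allFin k)
      ... | false | b     | h = solve 2 (λ a b → a :* (con 0ℚ :* b) := con 0ℚ) refl (f k) (ι b * (weight (add S k) * R (add S k) k i))
      ... | true  | false | h = solve 2 (λ a b → a :* (con 1ℚ :* (con 0ℚ :* b)) := con 0ℚ) refl (f k) (weight (add S k) * R (add S k) k i)
    -- Any edge completing `S` to a good set can serve as the reference `k₀`; its row is the
    -- functional `φ` against which the other completions are measured.
    ... | true with any-elim (λ k → not (lookup S k) ∧ good (add S k)) (allFin m) eq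
    ... | k₀ , hk₀ with ∧-true {not (lookup S k₀)} hk₀
    ... | k₀∉' , good₀ = trans (∑-cong (allFin m) termwise)
        (trans (sym (∑-*ˡ (allFin m) (weight H₀ * φ i) (λ k → f k * p k)))
        (trans (cong (weight H₀ * φ i *_) φνf) (ℚP.*-zeroʳ (weight H₀ * φ i))))
      where
      k₀∉ : lookup S k₀ ≡ false
      k₀∉ with lookup S k₀
      ... | false = refl
      H₀ : EdgeSet m
      H₀ = add S k₀
      φ : Fin n → ℚ
      φ = R H₀ k₀
      p : Fin m → ℚ
      p k = (R H₀ ∙ ν) k₀ k
      φνf : ∑ (allFin m) (λ k → f k * p k) ≡ 0ℚ
      φνf = trans (∑-cong (allFin m) (λ k → ∑-*ˡ (allFin n) (f k) (λ v → φ v * ν v k)))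
        (trans (∑-swap (allFin m) (allFin n) (λ k v → f k * (φ v * ν v k)))
        (∑-zero (allFin n) (λ v → trans
          (∑-cong (allFin m) (λ k → solve 3 (λ a b c → a :* (b :* c) := b :* (c :* a)) refl (f k) (φ v) (ν v k)))
          (trans (sym (∑-*ˡ (allFin m) (φ v) (λ k → ν v k * f k)))
            (trans (cong (φ v *_) (νf v)) (ℚP.*-zeroʳ (φ v)))))))
      p-S : ∀ e → lookup S e ≡ true → p e ≡ 0ℚ
      p-S e e∈ = trans (dual good₀ (lookup-add S k₀) (lookup-add-⊇ S e∈))
        (cong ι (==-≢ {i = k₀} {e} λ { refl → true≢false e∈ k₀∉ }))
      φP : ∀ v → ∑ (allFin n) (λ u → φ u * P u v) ≡ φ v
      φP = RP good₀ (lookup-add S k₀)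
      φ-add : ∀ k → p k ≡ 0ℚ → ∀ e → lookup (add S k) e ≡ true → p e ≡ 0ℚ
      φ-add k pk e e∈ with e ≟ k
      ... | yes refl = pk
      ... | no  e≢k  = p-S e (trans (sym (lookup-add-≢ S e≢k)) e∈)
      -- Otherwise `φ` would vanish on every column in a good set and be zero by `killed`, although
      -- it takes the value 1 on column `k₀`.
      bad : ∀ k → p k ≡ 0ℚ → good (add S k) ≡ false
      bad k pk = ¬true⇒false λ gk → case trans (sym
          (trans (dual good₀ (lookup-add S k₀) (lookup-add S k₀)) (cong ι (==-refl k₀))))
          (∑-zero (allFin n) (λ v → trans (cong (_* ν v k₀) (killed gk φ φP (φ-add k pk) v)) (ℚP.*-zeroˡ (ν v k₀))))
        of λ ()
      -- Both sides vanish on `S` and agree on column `k`, so `killed` for `add S k` identifies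
      -- them.
      proportional : ∀ k → good (add S k) ≡ true → p k * R (add S k) k i ≡ φ i
      proportional k gk = trans (solve 2 (λ a b → a := (a :- b) :+ b) refl _ (φ i))
        (trans (cong (_+ φ i) (killed gk y yP yν i)) (ℚP.+-identityˡ (φ i)))
        where
        y : Fin n → ℚ
        y v = p k * R (add S k) k v - φ v
        y-mult : ∀ {c} (B : Rect n c) w → ∑ (allFin n) (λ u → y u * B u w) ≡
          p k * (R (add S k) ∙ B) k w - (R H₀ ∙ B) k₀ w
        y-mult B w = trans
          (∑-cong (allFin n) (λ u → solve 4 (λ a b c d → (a :* b :- c) :* d := a :* (b :* d) :- c :* d) refl
             (p k) (R (add S k) k u) (φ u) (B u w)))
          (trans (∑-minus (allFin n) (λ u → p k * (R (add S k) k u * B u w)) (λ u → φ u * B u w))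
            (cong (_- (R H₀ ∙ B) k₀ w) (sym (∑-*ˡ (allFin n) (p k) (λ u → R (add S k) k u * B u w)))))
        yP : ∀ v → ∑ (allFin n) (λ u → y u * P u v) ≡ y v
        yP v = trans (y-mult P v) (cong₂ (λ a b → p k * a - b) (RP gk (lookup-add S k) v) (φP v))
        yν : ∀ e → lookup (add S k) e ≡ true → ∑ (allFin n) (λ u → y u * ν u e) ≡ 0ℚ
        yν e e∈ = trans (y-mult ν e) (trans (cong (λ q → p k * q - p e) (dual gk (lookup-add S k) e∈)) fin)
          where
          fin : p k * ι (k == e) - p e ≡ 0ℚ
          fin with k ≟ e
          ... | yes refl = solve 1 (λ a → a :* con 1ℚ :- a := con 0ℚ) refl (p k)
          ... | no  k≢e  = trans (cong (λ q → p k * 0ℚ - q) (p-S e (trans (sym (lookup-add-≢ S (k≢e ∘ sym))) e∈)))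
                             (solve 1 (λ a → a :* con 0ℚ :- con 0ℚ := con 0ℚ) refl (p k))
      -- This is where the weights must scale by a square: of the two factors `p k` supplied by
      -- `exchange`, one is absorbed in replacing `R (add S k) k` by `φ`, and the other is left to
      -- pair with `f k`, where `φνf` makes the sum vanish.
      termwise : ∀ k → f k * (ι (not (lookup S k)) * term (add S k) k i) ≡ weight H₀ * φ i * (f k * p k)
      termwise k = aux (lookup S k) refl (p k ℚP.≟ 0ℚ)
        where
        aux : ∀ b → lookup S k ≡ b → Dec (p k ≡ 0ℚ) →
          f k * (ι (not b) * term (add S k) k i) ≡ weight H₀ * φ i * (f k * p k)
        aux true k∈ _ = trans (solve 3 (λ a b c → a :* (con 0ℚ :* b) := c :* (a :* con 0ℚ)) refl
            (f k) (term (add S k) k i) (weight H₀ * φ i))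
          (cong (λ q → weight H₀ * φ i * (f k * q)) (sym (p-S k k∈)))
        aux false k∉ (yes pk) = trans
          (cong (λ b → f k * (1ℚ * (ι b * (weight (add S k) * R (add S k) k i)))) (bad k pk))
          (trans (solve 3 (λ a b c → a :* (con 1ℚ :* (con 0ℚ :* b)) := c :* (a :* con 0ℚ)) refl
            (f k) (weight (add S k) * R (add S k) k i) (weight H₀ * φ i))
            (cong (λ q → weight H₀ * φ i * (f k * q)) (sym pk)))
        aux false k∉ (no pk) with exchange k₀∉ k∉ good₀ pk
        ... | gk , wk = trans
          (cong₂ (λ b x → f k * (1ℚ * (ι b * (x * R (add S k) k i)))) gk wk)
          (trans (solve 4 (λ a p w r → a :* (con 1ℚ :* (con 1ℚ :* (p :* p :* w :* r))) := w :* (p :* r) :* (a :* p))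
             refl (f k) (p k) (weight H₀) (R (add S k) k i))
             (cong (λ q → weight H₀ * q * (f k * p k)) (proportional k gk)))

    numerator-⊥ : ∑ (allFin m) (λ k → f k * numerator k i) ≡ 0ℚ
    numerator-⊥ =
      trans (∑-cong (allFin m) (λ k → cong (f k *_) (trans (numerator-allSets k i)
        (∑-exchange m k (λ H → term H k i)))))
      (trans (∑-cong (allFin m) (λ k → ∑-*ˡ (allSets m) (f k) (λ S → ι (not (lookup S k)) * term (add S k) k i)))
      (trans (∑-swap (allFin m) (allSets m) (λ k S → f k * (ι (not (lookup S k)) * term (add S k) k i)))
      (∑-zero (allSets m) perRemoved)))

  -- Written so that, for the data of the unbalanced case, it unfolds to `formulaB`.
  Y : Mat n
  Y i j = inv (W * W) * ∑ (allFin m) (λ k → numerator k i * numerator k j)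

  module _ (W≢0 : W ≢ 0ℚ) where

    M : Rect m n
    M k i = inv W * numerator k i

    νM : ν ∙ M ≈ P
    νM v u = trans (∑-cong (allFin m) (λ k → solve 3 (λ a b c → a :* (b :* c) := b :* (a :* c)) refl
                      (ν v k) (inv W) (numerator k u)))
      (trans (sym (∑-*ˡ (allFin m) (inv W) (λ k → ν v k * numerator k u)))
      (trans (cong (inv W *_) (ν-numerator v u))
      (trans (solve 3 (λ a b c → a :* (b :* c) := (b :* a) :* c) refl (inv W) W (P v u))
      (trans (cong (_* P v u) (inv-* W≢0)) (ℚP.*-identityˡ (P v u))))))

    Y-MᵗM : Y ≈ (M ᵗ) ∙ M
    Y-MᵗM i j = trans (cong (_* ∑ (allFin m) (λ k → numerator k i * numerator k j)) (inv-*-distrib W≢0 W≢0))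
      (trans (∑-*ˡ (allFin m) (inv W * inv W) (λ k → numerator k i * numerator k j))
      (∑-cong (allFin m) (λ k → solve 3 (λ a x y → a :* a :* (x :* y) := (a :* x) :* (a :* y)) refl
         (inv W) (numerator k i) (numerator k j))))

    Y-sym : Y ᵗ ≈ Y
    Y-sym i j = cong (inv (W * W) *_) (∑-cong (allFin m) (λ k → ℚP.*-comm (numerator k j) (numerator k i)))

    -- The columns of Mν - I lie in the kernel of `ν`, because νMν = Pν = ν, and `numerator-⊥` makes
    -- them orthogonal to the columns of `M`.
    MᵗMν : ((M ᵗ) ∙ M) ∙ ν ≈ M ᵗ
    MᵗMν i e = trans (∙-assoc (M ᵗ) M ν i e)
      (trans (solve 2 (λ a b → a := (a :- b) :+ b) refl (((M ᵗ) ∙ (M ∙ ν)) i e) (M e i))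
      (trans (cong (_+ M e i) (trans (sym split) ⊥M)) (ℚP.+-identityˡ (M e i))))
      where
      f : Fin m → ℚ
      f k = (M ∙ ν) k e - idMat k e
      νf : ∀ v → ∑ (allFin m) (λ k → ν v k * f k) ≡ 0ℚ
      νf v = trans (∑-cong (allFin m) (λ k → solve 3 (λ a b c → a :* (b :- c) := a :* b :- a :* c) refl
                      (ν v k) ((M ∙ ν) k e) (idMat k e)))
        (trans (∑-minus (allFin m) (λ k → ν v k * (M ∙ ν) k e) (λ k → ν v k * idMat k e))
        (trans (cong₂ _-_ (trans (sym (∙-assoc ν M ν v e)) (trans (∙-congʳ ν νM v e) (Pν v e))) (∙-idMat ν v e))
          (ℚP.+-inverseʳ (ν v e))))
      ⊥M : ∑ (allFin m) (λ k → M k i * f k) ≡ 0ℚ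
      ⊥M = trans (∑-cong (allFin m) (λ k → solve 3 (λ a b c → (a :* b) :* c := a :* (c :* b)) refl
                    (inv W) (numerator k i) (f k)))
        (trans (sym (∑-*ˡ (allFin m) (inv W) (λ k → f k * numerator k i)))
        (trans (cong (inv W *_) (numerator-⊥ f νf i)) (ℚP.*-zeroʳ (inv W))))
      split : ∑ (allFin m) (λ k → M k i * f k) ≡ ((M ᵗ) ∙ (M ∙ ν)) i e - M e i
      split = trans (∑-cong (allFin m) (λ k → solve 3 (λ a b c → a :* (b :- c) := a :* b :- a :* c) refl
                      (M k i) ((M ∙ ν) k e) (idMat k e)))
        (trans (∑-minus (allFin m) (λ k → M k i * (M ∙ ν) k e) (λ k → M k i * idMat k e))
          (cong (λ q → ((M ᵗ) ∙ (M ∙ ν)) i e - q) (∙-idMat (M ᵗ) i e)))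

    L : Mat n
    L = ν ∙ (ν ᵗ)

    YL : Y ∙ L ≈ P
    YL = ≈-trans (≈-sym (∙-assoc Y ν (ν ᵗ))) (≈-trans (∙-congʳ (ν ᵗ) (≈-trans (∙-congʳ ν Y-MᵗM) MᵗMν))
      (≈-trans (≈-sym (ᵗ-∙ ν M)) (≈-trans (λ i j → νM j i) P-sym)))

    L-sym : L ᵗ ≈ L
    L-sym = ᵗ-∙ ν (ν ᵗ)

    LY : L ∙ Y ≈ P
    LY = ≈-trans (∙-cong (≈-sym L-sym) (≈-sym Y-sym)) (≈-trans (≈-sym (ᵗ-∙ Y L))
      (≈-trans (λ i j → YL j i) P-sym))

    MP : M ∙ P ≈ M
    MP k v = trans (∑-cong (allFin n) (λ u → ℚP.*-assoc (inv W) (numerator k u) (P u v)))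
      (trans (sym (∑-*ˡ (allFin n) (inv W) (λ u → numerator k u * P u v)))
      (cong (inv W *_) (trans (∑-cong (allFin n) (λ u → trans (cong (_* P u v) (numerator-allSets k u))
          (∑-*ʳ (allSets m) (P u v) (λ H → ι (lookup H k) * term H k u))))
        (trans (∑-swap (allFin n) (allSets m) (λ u H → ι (lookup H k) * term H k u * P u v))
        (trans (∑-cong (allSets m) perSet) (sym (numerator-allSets k v)))))))
      where
      perSet : ∀ H → ∑ (allFin n) (λ u → ι (lookup H k) * term H k u * P u v) ≡ ι (lookup H k) * term H k v
      perSet H = trans (∑-cong (allFin n) (λ u → solve 5 (λ a b c d e → a :* (b :* (c :* d)) :* e := (a :* (b :* c)) :* (d :* e))
          refl (ι (lookup H k)) (ι (good H)) (weight H) (R H k u) (P u v)))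
        (trans (sym (∑-*ˡ (allFin n) (ι (lookup H k) * (ι (good H) * weight H)) (λ u → R H k u * P u v))) last)
        where
        last : ι (lookup H k) * (ι (good H) * weight H) * (R H ∙ P) k v ≡ ι (lookup H k) * term H k v
        last with lookup H k in k∈ | good H in gH
        ... | true  | true  = trans (cong (1ℚ * (1ℚ * weight H) *_) (RP gH k∈ v))
               (solve 2 (λ a b → con 1ℚ :* (con 1ℚ :* a) :* b := con 1ℚ :* (con 1ℚ :* (a :* b))) refl (weight H) (R H k v))
        ... | true  | false = solve 3 (λ a b c → con 1ℚ :* (con 0ℚ :* a) :* c := con 1ℚ :* (con 0ℚ :* (a :* b))) refl
               (weight H) (R H k v) ((R H ∙ P) k v)
        ... | false | b     = solve 4 (λ g a b c → con 0ℚ :* (g :* a) :* c := con 0ℚ :* (g :* (a :* b))) refl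
               (ι b) (weight H) (R H k v) ((R H ∙ P) k v)

    -- Both L Y and Y L are the symmetric matrix `P`, so the four conditions reduce to P L = L, from
    -- `Pν`, and Y P = Y, from `MP`.
    isPseudoInverse : IsPseudoInverse L Y
    isPseudoInverse =
        ≈-trans (∙-congʳ L LY) (≈-trans (≈-sym (∙-assoc P ν (ν ᵗ))) (∙-congʳ (ν ᵗ) Pν))
      , ≈-trans (∙-assoc Y L Y) (≈-trans (∙-congˡ Y LY) (≈-trans (∙-congʳ P Y-MᵗM)
          (≈-trans (∙-assoc (M ᵗ) M P) (≈-trans (∙-congˡ (M ᵗ) MP) (≈-sym Y-MᵗM)))))
      , ≈-trans (λ i j → LY j i) (≈-trans P-sym (≈-sym LY))
      , ≈-trans (λ i j → YL j i) (≈-trans P-sym (≈-sym YL))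

-- Walks and reachability

Unique-lookup-injective : ∀ {A : Set} {xs : List A} → Unique xs →
  ∀ {i j} → List.lookup xs i ≡ List.lookup xs j → i ≡ j
Unique-lookup-injective (p ∷ u) {zero}  {zero}  h = refl
Unique-lookup-injective (p ∷ u) {zero}  {suc j} h = contradiction h (All.lookup p (MemP.∈-lookup j))
Unique-lookup-injective (p ∷ u) {suc i} {zero}  h = contradiction (sym h) (All.lookup p (MemP.∈-lookup i))
Unique-lookup-injective (p ∷ u) {suc i} {suc j} h = cong suc (Unique-lookup-injective u h)

Unique-length≤ : ∀ {n} {xs : List (Fin n)} → Unique xs → length xs ≤ n
Unique-length≤ u = FP.injective⇒≤ (Unique-lookup-injective u)

firstJust-just : ∀ {n m} (Γ : SignedGraph n m) {A B : Set} (f : A → Maybe B) (xs : List A) {b} →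
  firstJust Γ (List.map f xs) ≡ just b → ∃ λ x → f x ≡ just b
firstJust-just Γ f (x ∷ xs) h with f x in eq
... | just b  = x , trans eq h
... | nothing = firstJust-just Γ f xs h

firstJust-nothing : ∀ {n m} (Γ : SignedGraph n m) {A B : Set} (f : A → Maybe B) {xs : List A} →
  firstJust Γ (List.map f xs) ≡ nothing → ∀ {x} → x ∈ xs → f x ≡ nothing
firstJust-nothing Γ f {y ∷ xs} h x∈ with f y in eq
firstJust-nothing Γ f {y ∷ xs} h (here refl) | nothing = eq
firstJust-nothing Γ f {y ∷ xs} h (there q)   | nothing = firstJust-nothing Γ f h q

module Reachability {n m} (Γ : SignedGraph n m) where
  open SignedGraph Γ

  src≢dst : ∀ e → src e ≢ dst e
  src≢dst e h = ℕP.<⇒≢ (ordered e) (cong toℕ h)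

  WalkOn : List (Fin m) → Fin n → Fin n → Set
  WalkOn es x y = ∃ (Walk Γ x y es)

  _++ʷ_ : ∀ {x y z es fs} → WalkOn es x y → WalkOn fs y z → WalkOn (es ++ fs) x z
  (_ , stop)    ++ʷ q = q
  (_ , fwd e p) ++ʷ q = _ , fwd e (proj₂ ((_ , p) ++ʷ q))
  (_ , bwd e p) ++ʷ q = _ , bwd e (proj₂ ((_ , p) ++ʷ q))

  walk-length : ∀ {x y es vs} → Walk Γ x y es vs → length vs ≡ length es
  walk-length stop      = refl
  walk-length (fwd e p) = cong suc (walk-length p)
  walk-length (bwd e p) = cong suc (walk-length p)

  record SplitAt (x y v : Fin n) (es : List (Fin m)) : Set where
    constructor splitAt
    field
      {before after} : List (Fin m)
      walk₁    : WalkOn before x v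
      walk₂    : WalkOn after v y
      es≡      : es ≡ before ++ after
      nonempty : 1 ≤ length after

  split-walk : ∀ {x y v es vs} → Walk Γ x y es vs → v ∈ vs → SplitAt x y v es
  split-walk (fwd e p) (here refl) = splitAt (_ , stop) (_ , fwd e p) refl (s≤s z≤n)
  split-walk (bwd e p) (here refl) = splitAt (_ , stop) (_ , bwd e p) refl (s≤s z≤n)
  split-walk (fwd e p) (there q) with split-walk p q
  ... | splitAt (_ , w₁) w₂ refl ne = splitAt (_ , fwd e w₁) w₂ refl ne
  split-walk (bwd e p) (there q) with split-walk p q
  ... | splitAt (_ , w₁) w₂ refl ne = splitAt (_ , bwd e w₁) w₂ refl ne

  -- The vertex list of a walk records departures, so a repeated vertex is left twice and something
  -- follows the loop. `after-nonempty` keeps this: even in a closed walk the loop is a proper part,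
  -- and an induction on length applies to the loop as well as to what remains.
  record Detour (x y : Fin n) (es : List (Fin m)) : Set where
    constructor detour
    field
      {before loop after} : List (Fin m)
      {turn} : Fin n
      walk₁ : WalkOn before x turn
      walk₂ : WalkOn loop turn turn
      walk₃ : WalkOn after turn y
      es≡   : es ≡ before ++ loop ++ after
      loop-nonempty  : 1 ≤ length loop
      after-nonempty : 1 ≤ length after

  unique-or-detour : ∀ {x y es vs} → Walk Γ x y es vs → Unique vs ⊎ Detour x y es
  unique-or-detour stop = inj₁ []
  unique-or-detour (fwd {vs = vs} e p) with DecMem._∈?_ _≟_ (src e) vs
  ... | yes q with split-walk p q
  ...   | splitAt (_ , w₁) w₂ refl ne = inj₂ (detour (_ , stop) (_ , fwd e w₁) w₂ refl (s≤s z≤n) ne)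
  unique-or-detour (fwd {vs = vs} e p) | no ¬q with unique-or-detour p
  ... | inj₁ u = inj₁ (AllP.¬Any⇒All¬ vs ¬q ∷ u)
  ... | inj₂ (detour (_ , w₁) w₂ w₃ refl a b) = inj₂ (detour (_ , fwd e w₁) w₂ w₃ refl a b)
  unique-or-detour (bwd {vs = vs} e p) with DecMem._∈?_ _≟_ (dst e) vs
  ... | yes q with split-walk p q
  ...   | splitAt (_ , w₁) w₂ refl ne = inj₂ (detour (_ , stop) (_ , bwd e w₁) w₂ refl (s≤s z≤n) ne)
  unique-or-detour (bwd {vs = vs} e p) | no ¬q with unique-or-detour p
  ... | inj₁ u = inj₁ (AllP.¬Any⇒All¬ vs ¬q ∷ u)
  ... | inj₂ (detour (_ , w₁) w₂ w₃ refl a b) = inj₂ (detour (_ , bwd e w₁) w₂ w₃ refl a b)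

  detour-length : ∀ (as bs cs : List (Fin m)) → 1 ≤ length bs →
    suc (length (as ++ cs)) ≤ length (as ++ bs ++ cs)
  detour-length as bs cs h rewrite LP.length-++ as {cs} | LP.length-++ as {bs ++ cs} | LP.length-++ bs {cs} =
    subst (_≤ length as ℕ.+ (length bs ℕ.+ length cs)) (ℕP.+-suc (length as) (length cs))
      (ℕP.+-monoʳ-≤ (length as) (ℕP.+-monoˡ-≤ (length cs) h))

  Inside : EdgeSet m → List (Fin m) → Set
  Inside S = All (λ e → lookup S e ≡ true)

  Inside-drop : ∀ {S} as bs cs → Inside S (as ++ bs ++ cs) → Inside S (as ++ cs)
  Inside-drop as bs cs h = AllP.++⁺ (AllP.++⁻ˡ as h) (AllP.++⁻ʳ bs (AllP.++⁻ʳ as h))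

  -- Each detour cut out shortens the walk, and a walk that leaves no vertex twice has at most `n`
  -- edges. This justifies the bound `n` built into `reach` and `pathSign`.
  shorten : ∀ {S} fuel {x y es} → WalkOn es x y → Inside S es → length es ≤ fuel →
    ∃ λ es' → WalkOn es' x y × Inside S es' × length es' ≤ n
  shorten fuel {es = es} w h le with unique-or-detour (proj₂ w)
  ... | inj₁ u = es , w , h , subst (_≤ n) (walk-length (proj₂ w)) (Unique-length≤ u)
  shorten zero w h le | inj₂ (detour {as} {bs} {cs} w₁ w₂ w₃ refl a b) =
    contradiction (ℕP.≤-trans (detour-length as bs cs a) le) λ ()
  shorten {S} (suc fuel) w h le | inj₂ (detour {as} {bs} {cs} w₁ w₂ w₃ refl a b) =
    shorten {S} fuel (w₁ ++ʷ w₃) (Inside-drop {S} as bs cs h)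
      (ℕP.≤-pred (ℕP.≤-trans (detour-length as bs cs a) le))

  reachK-sound : ∀ {S} k {x y} → reachK Γ k S x y ≡ true →
    ∃ λ es → WalkOn es x y × Inside S es × length es ≤ k
  reachK-sound zero h with ==-true h
  ... | refl = [] , (_ , stop) , [] , z≤n
  reachK-sound {S} (suc k) {x} {y} h with reachK Γ k S x y in eq
  ... | true with reachK-sound k eq
  ...   | es , w , i , le = es , w , i , ℕP.m≤n⇒m≤1+n le
  reachK-sound {S} (suc k) {x} {y} h | false with any-elim _ (allFin m) h
  ... | e , he with lookup S e in e∈
  ... | true with src e == x in sx | reachK Γ k S (dst e) y in ry | dst e == x in dx | he
  ...   | true | true | _ | _ with ==-true sx | reachK-sound k ry
  ...     | refl | es , w , i , le = e ∷ es , (_ , fwd e (proj₂ w)) , e∈ ∷ i , s≤s le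
  reachK-sound {S} (suc k) {x} {y} h | false | e , he | true | true | false | true | he'
    with ==-true dx | reachK-sound k he'
  ... | refl | es , w , i , le = e ∷ es , (_ , bwd e (proj₂ w)) , e∈ ∷ i , s≤s le
  reachK-sound {S} (suc k) {x} {y} h | false | e , he | true | false | _ | true | he'
    with ==-true dx | reachK-sound k he'
  ... | refl | es , w , i , le = e ∷ es , (_ , bwd e (proj₂ w)) , e∈ ∷ i , s≤s le

  ∨-introʳ : ∀ {a b} → b ≡ true → a ∨ b ≡ true
  ∨-introʳ {true}  h = refl
  ∨-introʳ {false} h = h

  reachK-complete : ∀ {S} k {x y es vs} → Walk Γ x y es vs → Inside S es → length es ≤ k →
    reachK Γ k S x y ≡ true
  reachK-complete zero    {x} stop [] le = ==-refl x
  reachK-complete {S} (suc k) {x} stop [] le rewrite reachK-complete {S} k {x} stop [] z≤n = refl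
  reachK-complete {S} (suc k) {x} {y} (fwd e p) (e∈ ∷ i) (s≤s le) = ∨-introʳ
    (any-intro (λ e → lookup S e ∧ (((src e == x) ∧ reachK Γ k S (dst e) y) ∨
                          ((dst e == x) ∧ reachK Γ k S (src e) y))) (MemP.∈-allFin e) found)
    where
    found : lookup S e ∧ (((src e == x) ∧ reachK Γ k S (dst e) y) ∨
                          ((dst e == x) ∧ reachK Γ k S (src e) y)) ≡ true
    found rewrite e∈ | ==-refl (src e) | reachK-complete {S} k p i le = refl
  reachK-complete {S} (suc k) {x} {y} (bwd e p) (e∈ ∷ i) (s≤s le) = ∨-introʳ
    (any-intro (λ e → lookup S e ∧ (((src e == x) ∧ reachK Γ k S (dst e) y) ∨
                          ((dst e == x) ∧ reachK Γ k S (src e) y))) (MemP.∈-allFin e) found)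
    where
    found : lookup S e ∧ (((src e == x) ∧ reachK Γ k S (dst e) y) ∨
                          ((dst e == x) ∧ reachK Γ k S (src e) y)) ≡ true
    found rewrite e∈ | ==-refl (dst e) | reachK-complete {S} k p i le = ∨-introʳ refl

  Reach : EdgeSet m → Fin n → Fin n → Set
  Reach S x y = reach Γ S x y ≡ true

  walk⇒Reach : ∀ {S x y es} → WalkOn es x y → Inside S es → Reach S x y
  walk⇒Reach {S} w i with shorten {S} _ w i ℕP.≤-refl
  ... | es , (_ , w') , i' , le = reachK-complete n w' i' le

  Reach-refl : ∀ {S x} → Reach S x x
  Reach-refl = walk⇒Reach (_ , stop) []

  Reach-edge : ∀ {S} e → lookup S e ≡ true → Reach S (src e) (dst e)
  Reach-edge e e∈ = walk⇒Reach (_ , fwd e stop) (e∈ ∷ [])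

  Reach-edge˘ : ∀ {S} e → lookup S e ≡ true → Reach S (dst e) (src e)
  Reach-edge˘ e e∈ = walk⇒Reach (_ , bwd e stop) (e∈ ∷ [])

  Reach-trans : ∀ {S x y z} → Reach S x y → Reach S y z → Reach S x z
  Reach-trans p q with reachK-sound n p | reachK-sound n q
  ... | _ , w , i , _ | _ , w' , i' , _ = walk⇒Reach (w ++ʷ w') (AllP.++⁺ i i')

  -- Both step hypotheses receive reachability of `src e`, whichever way the edge is crossed: this
  -- is the form in which `Potential`, `Tree` and `compEdgeᵇ` place an edge in a component.
  Reach-ind : ∀ {S x} (P : Fin n → Set) →
    (∀ e → lookup S e ≡ true → Reach S x (src e) → P (src e) → P (dst e)) →
    (∀ e → lookup S e ≡ true → Reach S x (src e) → P (dst e) → P (src e)) →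
    P x → ∀ {y} → Reach S x y → P y
  Reach-ind {S} {x} P f b px r with reachK-sound n r
  ... | _ , (_ , w) , i , _ = go w i Reach-refl px
    where
    go : ∀ {u v es vs} → Walk Γ u v es vs → Inside S es → Reach S x u → P u → P v
    go stop      []       r pu = pu
    go (fwd e w) (e∈ ∷ i) r pu = go w i (Reach-trans r (Reach-edge e e∈)) (f e e∈ r pu)
    go (bwd e w) (e∈ ∷ i) r pu = go w i r' (b e e∈ r' pu)
      where
      r' : Reach S x (src e)
      r' = Reach-trans r (Reach-edge˘ e e∈)

  Reach-sym : ∀ {S x y} → Reach S x y → Reach S y x
  Reach-sym {S} {x} = Reach-ind (λ y → Reach S y x)
    (λ e e∈ _ p → Reach-trans (Reach-edge˘ e e∈) p)
    (λ e e∈ _ p → Reach-trans (Reach-edge e e∈) p) Reach-refl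

  Reach-mono : ∀ {S S'} → (∀ {e} → lookup S e ≡ true → lookup S' e ≡ true) →
    ∀ {x y} → Reach S x y → Reach S' x y
  Reach-mono {S} {S'} h {x} = Reach-ind (Reach S' x)
    (λ e e∈ _ p → Reach-trans p (Reach-edge e (h e∈)))
    (λ e e∈ _ p → Reach-trans p (Reach-edge˘ e (h e∈))) Reach-refl

  -- Known as a switching function: switching by `g` makes all edges in the component of `x`
  -- positive.
  Potential : EdgeSet m → Fin n → (Fin n → Sign) → Set
  Potential S x g = ∀ e → lookup S e ≡ true → Reach S x (src e) → g (src e) Sign.* σ e ≡ g (dst e)

  s*s*t : ∀ s t → (s Sign.* t) Sign.* t ≡ s
  s*s*t s t = trans (SP.*-assoc s t t) (trans (cong (s Sign.*_) (SP.s*s≡+ t)) (SP.*-identityʳ s))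

  -- The search returns the sign of whichever walk it meets first. Quantifying over potentials pins
  -- the value down without naming that walk.
  walkSignK-sound : ∀ {S x} k {y s} → walkSignK Γ k S x y ≡ just s →
    Reach S x y × (∀ g → Potential S x g → g x Sign.* s ≡ g y)
  walkSignK-sound {S} {x} zero {y} h with x == y in eq
  walkSignK-sound {S} {x} zero {y} refl | true with ==-true eq
  ... | refl = Reach-refl , λ g _ → SP.*-identityʳ (g x)
  walkSignK-sound {S} {x} (suc k) {y} h with walkSignK Γ k S x y in eq
  walkSignK-sound {S} {x} (suc k) {y} refl | just s = walkSignK-sound k eq
  walkSignK-sound {S} {x} (suc k) {y} h | nothing with firstJust-just Γ _ (allFin m) h
  ... | e , he with lookup S e in e∈
  ... | true with dst e == y in dy
  ...   | true with walkSignK Γ k S x (src e) in eq'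
  walkSignK-sound {S} {x} (suc k) {y} h | nothing | e , refl | true | true | just s
    with ==-true dy | walkSignK-sound k eq'
  ... | refl | r , f = Reach-trans r (Reach-edge e e∈) ,
        λ g pot → trans (sym (SP.*-assoc (g x) s (σ e))) (trans (cong (Sign._* σ e) (f g pot)) (pot e e∈ r))
  walkSignK-sound {S} {x} (suc k) {y} h | nothing | e , he | true | false with src e == y in sy
  ... | true with walkSignK Γ k S x (dst e) in eq'
  walkSignK-sound {S} {x} (suc k) {y} h | nothing | e , refl | true | false | true | just s
    with ==-true sy | walkSignK-sound k eq'
  ... | refl | r , f = Reach-trans r (Reach-edge˘ e e∈) ,
        λ g pot → trans (sym (SP.*-assoc (g x) s (σ e))) (trans (cong (Sign._* σ e)
            (trans (f g pot) (sym (pot e e∈ (Reach-trans r (Reach-edge˘ e e∈))))))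
          (s*s*t (g (src e)) (σ e)))

  walkSignK-nothing : ∀ {S x} k {y} → walkSignK Γ (suc k) S x y ≡ nothing → walkSignK Γ k S x y ≡ nothing
  walkSignK-nothing {S} {x} k {y} h with walkSignK Γ k S x y
  ... | nothing = refl

  -- The walk runs from `y` to `x` because `walkSignK` extends its walks at `y`; peeling off the
  -- first edge then follows the recursion.
  walkSignK-complete : ∀ {S x} k {y es vs} → Walk Γ y x es vs → Inside S es → length es ≤ k →
    walkSignK Γ k S x y ≢ nothing
  walkSignK-complete {S} {x} zero stop [] le h rewrite ==-refl x = case h of λ ()
  walkSignK-complete {S} {x} (suc k) w i le h = go w i le h (walkSignK-nothing k h)
    where
    go : ∀ {y es vs} → Walk Γ y x es vs → Inside S es → length es ≤ suc k →
         walkSignK Γ (suc k) S x y ≡ nothing → walkSignK Γ k S x y ≡ nothing → ⊥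
    go stop [] le h eq = walkSignK-complete k stop [] z≤n eq
    go {y} (fwd e w) (e∈ ∷ i) (s≤s le) h eq rewrite eq
      with firstJust-nothing Γ _ h (MemP.∈-allFin e)
    ... | he rewrite e∈ | ==-≢ (src≢dst e ∘ sym) | ==-refl (src e)
      with walkSignK Γ k S x (dst e) in eq'
    ...   | nothing = walkSignK-complete k w i le eq'
    go {y} (bwd e w) (e∈ ∷ i) (s≤s le) h eq rewrite eq
      with firstJust-nothing Γ _ h (MemP.∈-allFin e)
    ... | he rewrite e∈ | ==-refl (dst e)
      with walkSignK Γ k S x (src e) in eq'
    ...   | nothing = walkSignK-complete k w i le eq'

  pathSign-potential : ∀ {S x y} → Reach S x y → ∀ g → Potential S x g →
    pathSign Γ S x y ≡ signℚ (g x Sign.* g y)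
  pathSign-potential {S} {x} {y} r g pot with walkSignK Γ n S x y in eq
  ... | just s = cong signℚ (trans (sym (trans (cong (Sign._* s) (SP.s*s≡+ (g x))) refl))
        (trans (SP.*-assoc (g x) (g x) s) (cong (g x Sign.*_) (proj₂ (walkSignK-sound n eq) g pot))))
  -- A walk of length at most `n` exists, so the search cannot have failed.
  ... | nothing with reachK-sound n (Reach-sym r)
  ...   | _ , (_ , w) , i , le = ⊥-elim (walkSignK-complete n w i le eq)

-- Components, bridges and forests

count-cong : ∀ k {p q : Fin k → Bool} → (∀ i → p i ≡ q i) → count k p ≡ count k q
count-cong k {p} {q} h = ℕtoℚ-injective (trans (ℕtoℚ-count k p)
  (trans (∑-cong (allFin k) (λ i → cong ι (h i))) (sym (ℕtoℚ-count k q))))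

count-+ : ∀ k {p q r : Fin k → Bool} → (∀ i → ι (p i) ≡ ι (q i) + ι (r i)) →
  count k p ≡ count k q ℕ.+ count k r
count-+ k {p} {q} {r} h = ℕtoℚ-injective (trans (ℕtoℚ-count k p)
  (trans (∑-cong (allFin k) h) (trans (∑-+ (allFin k) (ι ∘ q) (ι ∘ r))
    (trans (sym (cong₂ _+_ (ℕtoℚ-count k q) (ℕtoℚ-count k r)))
           (sym (ℕtoℚ-+ (count k q) (count k r)))))))

count-none : ∀ k {p : Fin k → Bool} → (∀ i → p i ≡ false) → count k p ≡ 0
count-none k {p} h = ℕtoℚ-injective (trans (ℕtoℚ-count k p) (∑-zero (allFin k) (λ i → cong ι (h i))))

count-== : ∀ k (j : Fin k) → count k (_== j) ≡ 1
count-== k j = ℕtoℚ-injective (trans (ℕtoℚ-count k (_== j))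
  (trans (∑-cong (allFin k) (λ i → sym (ℚP.*-identityʳ (ι (i == j))))) (∑-δ (λ _ → 1ℚ) j)))

count-suc : ∀ k {p q : Fin k → Bool} j → p j ≡ true → q j ≡ false → (∀ i → i ≢ j → p i ≡ q i) →
  count k p ≡ suc (count k q)
count-suc k {p} {q} j pj qj h = trans (count-+ k split) (cong (ℕ._+ count k q) (count-== k j))
  where
  split : ∀ i → ι (p i) ≡ ι (i == j) + ι (q i)
  split i with i ≟ j
  ... | yes refl rewrite pj | qj = refl
  ... | no  i≢j  = trans (cong ι (h i i≢j)) (sym (ℚP.+-identityˡ _))

ι-⊎ : ∀ {a b c} → (a ≡ true → b ≡ true ⊎ c ≡ true) → (b ≡ true → a ≡ true) → (c ≡ true → a ≡ true) →
  ¬ (b ≡ true × c ≡ true) → ι a ≡ ι b + ι c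
ι-⊎ {a}     {true}  {true}  f g h k = contradiction (refl , refl) k
ι-⊎ {true}  {true}  {false} f g h k = refl
ι-⊎ {false} {true}  {false} f g h k = case g refl of λ ()
ι-⊎ {true}  {false} {true}  f g h k = refl
ι-⊎ {false} {false} {true}  f g h k = case h refl of λ ()
ι-⊎ {false} {false} {false} f g h k = refl
ι-⊎ {true}  {false} {false} f g h k with f refl
... | inj₁ ()
... | inj₂ ()

∏ : ∀ {k} → (Fin k → Sign) → Sign
∏ f = List.foldr Sign._*_ Sign.+ (List.map f (allFin _))

∏-suc : ∀ {k} (f : Fin (suc k) → Sign) → ∏ f ≡ f zero Sign.* ∏ (f ∘ suc)
∏-suc f = cong (λ l → f zero Sign.* List.foldr Sign._*_ Sign.+ l)
  (trans (LP.map-tabulate suc f) (sym (LP.map-tabulate id (f ∘ suc))))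

∏-cong : ∀ {k} {f g : Fin k → Sign} → (∀ i → f i ≡ g i) → ∏ f ≡ ∏ g
∏-cong h = cong (List.foldr Sign._*_ Sign.+) (LP.map-cong h (allFin _))

∏-+ : ∀ {k} {f : Fin k → Sign} → (∀ i → f i ≡ Sign.+) → ∏ f ≡ Sign.+
∏-+ {zero}      h = refl
∏-+ {suc k} {f} h = trans (∏-suc f) (cong₂ Sign._*_ (h zero) (∏-+ (h ∘ suc)))

∏-update : ∀ {k} {f g : Fin k → Sign} j s → f j ≡ s Sign.* g j → (∀ i → i ≢ j → f i ≡ g i) →
  ∏ f ≡ s Sign.* ∏ g
∏-update {suc k} {f} {g} zero s fj h = trans (∏-suc f)
  (trans (cong₂ Sign._*_ fj (∏-cong (λ i → h (suc i) λ ())))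
  (trans (SP.*-assoc s (g zero) _) (cong (s Sign.*_) (sym (∏-suc g)))))
∏-update {suc k} {f} {g} (suc j) s fj h = trans (∏-suc f)
  (trans (cong₂ Sign._*_ (h zero λ ()) (∏-update j s fj (λ i i≢j → h (suc i) λ { refl → i≢j refl })))
  (trans (sym (SP.*-assoc (g zero) s (∏ (g ∘ suc))))
  (trans (cong (Sign._* ∏ (g ∘ suc)) (SP.*-comm (g zero) s))
  (trans (SP.*-assoc s (g zero) (∏ (g ∘ suc))) (cong (s Sign.*_) (sym (∏-suc g)))))))

sign-cancelʳ : ∀ a b s → (a Sign.* s) Sign.* (b Sign.* s) ≡ a Sign.* b
sign-cancelʳ Sign.+ Sign.+ Sign.+ = refl
sign-cancelʳ Sign.+ Sign.+ Sign.- = refl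
sign-cancelʳ Sign.+ Sign.- Sign.+ = refl
sign-cancelʳ Sign.+ Sign.- Sign.- = refl
sign-cancelʳ Sign.- Sign.+ Sign.+ = refl
sign-cancelʳ Sign.- Sign.+ Sign.- = refl
sign-cancelʳ Sign.- Sign.- Sign.+ = refl
sign-cancelʳ Sign.- Sign.- Sign.- = refl

not-== : ∀ {n} {i j : Fin n} → not (i == j) ≡ true → i ≢ j
not-== {i = i} h refl with i == i | ==-refl i
not-== () refl | true | _

module Components {n m} (Γ : SignedGraph n m) where
  open SignedGraph Γ
  open Reachability Γ public

  infixl 6 _∖_
  _∖_ : EdgeSet m → Fin m → EdgeSet m
  _∖_ = remove Γ

  lookup-∖ : ∀ S e → lookup (S ∖ e) e ≡ false
  lookup-∖ S e = VP.lookup∘updateAt e S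

  lookup-∖-≢ : ∀ S {e f} → f ≢ e → lookup (S ∖ e) f ≡ lookup S f
  lookup-∖-≢ S {e} {f} f≢e = VP.lookup∘updateAt′ f e f≢e S

  ∖-⊆ : ∀ S e {f} → lookup (S ∖ e) f ≡ true → lookup S f ≡ true
  ∖-⊆ S e {f} h with f ≟ e
  ... | yes refl = true≢false h (lookup-∖ S e)
  ... | no  f≢e  = trans (sym (lookup-∖-≢ S f≢e)) h

  ∖-mono : ∀ S S' e → (∀ {f} → lookup S f ≡ true → lookup S' f ≡ true) →
    ∀ {f} → lookup (S ∖ e) f ≡ true → lookup (S' ∖ e) f ≡ true
  ∖-mono S S' e h {f} q with f ≟ e
  ... | yes refl = true≢false q (lookup-∖ S e)
  ... | no  f≢e  = trans (lookup-∖-≢ S' f≢e) (h (trans (sym (lookup-∖-≢ S f≢e)) q))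

  ∖-comm-⊆ : ∀ S e e' {f} → lookup (S ∖ e ∖ e') f ≡ true → lookup (S ∖ e' ∖ e) f ≡ true
  ∖-comm-⊆ S e e' {f} h with f ≟ e | f ≟ e'
  ... | yes refl | _        = true≢false (∖-⊆ (S ∖ e) e' h) (lookup-∖ S e)
  ... | no  _    | yes refl = true≢false h (lookup-∖ (S ∖ e) e')
  ... | no  p    | no  q    = trans (lookup-∖-≢ (S ∖ e') p) (trans (lookup-∖-≢ S q) (∖-⊆ S e (∖-⊆ (S ∖ e) e' h)))

  Reach-∖ : ∀ {S} e {x y} → Reach (S ∖ e) x y → Reach S x y
  Reach-∖ {S} e = Reach-mono (∖-⊆ S e)

  -- One crossing of `e` is enough: at every further crossing the induction discards what came after
  -- the first arrival at `e`.
  Reach-split : ∀ {S} e {x y} → Reach S x y →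
    Reach (S ∖ e) x y ⊎ (Reach (S ∖ e) x (src e) × Reach (S ∖ e) (dst e) y) ⊎
                        (Reach (S ∖ e) x (dst e) × Reach (S ∖ e) (src e) y)
  Reach-split {S} e {x} = Reach-ind P fwd' bwd' (inj₁ Reach-refl)
    where
    P : Fin n → Set
    P y = Reach (S ∖ e) x y ⊎ (Reach (S ∖ e) x (src e) × Reach (S ∖ e) (dst e) y) ⊎
                              (Reach (S ∖ e) x (dst e) × Reach (S ∖ e) (src e) y)
    extend : ∀ {y z} → Reach (S ∖ e) y z → P y → P z
    extend r (inj₁ p)              = inj₁ (Reach-trans p r)
    extend r (inj₂ (inj₁ (p , q))) = inj₂ (inj₁ (p , Reach-trans q r))
    extend r (inj₂ (inj₂ (p , q))) = inj₂ (inj₂ (p , Reach-trans q r))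
    fwd' : ∀ f → lookup S f ≡ true → Reach S x (src f) → P (src f) → P (dst f)
    fwd' f f∈ _ p with f ≟ e
    ... | no f≢e = extend (Reach-edge f (trans (lookup-∖-≢ S f≢e) f∈)) p
    fwd' f f∈ _ (inj₁ p)              | yes refl = inj₂ (inj₁ (p , Reach-refl))
    fwd' f f∈ _ (inj₂ (inj₁ (p , q))) | yes refl = inj₂ (inj₁ (p , Reach-refl))
    fwd' f f∈ _ (inj₂ (inj₂ (p , q))) | yes refl = inj₁ p
    bwd' : ∀ f → lookup S f ≡ true → Reach S x (src f) → P (dst f) → P (src f)
    bwd' f f∈ _ p with f ≟ e
    ... | no f≢e = extend (Reach-edge˘ f (trans (lookup-∖-≢ S f≢e) f∈)) p
    bwd' f f∈ _ (inj₁ p)              | yes refl = inj₂ (inj₂ (p , Reach-refl))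
    bwd' f f∈ _ (inj₂ (inj₁ (p , q))) | yes refl = inj₁ p
    bwd' f f∈ _ (inj₂ (inj₂ (p , q))) | yes refl = inj₂ (inj₂ (p , Reach-refl))

  Reach-reroute : ∀ {S} e → Reach (S ∖ e) (src e) (dst e) → ∀ {x y} → Reach S x y → Reach (S ∖ e) x y
  Reach-reroute e r p with Reach-split e p
  ... | inj₁ q              = q
  ... | inj₂ (inj₁ (q , s)) = Reach-trans q (Reach-trans r s)
  ... | inj₂ (inj₂ (q , s)) = Reach-trans q (Reach-trans (Reach-sym r) s)

  Reach-sides : ∀ {S} e {x} → Reach S (src e) x → Reach (S ∖ e) (src e) x ⊎ Reach (S ∖ e) (dst e) x
  Reach-sides e p with Reach-split e p
  ... | inj₁ q              = inj₁ q
  ... | inj₂ (inj₁ (q , s)) = inj₂ s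
  ... | inj₂ (inj₂ (q , s)) = inj₁ s

  OnCycle : EdgeSet m → Fin m → Set
  OnCycle S e = onCycle Γ S e ≡ true

  onCycle-intro : ∀ {S e} → lookup S e ≡ true → Reach (S ∖ e) (src e) (dst e) → OnCycle S e
  onCycle-intro {S} {e} p q rewrite p = q

  onCycle-elim : ∀ {S e} → OnCycle S e → lookup S e ≡ true × Reach (S ∖ e) (src e) (dst e)
  onCycle-elim {S} {e} h = ∧-true {lookup S e} h

  onCycle-mono : ∀ {S S'} → (∀ {e} → lookup S e ≡ true → lookup S' e ≡ true) →
    ∀ {e} → OnCycle S e → OnCycle S' e
  onCycle-mono {S} {S'} h {e} c with onCycle-elim {S} c
  ... | e∈ , r = onCycle-intro (h e∈) (Reach-mono (∖-mono S S' e h) r)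

  bridge : ∀ {S e} → lookup S e ≡ true → onCycle Γ S e ≡ false → ¬ Reach (S ∖ e) (src e) (dst e)
  bridge e∈ h r = true≢false (onCycle-intro e∈ r) h

  compEdgeᵇ : EdgeSet m → Fin n → Fin m → Bool
  compEdgeᵇ S x e = lookup S e ∧ reach Γ S x (src e)

  compEdge-intro : ∀ {S x e} → lookup S e ≡ true → Reach S x (src e) → compEdgeᵇ S x e ≡ true
  compEdge-intro p q rewrite p = q

  ∣V∣ : EdgeSet m → Fin n → ℕ
  ∣V∣ = compSize Γ

  ∣E∣ : EdgeSet m → Fin n → ℕ
  ∣E∣ S x = count m (compEdgeᵇ S x)

  Tree : EdgeSet m → Fin n → Set
  Tree S x = ∀ e → lookup S e ≡ true → Reach S x (src e) → onCycle Γ S e ≡ false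

  HasCycle : EdgeSet m → Fin n → Set
  HasCycle S x = ∃ λ e → OnCycle S e × Reach S x (src e)

  size-∖ : ∀ {S} e → lookup S e ≡ true → count m (lookup S) ≡ suc (count m (lookup (S ∖ e)))
  size-∖ {S} e e∈ = count-suc m e e∈ (lookup-∖ S e) (λ f f≢e → sym (lookup-∖-≢ S f≢e))

  ∣V∣-cycle : ∀ {S} e → OnCycle S e → ∀ x → ∣V∣ S x ≡ ∣V∣ (S ∖ e) x
  ∣V∣-cycle {S} e c x = count-cong n (λ v → bool-≡ (Reach-reroute e (proj₂ (onCycle-elim {S} c))) (Reach-∖ e))

  ∣E∣-cycle : ∀ {S} e {x} → OnCycle S e → Reach S x (src e) → ∣E∣ S x ≡ suc (∣E∣ (S ∖ e) x)
  ∣E∣-cycle {S} e {x} c r = count-suc m e (compEdge-intro {S} e∈ r) (cong (_∧ reach Γ (S ∖ e) x (src e)) (lookup-∖ S e))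
    (λ f f≢e → cong₂ _∧_ (sym (lookup-∖-≢ S f≢e))
      (bool-≡ (Reach-reroute e (proj₂ (onCycle-elim {S} c))) (Reach-∖ e)))
    where
    e∈ : lookup S e ≡ true
    e∈ = proj₁ (onCycle-elim {S} c)

  bridge-disjoint : ∀ {S} e → ¬ Reach (S ∖ e) (src e) (dst e) →
    ∀ {v} → ¬ (Reach (S ∖ e) (src e) v × Reach (S ∖ e) (dst e) v)
  bridge-disjoint e b (p , q) = b (Reach-trans p (Reach-sym q))

  ∣V∣-bridge : ∀ {S} e {x} → lookup S e ≡ true → ¬ Reach (S ∖ e) (src e) (dst e) → Reach S x (src e) →
    ∣V∣ S x ≡ ∣V∣ (S ∖ e) (src e) ℕ.+ ∣V∣ (S ∖ e) (dst e)
  ∣V∣-bridge e e∈ b r = count-+ n (λ v → ι-⊎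
    (λ p → Reach-sides e (Reach-trans (Reach-sym r) p))
    (λ p → Reach-trans r (Reach-∖ e p))
    (λ p → Reach-trans r (Reach-trans (Reach-edge e e∈) (Reach-∖ e p)))
    (bridge-disjoint e b))

  ∣E∣-bridge : ∀ {S} e {x} → lookup S e ≡ true → ¬ Reach (S ∖ e) (src e) (dst e) → Reach S x (src e) →
    ∣E∣ S x ≡ suc (∣E∣ (S ∖ e) (src e) ℕ.+ ∣E∣ (S ∖ e) (dst e))
  ∣E∣-bridge {S} e {x} e∈ b r = trans
    -- The edge `e` itself is taken out before the remaining edges are divided between its two
    -- sides.
    (count-suc m {q = λ f → compEdgeᵇ S x f ∧ not (f == e)} e (compEdge-intro {S} e∈ r) at-e off-e)
    (cong suc (count-+ m (λ f → ι-⊎ (to f) (from₁ f) (from₂ f)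
      (λ { (p , q) → bridge-disjoint e b (proj₂ (∧-true {lookup (S ∖ e) f} p) , proj₂ (∧-true {lookup (S ∖ e) f} q)) }))))
    where
    at-e : compEdgeᵇ S x e ∧ not (e == e) ≡ false
    at-e rewrite ==-refl e with compEdgeᵇ S x e
    ... | true  = refl
    ... | false = refl
    off-e : ∀ f → f ≢ e → compEdgeᵇ S x f ≡ compEdgeᵇ S x f ∧ not (f == e)
    off-e f f≢e rewrite ==-≢ f≢e with compEdgeᵇ S x f
    ... | true  = refl
    ... | false = refl
    to : ∀ f → compEdgeᵇ S x f ∧ not (f == e) ≡ true →
      compEdgeᵇ (S ∖ e) (src e) f ≡ true ⊎ compEdgeᵇ (S ∖ e) (dst e) f ≡ true
    to f h = sides (Reach-sides e (Reach-trans (Reach-sym r) (proj₂ ce)))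
      where
      ce : lookup S f ≡ true × Reach S x (src f)
      ce = ∧-true {lookup S f} (proj₁ (∧-true {compEdgeᵇ S x f} h))
      f∈ : lookup (S ∖ e) f ≡ true
      f∈ = trans (lookup-∖-≢ S (not-== (proj₂ (∧-true {compEdgeᵇ S x f} h)))) (proj₁ ce)
      sides : Reach (S ∖ e) (src e) (src f) ⊎ Reach (S ∖ e) (dst e) (src f) →
        compEdgeᵇ (S ∖ e) (src e) f ≡ true ⊎ compEdgeᵇ (S ∖ e) (dst e) f ≡ true
      sides (inj₁ q) = inj₁ (compEdge-intro {S ∖ e} f∈ q)
      sides (inj₂ q) = inj₂ (compEdge-intro {S ∖ e} f∈ q)
    back : ∀ f → lookup (S ∖ e) f ≡ true → Reach S x (src f) → compEdgeᵇ S x f ∧ not (f == e) ≡ true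
    back f f∈ p with f ≟ e
    ... | yes refl = true≢false f∈ (lookup-∖ S e)
    ... | no  f≢e  rewrite ∖-⊆ S e f∈ | p = refl
    from₁ : ∀ f → compEdgeᵇ (S ∖ e) (src e) f ≡ true → compEdgeᵇ S x f ∧ not (f == e) ≡ true
    from₁ f h with ∧-true {lookup (S ∖ e) f} h
    ... | f∈ , p = back f f∈ (Reach-trans r (Reach-∖ e p))
    from₂ : ∀ f → compEdgeᵇ (S ∖ e) (dst e) f ≡ true → compEdgeᵇ S x f ∧ not (f == e) ≡ true
    from₂ f h with ∧-true {lookup (S ∖ e) f} h
    ... | f∈ , p = back f f∈ (Reach-trans r (Reach-trans (Reach-edge e e∈) (Reach-∖ e p)))

  -- Induction on the number of edges. Deleting an edge on a cycle keeps the vertex set of the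
  -- component and lowers the edge count; without cycles every edge is a bridge, and deleting one
  -- leaves two smaller trees. Later arguments use it in reverse, to detect cycles by counting.
  tree-or-cycle : ∀ S x → (Tree S x × ∣V∣ S x ≡ suc (∣E∣ S x)) ⊎ (HasCycle S x × ∣V∣ S x ≤ ∣E∣ S x)
  tree-or-cycle S x = go (count m (lookup S)) S x refl
    where
    go : ∀ d S x → count m (lookup S) ≡ d →
      (Tree S x × ∣V∣ S x ≡ suc (∣E∣ S x)) ⊎ (HasCycle S x × ∣V∣ S x ≤ ∣E∣ S x)
    go d S x h with any (λ e → compEdgeᵇ S x e ∧ onCycle Γ S e) (allFin m) in eq
    ... | true with any-elim (λ e → compEdgeᵇ S x e ∧ onCycle Γ S e) (allFin m) eq
    ... | e , he with ∧-true {compEdgeᵇ S x e} he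
    ... | ce , c with ∧-true {lookup S e} ce
    go zero S x h | true | e , he | ce , c | e∈ , r = case trans (sym h) (size-∖ {S} e e∈) of λ ()
    go (suc d) S x h | true | e , he | ce , c | e∈ , r = inj₂ ((e , c , r) ,
      subst₂ _≤_ (sym (∣V∣-cycle e c x)) (sym (∣E∣-cycle e c r))
        (bound (go d (S ∖ e) x (ℕP.suc-injective (trans (sym (size-∖ {S} e e∈)) h)))))
      where
      bound : (Tree (S ∖ e) x × ∣V∣ (S ∖ e) x ≡ suc (∣E∣ (S ∖ e) x)) ⊎
              (HasCycle (S ∖ e) x × ∣V∣ (S ∖ e) x ≤ ∣E∣ (S ∖ e) x) → ∣V∣ (S ∖ e) x ≤ suc (∣E∣ (S ∖ e) x)
      bound (inj₁ (_ , q)) = ℕP.≤-reflexive q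
      bound (inj₂ (_ , q)) = ℕP.m≤n⇒m≤1+n q
    go d S x h | false with any (compEdgeᵇ S x) (allFin m) in eq'
    ... | false = inj₁ (tree , trans V1 (cong suc (sym (count-none m no-edge))))
      where
      no-edge : ∀ e → compEdgeᵇ S x e ≡ false
      no-edge e = any-false (compEdgeᵇ S x) eq' (MemP.∈-allFin e)
      tree : Tree S x
      tree e e∈ r = true≢false (compEdge-intro {S} e∈ r) (no-edge e)
      alone : ∀ {v} → Reach S x v → v ≡ x
      alone = Reach-ind (_≡ x) (λ e e∈ r _ → true≢false (compEdge-intro {S} e∈ r) (no-edge e))
        (λ e e∈ r _ → true≢false (compEdge-intro {S} e∈ r) (no-edge e)) refl
      V1 : ∣V∣ S x ≡ 1
      V1 = trans (count-cong n (λ v → bool-≡ {b = v == x}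
        (λ r → trans (cong (_== x) (alone r)) (==-refl x))
        (λ q → subst (Reach S x) (sym (==-true q)) Reach-refl))) (count-== n x)
    ... | true with any-elim (compEdgeᵇ S x) (allFin m) eq'
    ... | e , ce with ∧-true {lookup S e} ce
    go zero S x h | false | true | e , ce | e∈ , r = case trans (sym h) (size-∖ {S} e e∈) of λ ()
    go (suc d) S x h | false | true | e , ce | e∈ , r = inj₁ (tree ,
      trans (∣V∣-bridge e e∈ br r) (trans (cong₂ ℕ._+_
          (side (src e) r (go d (S ∖ e) (src e) h'))
          (side (dst e) (Reach-trans r (Reach-edge e e∈)) (go d (S ∖ e) (dst e) h')))
        (cong suc (trans (ℕP.+-suc _ _) (sym (∣E∣-bridge e e∈ br r))))))
      where
      tree : Tree S x
      tree f f∈ q with onCycle Γ S f in c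
      ... | false = refl
      ... | true  = true≢false (trans (cong₂ _∧_ (compEdge-intro {S} f∈ q) c) refl)
                      (any-false (λ e → compEdgeᵇ S x e ∧ onCycle Γ S e) eq (MemP.∈-allFin f))
      br : ¬ Reach (S ∖ e) (src e) (dst e)
      br = bridge e∈ (tree e e∈ r)
      h' : count m (lookup (S ∖ e)) ≡ d
      h' = ℕP.suc-injective (trans (sym (size-∖ {S} e e∈)) h)
      side : ∀ z → Reach S x z → (Tree (S ∖ e) z × ∣V∣ (S ∖ e) z ≡ suc (∣E∣ (S ∖ e) z)) ⊎
              (HasCycle (S ∖ e) z × ∣V∣ (S ∖ e) z ≤ ∣E∣ (S ∖ e) z) → ∣V∣ (S ∖ e) z ≡ suc (∣E∣ (S ∖ e) z)
      side z q (inj₁ (_ , p)) = p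
      side z q (inj₂ ((f , c , s) , _)) = true≢false (onCycle-mono (∖-⊆ S e) c)
        (tree f (∖-⊆ S e (proj₁ (onCycle-elim {S ∖ e} c))) (Reach-trans q (Reach-∖ e s)))

  -- In a forest the sign of the path from a to z is the product of the signs of the edges that
  -- separate a from z.
  pathFactor : EdgeSet m → Fin n → Fin n → Fin m → Sign
  pathFactor S a z e = if lookup S e ∧ not (reach Γ (S ∖ e) a z) then σ e else Sign.+

  treePotential : EdgeSet m → Fin n → Fin n → Sign
  treePotential S a z = ∏ (pathFactor S a z)

  treePotential-root : ∀ S a → treePotential S a a ≡ Sign.+
  treePotential-root S a = ∏-+ factor
    where
    factor : ∀ e → pathFactor S a a e ≡ Sign.+
    factor e rewrite Reach-refl {S ∖ e} {a} with lookup S e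
    ... | true  = refl
    ... | false = refl

  -- Crossing `f` toggles the factor of `f` alone: deleting any other edge leaves `f` in place, so
  -- both ends of `f` stay on the same side of that edge.
  treePotential-potential : ∀ {S a} → Tree S a → Potential S a (treePotential S a)
  treePotential-potential {S} {a} tree f f∈ r =
    trans (SP.*-comm (treePotential S a (src f)) (σ f))
      (sym (∏-update {f = pathFactor S a (dst f)} {g = pathFactor S a (src f)} f (σ f) at-f off-f))
    where
    br : ¬ Reach (S ∖ f) (src f) (dst f)
    br = bridge f∈ (tree f f∈ r)
    at-f : pathFactor S a (dst f) f ≡ σ f Sign.* pathFactor S a (src f) f
    at-f rewrite f∈ with reach Γ (S ∖ f) a (src f) in p | reach Γ (S ∖ f) a (dst f) in q
    ... | true  | true  = contradiction (Reach-trans (Reach-sym p) q) br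
    ... | true  | false = sym (SP.*-identityʳ (σ f))
    ... | false | true  = sym (SP.s*s≡+ (σ f))
    ... | false | false with Reach-split f r
    ...   | inj₁ h              = true≢false h p
    ...   | inj₂ (inj₁ (h , _)) = true≢false h p
    ...   | inj₂ (inj₂ (h , _)) = true≢false h q
    off-f : ∀ e → e ≢ f → pathFactor S a (dst f) e ≡ pathFactor S a (src f) e
    off-f e e≢f = cong (λ b → if lookup S e ∧ not b then σ e else Sign.+)
      (bool-≡ (λ p → Reach-trans p (Reach-edge˘ f f∈'))
              (λ p → Reach-trans p (Reach-edge f f∈')))
      where
      f∈' : lookup (S ∖ e) f ≡ true
      f∈' = trans (lookup-∖-≢ S (e≢f ∘ sym)) f∈

  -- The edge sign enters both factors and cancels along each step; two potentials of a component
  -- thus differ by one global sign.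
  potential-unique : ∀ {S x} g h → Potential S x g → Potential S x h →
    ∀ {y} → Reach S x y → g y Sign.* h y ≡ g x Sign.* h x
  potential-unique g h pg ph = Reach-ind (λ y → g y Sign.* h y ≡ _)
    (λ e e∈ r p → trans (cong₂ Sign._*_ (sym (pg e e∈ r)) (sym (ph e e∈ r)))
                    (trans (sign-cancelʳ (g (src e)) (h (src e)) (σ e)) p))
    (λ e e∈ r p → trans (sym (sign-cancelʳ (g (src e)) (h (src e)) (σ e)))
                    (trans (cong₂ Sign._*_ (pg e e∈ r) (ph e e∈ r)) p))
    refl

  Potential-⊆ : ∀ {S S' x y} g → (∀ {e} → lookup S' e ≡ true → lookup S e ≡ true) → Reach S x y →
    Potential S x g → Potential S' y g
  Potential-⊆ g h r pot e e∈ q = pot e (h e∈) (Reach-trans r (Reach-mono h q))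

-- Representatives and the incidence matrix

all-false : {A : Set} (p : A → Bool) (xs : List A) → all p xs ≡ false → ∃ λ x → p x ≡ false
all-false p (x ∷ xs) h with p x in eq
... | true  = all-false p xs h
... | false = x , eq

≡ᵇ-sound : ∀ {a b} → (a ℕ.≡ᵇ b) ≡ true → a ≡ b
≡ᵇ-sound {a} {b} h = ℕP.≡ᵇ⇒≡ a b (subst T (sym h) _)

≡ᵇ-complete : ∀ {a b} → a ≡ b → (a ℕ.≡ᵇ b) ≡ true
≡ᵇ-complete {a} refl with a ℕ.≡ᵇ a | ℕP.≡⇒≡ᵇ a a refl
... | true | _ = refl

<ᵇ-complete : ∀ {a b} → a ℕ.< b → (a ℕ.<ᵇ b) ≡ true
<ᵇ-complete {a} {b} h with a ℕ.<ᵇ b | ℕP.<⇒<ᵇ h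
... | true | _ = refl

<ᵇ-sound : ∀ {a b} → (a ℕ.<ᵇ b) ≡ true → a ℕ.< b
<ᵇ-sound {a} {b} h = ℕP.<ᵇ⇒< a b (subst T (sym h) _)

module Representatives {n m} (Γ : SignedGraph n m) (N : Fin n → Fin m → ℤ) where
  open SignedGraph Γ
  open Components Γ public
  open Formulas Γ N using (isRep)

  isRep-elim : ∀ {H x} → isRep H x ≡ true → ∀ {y} → Reach H x y → toℕ x ≤ toℕ y
  isRep-elim {H} {x} h {y} r with toℕ y ℕP.<? toℕ x
  ... | no  ¬p = ℕP.≮⇒≥ ¬p
  ... | yes p  = true≢false (all-elim _ h (MemP.∈-allFin y)) (cong not (cong₂ _∧_ (<ᵇ-complete p) r))

  isRep-intro : ∀ {H x} → (∀ {y} → Reach H x y → toℕ x ≤ toℕ y) → isRep H x ≡ true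
  isRep-intro {H} {x} h = all-intro _ (allFin n) smaller
    where
    smaller : ∀ y → not ((toℕ y ℕ.<ᵇ toℕ x) ∧ reach Γ H x y) ≡ true
    smaller y with toℕ y ℕ.<ᵇ toℕ x in lt | reach Γ H x y in r
    ... | false | _     = refl
    ... | true  | false = refl
    ... | true  | true  = contradiction (h r) (ℕP.<⇒≱ (<ᵇ-sound lt))

  representative : ∀ H v → ∃ λ r → isRep H r ≡ true × Reach H v r
  representative H v = go (suc (toℕ v)) v ℕP.≤-refl
    where
    go : ∀ fuel v → toℕ v ℕ.< fuel → ∃ λ r → isRep H r ≡ true × Reach H v r
    go (suc fuel) v (s≤s le) with isRep H v in eq
    ... | true  = v , eq , Reach-refl
    ... | false with all-false _ (allFin n) eq
    ... | y , hy with toℕ y ℕ.<ᵇ toℕ v in lt | reach Γ H v y in r | hy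
    ... | true | true | _ with go fuel y (ℕP.<-≤-trans (<ᵇ-sound lt) le)
    ... | x , hx , r' = x , hx , Reach-trans r r'

  isRep-unique : ∀ {H x y} → isRep H x ≡ true → isRep H y ≡ true → Reach H x y → x ≡ y
  isRep-unique {H} hx hy r =
    FP.toℕ-injective (ℕP.≤-antisym (isRep-elim {H} hx r) (isRep-elim {H} hy (Reach-sym r)))

  -- Each `f i` lies in the component of exactly one representative. With `f = id` this distributes
  -- the vertices over the components, with `f = src` the edges.
  ∑-representatives : ∀ H {k} (p : Fin k → Bool) (f : Fin k → Fin n) →
    ∑ (allFin n) (λ r → ι (isRep H r) * ℕtoℚ (count k (λ i → p i ∧ reach Γ H r (f i)))) ≡ ℕtoℚ (count k p)
  ∑-representatives H {k} p f =
    trans (∑-cong (allFin n) (λ r → trans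
      (cong (ι (isRep H r) *_) (ℕtoℚ-count k (λ i → p i ∧ reach Γ H r (f i))))
      (∑-*ˡ (allFin k) (ι (isRep H r)) (λ i → ι (p i ∧ reach Γ H r (f i))))))
    (trans (∑-swap (allFin n) (allFin k) (λ r i → ι (isRep H r) * ι (p i ∧ reach Γ H r (f i))))
    (trans (∑-cong (allFin k) one) (sym (ℕtoℚ-count k p))))
    where
    one : ∀ i → ∑ (allFin n) (λ r → ι (isRep H r) * ι (p i ∧ reach Γ H r (f i))) ≡ ι (p i)
    one i with p i
    ... | false = ∑-zero (allFin n) (λ r → ℚP.*-zeroʳ (ι (isRep H r)))
    ... | true with representative H (f i)
    ... | r₀ , h₀ , reach₀ = trans (∑-point (λ r → ι (isRep H r) * ι (reach Γ H r (f i))) r₀ others)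
        (trans (cong₂ (λ a b → ι a * ι b) h₀ (Reach-sym reach₀)) refl)
      where
      others : ∀ r → r ≢ r₀ → ι (isRep H r) * ι (reach Γ H r (f i)) ≡ 0ℚ
      others r r≢ with isRep H r in hr | reach Γ H r (f i) in q
      ... | false | b     = ℚP.*-zeroˡ (ι b)
      ... | true  | false = refl
      ... | true  | true  = contradiction (isRep-unique {H} hr h₀ (Reach-trans q reach₀)) r≢

  components : EdgeSet m → ℕ
  components H = count n (isRep H)

  add-∖-⊆ : ∀ S e {f} → lookup (add S e ∖ e) f ≡ true → lookup S f ≡ true
  add-∖-⊆ S e {f} h with f ≟ e
  ... | yes refl = true≢false h (lookup-∖ (add S e) e)
  ... | no  f≢e  = trans (sym (lookup-add-≢ S f≢e)) (trans (sym (lookup-∖-≢ (add S e) f≢e)) h)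

  Reach-add : ∀ {S} e {x y} → Reach S x y → Reach (add S e) x y
  Reach-add {S} e = Reach-mono (lookup-add-⊇ S)

  Reach-add-split : ∀ {S} e {x y} → Reach (add S e) x y →
    Reach S x y ⊎ (Reach S x (src e) × Reach S (dst e) y) ⊎ (Reach S x (dst e) × Reach S (src e) y)
  Reach-add-split {S} e r with Reach-split e r
  ... | inj₁ p              = inj₁ (Reach-mono (add-∖-⊆ S e) p)
  ... | inj₂ (inj₁ (p , q)) = inj₂ (inj₁ (Reach-mono (add-∖-⊆ S e) p , Reach-mono (add-∖-⊆ S e) q))
  ... | inj₂ (inj₂ (p , q)) = inj₂ (inj₂ (Reach-mono (add-∖-⊆ S e) p , Reach-mono (add-∖-⊆ S e) q))

  components-same : ∀ {S} e → Reach S (src e) (dst e) → components (add S e) ≡ components S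
  components-same {S} e r = count-cong n (λ x → bool-≡
    (λ h → isRep-intro {S} (λ p → isRep-elim {add S e} h (Reach-add e p)))
    (λ h → isRep-intro {add S e} (λ p → isRep-elim {S} h (back p))))
    where
    back : ∀ {x y} → Reach (add S e) x y → Reach S x y
    back p with Reach-add-split e p
    ... | inj₁ q              = q
    ... | inj₂ (inj₁ (q , s)) = Reach-trans q (Reach-trans r s)
    ... | inj₂ (inj₂ (q , s)) = Reach-trans q (Reach-trans (Reach-sym r) s)

  -- A representative is the least vertex of its component. When two components merge, the larger of
  -- their two least vertices loses this status and every other vertex keeps its own.
  components-merge : ∀ {S} e → ¬ Reach S (src e) (dst e) → components S ≡ suc (components (add S e))
  components-merge {S} e ¬r with representative S (src e) | representative S (dst e)
  ... | a , ha , ra | b , hb , rb with ℕP.<-cmp (toℕ a) (toℕ b)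
  ... | tri≈ _ a≡b _ with FP.toℕ-injective a≡b
  ...   | refl = contradiction (Reach-trans ra (Reach-sym rb)) ¬r
  components-merge {S} e ¬r | a , ha , ra | b , hb , rb | tri< a<b _ _ =
    count-suc n b hb
      (¬true⇒false (λ h → ℕP.<⇒≱ a<b (isRep-elim {add S e} h
        (Reach-trans (Reach-sym (Reach-add e rb)) (Reach-trans (Reach-edge˘ e (lookup-add S e)) (Reach-add e ra))))))
      (λ x x≢b → bool-≡ (λ h → isRep-intro {add S e} (keep x x≢b h))
                        (λ h → isRep-intro {S} (λ p → isRep-elim {add S e} h (Reach-add e p))))
    where
    keep : ∀ x → x ≢ b → isRep S x ≡ true → ∀ {y} → Reach (add S e) x y → toℕ x ≤ toℕ y
    keep x x≢b h p with Reach-add-split e p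
    ... | inj₁ q = isRep-elim {S} h q
    ... | inj₂ (inj₁ (q , s)) with isRep-unique {S} h ha (Reach-trans q ra)
    ...   | refl = ℕP.≤-trans (ℕP.<⇒≤ a<b) (isRep-elim {S} hb (Reach-trans (Reach-sym rb) s))
    keep x x≢b h p | inj₂ (inj₂ (q , s)) = contradiction (isRep-unique {S} h hb (Reach-trans q rb)) x≢b
  components-merge {S} e ¬r | a , ha , ra | b , hb , rb | tri> _ _ b<a =
    count-suc n a ha
      (¬true⇒false (λ h → ℕP.<⇒≱ b<a (isRep-elim {add S e} h
        (Reach-trans (Reach-sym (Reach-add e ra)) (Reach-trans (Reach-edge e (lookup-add S e)) (Reach-add e rb))))))
      (λ x x≢a → bool-≡ (λ h → isRep-intro {add S e} (keep x x≢a h))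
                        (λ h → isRep-intro {S} (λ p → isRep-elim {add S e} h (Reach-add e p))))
    where
    keep : ∀ x → x ≢ a → isRep S x ≡ true → ∀ {y} → Reach (add S e) x y → toℕ x ≤ toℕ y
    keep x x≢a h p with Reach-add-split e p
    ... | inj₁ q = isRep-elim {S} h q
    ... | inj₂ (inj₂ (q , s)) with isRep-unique {S} h hb (Reach-trans q rb)
    ...   | refl = ℕP.≤-trans (ℕP.<⇒≤ b<a) (isRep-elim {S} ha (Reach-trans (Reach-sym ra) s))
    keep x x≢a h p | inj₂ (inj₁ (q , s)) = contradiction (isRep-unique {S} h ha (Reach-trans q ra)) x≢a

-- The incidence matrix and the Laplacian

signℚ-* : ∀ s t → signℚ (s Sign.* t) ≡ signℚ s * signℚ t
signℚ-* Sign.+ t = sym (ℚP.*-identityˡ (signℚ t))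
signℚ-* Sign.- Sign.+ = refl
signℚ-* Sign.- Sign.- = refl

signℚ-square : ∀ s → signℚ s * signℚ s ≡ 1ℚ
signℚ-square Sign.+ = refl
signℚ-square Sign.- = refl

module Incidence {n m} (Γ : SignedGraph n m) (N : Fin n → Fin m → ℤ) (inc : IsIncidence Γ N) where
  open SignedGraph Γ
  open Representatives Γ N public
  open WithN Γ N public

  ν : Rect n m
  ν v e = ℤtoℚ (N v e)

  _·ν_ : (Fin n → ℚ) → Fin m → ℚ
  y ·ν e = ∑ (allFin n) (λ v → y v * ν v e)

  ν-off : ∀ v e → v ≢ src e → v ≢ dst e → ν v e ≡ 0ℚ
  ν-off v e p q = cong ℤtoℚ (proj₁ inc v e p q)

  unit-square : ∀ {z} → z ≡ ℤ.1ℤ ⊎ z ≡ ℤ.-1ℤ → ℤtoℚ z * ℤtoℚ z ≡ 1ℚ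
  unit-square (inj₁ refl) = refl
  unit-square (inj₂ refl) = refl

  ν-src² : ∀ e → ν (src e) e * ν (src e) e ≡ 1ℚ
  ν-src² e = unit-square (proj₁ (proj₂ inc) e)

  ν-dst : ∀ e → ν (dst e) e ≡ - (signℚ (σ e) * ν (src e) e)
  ν-dst e with σ e in s
  ... | Sign.- = trans (cong ℤtoℚ (sym (proj₁ (proj₂ (proj₂ (proj₂ inc))) e s)))
        (solve 1 (λ a → a := :- (con (- 1ℚ) :* a)) refl (ν (src e) e))
  ... | Sign.+ with N (dst e) e | proj₁ (proj₂ (proj₂ inc)) e | proj₂ (proj₂ (proj₂ (proj₂ inc))) e s
  ...   | _ | inj₁ refl | h rewrite h = refl
  ...   | _ | inj₂ refl | h rewrite h = refl

  ·ν-ends : ∀ y e → y ·ν e ≡ y (src e) * ν (src e) e + y (dst e) * ν (dst e) e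
  ·ν-ends y e = ∑-two-points (λ v → y v * ν v e) (src e) (dst e) (src≢dst e)
    (λ v p q → trans (cong (y v *_) (ν-off v e p q)) (ℚP.*-zeroʳ (y v)))

  -- The unit `ν (src e) e` can be factored out of the column for both edge signs, so vanishing and
  -- squares of these products do not depend on the choice of `N`.
  ·ν-formula : ∀ y e → y ·ν e ≡ ν (src e) e * (y (src e) - signℚ (σ e) * y (dst e))
  ·ν-formula y e = trans (·ν-ends y e) (trans (cong (λ q → y (src e) * ν (src e) e + y (dst e) * q) (ν-dst e))
    (solve 4 (λ a b s t → a :* t :+ b :* (:- (s :* t)) := t :* (a :- s :* b)) refl
      (y (src e)) (y (dst e)) (signℚ (σ e)) (ν (src e) e)))

  ν-src≢0 : ∀ e → ν (src e) e ≢ 0ℚ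
  ν-src≢0 e h = case trans (sym (ν-src² e)) (trans (cong (_* ν (src e) e) h) (ℚP.*-zeroˡ (ν (src e) e))) of λ ()

  ·ν-zero : ∀ y e → y ·ν e ≡ 0ℚ → y (src e) ≡ signℚ (σ e) * y (dst e)
  ·ν-zero y e h = trans (solve 2 (λ a b → a := (a :- b) :+ b) refl (y (src e)) (signℚ (σ e) * y (dst e)))
    (trans (cong (_+ signℚ (σ e) * y (dst e)) (*-cancelˡ (ν-src≢0 e)
       (trans (sym (·ν-formula y e)) (trans h (sym (ℚP.*-zeroʳ (ν (src e) e)))))))
      (ℚP.+-identityˡ (signℚ (σ e) * y (dst e))))

  zero-·ν : ∀ y e → y (src e) ≡ signℚ (σ e) * y (dst e) → y ·ν e ≡ 0ℚ
  zero-·ν y e h = trans (·ν-formula y e) (trans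
    (cong (λ q → ν (src e) e * (q - signℚ (σ e) * y (dst e))) h)
    (solve 2 (λ a b → a :* (b :- b) := con 0ℚ) refl (ν (src e) e) (signℚ (σ e) * y (dst e))))

  ·ν-linear : ∀ a b y z e → (λ v → a * y v + b * z v) ·ν e ≡ a * (y ·ν e) + b * (z ·ν e)
  ·ν-linear a b y z e = trans (∑-cong (allFin n) (λ v → solve 5 (λ a b y z t →
      (a :* y :+ b :* z) :* t := a :* (y :* t) :+ b :* (z :* t)) refl a b (y v) (z v) (ν v e)))
    (∑-linear (allFin n) a b (λ v → y v * ν v e) (λ v → z v * ν v e))

  -- Reconciles the stored order of the ends with tail and head. In both cases `w e` is the
  -- incidence entry at the tail, which lets one formula serve positive and negative edges.
  data Oriented (e : Fin m) : Set where
    forward  : tail e ≡ src e → head e ≡ dst e → ν (src e) e ≡ w e → Oriented e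
    backward : tail e ≡ dst e → head e ≡ src e → ν (dst e) e ≡ w e → Oriented e

  orientation : ∀ e → Oriented e
  orientation e with σ e in s
  ... | Sign.- with N (src e) e ℤ.≟ ℤ.-1ℤ | proj₁ (proj₂ inc) e
  ...   | yes p | _      = forward (tl s) (hd s) (trans (cong ℤtoℚ p) (sym (w-neg s p)))
    where
    tl : σ e ≡ Sign.- → tail e ≡ src e
    tl h rewrite h = refl
    hd : σ e ≡ Sign.- → head e ≡ dst e
    hd h rewrite h = refl
    w-neg : σ e ≡ Sign.- → N (src e) e ≡ ℤ.-1ℤ → w e ≡ - 1ℚ
    w-neg h p rewrite h | p = refl
  ...   | no ¬p | inj₂ p = contradiction p ¬p
  ...   | no ¬p | inj₁ p = forward (tl s) (hd s) (trans (cong ℤtoℚ p) (sym (w-pos s p)))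
    where
    tl : σ e ≡ Sign.- → tail e ≡ src e
    tl h rewrite h = refl
    hd : σ e ≡ Sign.- → head e ≡ dst e
    hd h rewrite h = refl
    w-pos : σ e ≡ Sign.- → N (src e) e ≡ ℤ.1ℤ → w e ≡ 1ℚ
    w-pos h p rewrite h | p = refl
  orientation e | Sign.+ with proj₁ (proj₂ inc) e
  ... | inj₁ p = forward (tl s p) (hd s p) (trans (cong ℤtoℚ p) (sym (w-pos s)))
    where
    tl : σ e ≡ Sign.+ → N (src e) e ≡ ℤ.1ℤ → tail e ≡ src e
    tl h p rewrite h | p = refl
    hd : σ e ≡ Sign.+ → N (src e) e ≡ ℤ.1ℤ → head e ≡ dst e
    hd h p rewrite h | p = refl
    w-pos : σ e ≡ Sign.+ → w e ≡ 1ℚ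
    w-pos h rewrite h = refl
  ... | inj₂ p = backward (tl s p) (hd s p) (trans (ν-dst e) (trans (val s p) (sym (w-pos s))))
    where
    tl : σ e ≡ Sign.+ → N (src e) e ≡ ℤ.-1ℤ → tail e ≡ dst e
    tl h p rewrite h | p = refl
    hd : σ e ≡ Sign.+ → N (src e) e ≡ ℤ.-1ℤ → head e ≡ src e
    hd h p rewrite h | p = refl
    val : σ e ≡ Sign.+ → N (src e) e ≡ ℤ.-1ℤ → - (signℚ (σ e) * ν (src e) e) ≡ 1ℚ
    val h p rewrite h | p = refl
    w-pos : σ e ≡ Sign.+ → w e ≡ 1ℚ
    w-pos h rewrite h = refl

  w² : ∀ e → w e * w e ≡ 1ℚ
  w² e with not (isPlus (σ e)) ∧ (N (src e) e ==ℤ ℤ.-1ℤ)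
  ... | true  = refl
  ... | false = refl

  ·ν-oriented : ∀ y e → y ·ν e ≡ w e * (y (tail e) - signℚ (σ e) * y (head e))
  ·ν-oriented y e with orientation e
  ... | forward t h q rewrite t | h = trans (·ν-formula y e)
        (cong (_* (y (src e) - signℚ (σ e) * y (dst e))) q)
  ... | backward t h q rewrite t | h = trans (·ν-ends y e) (trans
        (cong₂ (λ a b → y (src e) * a + y (dst e) * b) src-w q)
        (solve 4 (λ a b s t → a :* (:- (s :* t)) :+ b :* t := t :* (b :- s :* a)) refl
          (y (src e)) (y (dst e)) (signℚ (σ e)) (w e)))
    where
    src-w : ν (src e) e ≡ - (signℚ (σ e) * w e)
    src-w = trans (trans (sym (ℚP.*-identityˡ (ν (src e) e)))
        (cong (_* ν (src e) e) (sym (signℚ-square (σ e)))))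
      (trans (solve 2 (λ s t → s :* s :* t := :- (s :* (:- (s :* t)))) refl (signℚ (σ e)) (ν (src e) e))
        (cong (λ q → - (signℚ (σ e) * q)) (trans (sym (ν-dst e)) q)))

  private
    incident : Fin m → Fin n → Bool
    incident e i = (src e == i) ∨ (dst e == i)

  -- Degree and adjacency are themselves sums over edges, so the identity is checked edge by edge,
  -- by comparing `i` and `j` with the two ends.
  laplacian-νν : laplacian Γ ≈ ν ∙ (ν ᵗ)
  laplacian-νν i j = trans (cong (_- adjacency Γ i j) degree-sum)
    (trans (sym (∑-minus (allFin m) (λ e → ι (i == j) * ι (incident e i)) _)) (∑-cong (allFin m) entry))
    where
    degree-sum : (if i == j then ℕtoℚ (degree Γ i) else 0ℚ) ≡
      ∑ (allFin m) (λ e → ι (i == j) * ι (incident e i))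
    degree-sum = trans (scale (i == j)) (∑-*ˡ (allFin m) (ι (i == j)) (λ e → ι (incident e i)))
      where
      scale : ∀ b → (if b then ℕtoℚ (degree Γ i) else 0ℚ) ≡ ι b * ∑ (allFin m) (λ e → ι (incident e i))
      scale true  = trans (ℕtoℚ-count m (λ e → incident e i)) (sym (ℚP.*-identityˡ _))
      scale false = sym (ℚP.*-zeroˡ (∑ (allFin m) (λ e → ι (incident e i))))
    entry : ∀ e → ι (i == j) * ι (incident e i) -
      (if ((src e == i) ∧ (dst e == j)) ∨ ((src e == j) ∧ (dst e == i)) then signℚ (σ e) else 0ℚ) ≡ ν i e * ν j e
    entry e with src e ≟ i | dst e ≟ i | src e ≟ j | dst e ≟ j
    ... | yes refl | yes d    | _        | _        = contradiction (sym d) (src≢dst e)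
    ... | _        | _        | yes refl | yes d    = contradiction (sym d) (src≢dst e)
    ... | yes refl | no _     | yes refl | no _     rewrite ==-refl (src e) = sym (ν-src² e)
    ... | yes refl | no _     | no _     | yes refl rewrite ==-≢ (src≢dst e) = sym
          (trans (cong (ν (src e) e *_) (ν-dst e)) (trans
            (solve 2 (λ s t → t :* (:- (s :* t)) := con 0ℚ :* con 1ℚ :- s :* (t :* t)) refl (signℚ (σ e)) (ν (src e) e))
            (trans (cong (λ q → 0ℚ - signℚ (σ e) * q) (ν-src² e)) (cong (λ q → 0ℚ - q) (ℚP.*-identityʳ (signℚ (σ e)))))))
    ... | yes refl | no _     | no p     | no q     rewrite ==-≢ (p) = sym
          (trans (cong (ν (src e) e *_) (ν-off j e (p ∘ sym) (q ∘ sym))) (ℚP.*-zeroʳ (ν (src e) e)))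
    ... | no _     | yes refl | yes refl | no _     rewrite ==-≢ (src≢dst e ∘ sym) = sym
          (trans (cong (_* ν (src e) e) (ν-dst e)) (trans
            (solve 2 (λ s t → (:- (s :* t)) :* t := con 0ℚ :* con 1ℚ :- s :* (t :* t)) refl (signℚ (σ e)) (ν (src e) e))
            (trans (cong (λ q → 0ℚ - signℚ (σ e) * q) (ν-src² e)) (cong (λ q → 0ℚ - q) (ℚP.*-identityʳ (signℚ (σ e)))))))
    ... | no _     | yes refl | no _     | yes refl rewrite ==-refl (dst e) = sym
          (trans (cong₂ _*_ (ν-dst e) (ν-dst e)) (trans
            (solve 2 (λ s t → (:- (s :* t)) :* (:- (s :* t)) := (s :* s) :* (t :* t)) refl (signℚ (σ e)) (ν (src e) e))
            (cong₂ _*_ (signℚ-square (σ e)) (ν-src² e))))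
    ... | no _     | yes refl | no p     | no q     rewrite ==-≢ q = sym
          (trans (cong (ν (dst e) e *_) (ν-off j e (p ∘ sym) (q ∘ sym))) (ℚP.*-zeroʳ (ν (dst e) e)))
    ... | no p     | no q     | x        | y        = trans (off x y) (sym
          (trans (cong (_* ν j e) (ν-off i e (p ∘ sym) (q ∘ sym))) (ℚP.*-zeroˡ (ν j e))))
      where
      off : ∀ x y → ι (i == j) * 0ℚ - (if ⌊ x ⌋ ∧ false then signℚ (σ e) else 0ℚ) ≡ 0ℚ
      off x y with ⌊ x ⌋
      ... | true  = trans (cong (_- 0ℚ) (ℚP.*-zeroʳ (ι (i == j)))) refl
      ... | false = trans (cong (_- 0ℚ) (ℚP.*-zeroʳ (ι (i == j)))) refl

-- Unbalanced unicyclic components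

add-remove : ∀ {n m} (Γ : SignedGraph n m) {S k} → lookup S k ≡ true → add (remove Γ S k) k ≡ S
add-remove Γ {S} {k} h = trans (VP.updateAt-updateAt k S) (VP.updateAt-id-local k S (sym h))

remove-add : ∀ {n m} (Γ : SignedGraph n m) {S k} → lookup S k ≡ false → remove Γ (add S k) k ≡ S
remove-add Γ {S} {k} h = trans (VP.updateAt-updateAt k S) (VP.updateAt-id-local k S (sym h))

signℚ-≢0 : ∀ s → signℚ s ≢ 0ℚ
signℚ-≢0 Sign.+ ()
signℚ-≢0 Sign.- ()

sign-product-+ : ∀ {s t} → s Sign.* t ≡ Sign.+ → s ≡ t
sign-product-+ {Sign.+} {Sign.+} h = refl
sign-product-+ {Sign.-} {Sign.-} h = refl

signℚ-≢ : ∀ {s t} → s ≢ t → signℚ s ≡ - signℚ t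
signℚ-≢ {Sign.+} {Sign.+} h = contradiction refl h
signℚ-≢ {Sign.+} {Sign.-} h = refl
signℚ-≢ {Sign.-} {Sign.+} h = refl
signℚ-≢ {Sign.-} {Sign.-} h = contradiction refl h

not-true : ∀ {b} → not b ≡ true → b ≡ false
not-true {false} h = refl

∨-elim : ∀ {a b} → a ∨ b ≡ true → a ≡ true ⊎ b ≡ true
∨-elim {true}  h = inj₁ refl
∨-elim {false} h = inj₂ h

minus : ∀ {s} → not (isPlus s) ≡ true → s ≡ Sign.-
minus {Sign.-} h = refl

signOf : ∀ {P : Set} → Dec P → Sign
signOf (yes _) = Sign.+
signOf (no  _) = Sign.-

≢-neg : ∀ {b} → b ≢ 0ℚ → b ≢ - b
≢-neg {b} b≢0 q = b≢0 (*-cancelˡ {1ℚ + 1ℚ} (λ ())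
  (trans (solve 1 (λ a → (con 1ℚ :+ con 1ℚ) :* a := a :+ a) refl b)
  (trans (cong (b +_) q) (trans (ℚP.+-inverseʳ b) (sym (ℚP.*-zeroʳ (1ℚ + 1ℚ)))))))

-- As `b` is nonzero it differs from its negative, so testing `a` against `b` recovers the sign.
signOf-value : ∀ {a b} (d : Dec (a ≡ b)) → b ≢ 0ℚ → ∀ s → a ≡ signℚ s * b → signOf d ≡ s
signOf-value         (yes _) b≢0 Sign.+ q = refl
signOf-value {b = b} (yes p) b≢0 Sign.- q = contradiction
  (trans (sym p) (trans q (solve 1 (λ a → con (- 1ℚ) :* a := :- a) refl b))) (≢-neg b≢0)
signOf-value {b = b} (no ¬p) b≢0 Sign.+ q = contradiction (trans q (ℚP.*-identityˡ b)) ¬p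
signOf-value         (no _)  b≢0 Sign.- q = refl

4ℚ : ℚ
4ℚ = ℕtoℚ 4

ℕtoℚ-4* : ∀ a → ℕtoℚ (4 ℕ.* a) ≡ 4ℚ * ℕtoℚ a
ℕtoℚ-4* a = trans (ℕtoℚ-+ a (a ℕ.+ (a ℕ.+ (a ℕ.+ 0))))
  (trans (cong (ℕtoℚ a +_) (trans (ℕtoℚ-+ a (a ℕ.+ (a ℕ.+ 0))) (cong (ℕtoℚ a +_)
    (trans (ℕtoℚ-+ a (a ℕ.+ 0)) (cong (ℕtoℚ a +_) (ℕtoℚ-+ a 0))))))
  (solve 1 (λ x → x :+ (x :+ (x :+ (x :+ con 0ℚ))) := con 4ℚ :* x) refl (ℕtoℚ a)))

module Unicyclic {n m} (Γ : SignedGraph n m) (N : Fin n → Fin m → ℤ) (inc : IsIncidence Γ N) where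
  open SignedGraph Γ
  open Incidence Γ N inc public
  open Formulas Γ N using (isRep; compIsTree; compCycleSign; compUnbalancedUnicyclic; isTU; weight; NHdag; sgnToEdge)

  -- The members of 𝒯𝒰ₙ without reference to cycles: by counting, a spanning subgraph with n
  -- edges has only unbalanced unicyclic components as soon as no component has a potential.
  record Good (H : EdgeSet m) : Set where
    field
      size      : count m (lookup H) ≡ n
      unicyclic : ∀ x → ∣V∣ H x ≡ ∣E∣ H x
      full      : ∀ x g → ¬ Potential H x g
  open Good

  hasCycle : ∀ {H} x → ∣V∣ H x ≡ ∣E∣ H x → HasCycle H x
  hasCycle {H} x h with tree-or-cycle H x
  ... | inj₁ (_ , q) = contradiction (trans (sym q) h) ℕP.1+n≢n
  ... | inj₂ (c , _) = c

  -- Deleting the edge leaves one edge fewer than vertices, which `tree-or-cycle` allows only for a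
  -- tree.
  unicyclic-∖ : ∀ {H x e} → ∣V∣ H x ≡ ∣E∣ H x → OnCycle H e → Reach H x (src e) → Tree (H ∖ e) x
  unicyclic-∖ {H} {x} {e} h c r with tree-or-cycle (H ∖ e) x
  ... | inj₁ (t , _) = t
  ... | inj₂ (_ , q) = contradiction
        (subst (_≤ ∣E∣ (H ∖ e) x) (trans (sym (∣V∣-cycle e c x)) (trans h (∣E∣-cycle e c r))) q) ℕP.1+n≰n

  Tree-move : ∀ {S x y} → Reach S x y → Tree S x → Tree S y
  Tree-move r t e e∈ q = t e e∈ (Reach-trans r q)

  sgnEdges-filter : ∀ (p : Fin m → Bool) (es : List (Fin m)) → sgnEdges Γ (filterᵇ p es) ≡
    List.foldr Sign._*_ Sign.+ (List.map (λ e → if p e then σ e else Sign.+) es)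
  sgnEdges-filter p [] = refl
  sgnEdges-filter p (e ∷ es) with p e
  ... | true  = cong (σ e Sign.*_) (sgnEdges-filter p es)
  ... | false = sgnEdges-filter p es

  -- Apart from `e`, the edges of the cycle are exactly those separating the ends of `e` in the tree
  -- `H ∖ e`, so the two products agree factor by factor.
  cycleSign-formula : ∀ {H x e} → ∣V∣ H x ≡ ∣E∣ H x → OnCycle H e → Reach H x (src e) →
    compCycleSign H x ≡ σ e Sign.* treePotential (H ∖ e) (src e) (dst e)
  cycleSign-formula {H} {x} {e} uni c r = trans (sgnEdges-filter p (allFin m))
    (∏-update {f = λ f → if p f then σ f else Sign.+} {g = pathFactor (H ∖ e) (src e) (dst e)}
      e (σ e) at-e off-e)
    where
    p : Fin m → Bool
    p f = compEdgeᵇ H x f ∧ onCycle Γ H f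
    S : EdgeSet m
    S = H ∖ e
    e∈ : lookup H e ≡ true
    e∈ = proj₁ (onCycle-elim {H} c)
    ab : Reach S (src e) (dst e)
    ab = proj₂ (onCycle-elim {H} c)
    tree : Tree S x
    tree = unicyclic-∖ uni c r
    at-e : (if p e then σ e else Sign.+) ≡ σ e Sign.* pathFactor S (src e) (dst e) e
    at-e = trans (cong (λ b → if b then σ e else Sign.+) (cong₂ _∧_ (compEdge-intro {H} e∈ r) c))
      (sym (trans (cong (λ b → σ e Sign.* (if b ∧ not (reach Γ (S ∖ e) (src e) (dst e)) then σ e else Sign.+))
                        (lookup-∖ H e)) (SP.*-identityʳ (σ e))))
    off-e : ∀ f → f ≢ e → (if p f then σ f else Sign.+) ≡ pathFactor S (src e) (dst e) f
    off-e f f≢e = cong (λ b → if b then σ f else Sign.+) (bool-≡ to from)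
      where
      to : p f ≡ true → lookup S f ∧ not (reach Γ (S ∖ f) (src e) (dst e)) ≡ true
      -- If `f` did not separate the ends of `e`, the detour around `f` could be rerouted past `e`,
      -- which would put `f` on a cycle of the tree `S`.
      to h = cong₂ _∧_ f∈S (cong not (¬true⇒false (λ u → separated u (Reach-split e s))))
        where
        ce : lookup H f ≡ true × Reach H x (src f)
        ce = ∧-true {lookup H f} (proj₁ (∧-true {compEdgeᵇ H x f} h))
        s : Reach (H ∖ f) (src f) (dst f)
        s = proj₂ (onCycle-elim {H} {f} (proj₂ (∧-true {compEdgeᵇ H x f} h)))
        f∈S : lookup S f ≡ true
        f∈S = trans (lookup-∖-≢ H f≢e) (proj₁ ce)
        br : ¬ Reach (S ∖ f) (src f) (dst f)
        br = bridge f∈S (tree f f∈S (Reach-reroute e ab (proj₂ ce)))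
        across : ∀ {u v} → Reach (H ∖ f ∖ e) u v → Reach (S ∖ f) u v
        across = Reach-mono (∖-comm-⊆ H f e)
        separated : Reach (S ∖ f) (src e) (dst e) →
          Reach (H ∖ f ∖ e) (src f) (dst f) ⊎
          (Reach (H ∖ f ∖ e) (src f) (src e) × Reach (H ∖ f ∖ e) (dst e) (dst f)) ⊎
          (Reach (H ∖ f ∖ e) (src f) (dst e) × Reach (H ∖ f ∖ e) (src e) (dst f)) → ⊥
        separated u (inj₁ v)               = br (across v)
        separated u (inj₂ (inj₁ (v , v'))) = br (Reach-trans (across v) (Reach-trans u (across v')))
        separated u (inj₂ (inj₂ (v , v'))) = br (Reach-trans (across v) (Reach-trans (Reach-sym u) (across v')))
      from : lookup S f ∧ not (reach Γ (S ∖ f) (src e) (dst e)) ≡ true → p f ≡ true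
      -- A separating `f` lies on the tree path between the ends of `e`; the rest of that path
      -- together with `e` leads around `f`.
      from h = cong₂ _∧_ (compEdge-intro {H} f∈ (proj₁ found)) (onCycle-intro {H} f∈ (proj₂ found))
        where
        f∈S : lookup S f ≡ true
        f∈S = proj₁ (∧-true {lookup S f} h)
        f∈ : lookup H f ≡ true
        f∈ = ∖-⊆ H e f∈S
        down : ∀ {u v} → Reach (S ∖ f) u v → Reach (H ∖ f) u v
        down = Reach-mono (∖-mono S H f (∖-⊆ H e))
        e∈f : lookup (H ∖ f) e ≡ true
        e∈f = trans (lookup-∖-≢ H (f≢e ∘ sym)) e∈
        join : Reach (S ∖ f) (src e) (dst e) ⊎
          (Reach (S ∖ f) (src e) (src f) × Reach (S ∖ f) (dst f) (dst e)) ⊎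
          (Reach (S ∖ f) (src e) (dst f) × Reach (S ∖ f) (src f) (dst e)) →
          Reach H x (src f) × Reach (H ∖ f) (src f) (dst f)
        join (inj₁ u) = true≢false u (not-true (proj₂ (∧-true {lookup S f} h)))
        join (inj₂ (inj₁ (u , v))) = Reach-trans r (Reach-∖ f (down u)) ,
          Reach-trans (Reach-sym (down u)) (Reach-trans (Reach-edge e e∈f) (Reach-sym (down v)))
        join (inj₂ (inj₂ (u , v))) =
          Reach-trans r (Reach-trans (Reach-∖ f (down u)) (Reach-edge˘ f f∈)) ,
          Reach-trans (down v) (Reach-trans (Reach-edge˘ e e∈f) (down u))
        found : Reach H x (src f) × Reach (H ∖ f) (src f) (dst f)
        found = join (Reach-split f ab)

  module _ {H : EdgeSet m} {x : Fin n} {e : Fin m} (uni : ∣V∣ H x ≡ ∣E∣ H x) (c : OnCycle H e) (r : Reach H x (src e)) where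
    private
      S : EdgeSet m
      S = H ∖ e
      e∈ : lookup H e ≡ true
      e∈ = proj₁ (onCycle-elim {H} c)
      ab : Reach S (src e) (dst e)
      ab = proj₂ (onCycle-elim {H} c)
      h : Fin n → Sign
      h = treePotential S (src e)
      pot : Potential S (src e) h
      pot = treePotential-potential (Tree-move (Reach-reroute e ab r) (unicyclic-∖ uni c r))

    -- On the tree `S` the given potential equals `h` up to one sign; comparing the two across `e`
    -- evaluates the cycle sign.
    potential⇒cycle-+ : ∀ g → Potential H x g → compCycleSign H x ≡ Sign.+
    potential⇒cycle-+ g pg = trans (cycleSign-formula uni c r) (SP.*-cancelˡ-≡ (g (src e)) _ _
      (trans (sym (SP.*-assoc (g (src e)) (σ e) (h (dst e))))
      (trans (cong (Sign._* h (dst e)) (pg e e∈ r))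
      (trans (potential-unique g h (Potential-⊆ g (∖-⊆ H e) r pg) pot ab)
             (cong (g (src e) Sign.*_) (treePotential-root S (src e)))))))

    -- Only the closing edge `e` is not covered by the tree potential, and positivity of the cycle
    -- is exactly the condition that `e` imposes.
    cycle-+⇒potential : compCycleSign H x ≡ Sign.+ → Potential H x h
    cycle-+⇒potential s f f∈ q with f ≟ e
    ... | yes refl = trans (cong (Sign._* σ f) (treePotential-root S (src f)))
            (sign-product-+ (trans (sym (cycleSign-formula uni c r)) s))
    ... | no  f≢e  = pot f (trans (lookup-∖-≢ H f≢e) f∈) (Reach-reroute e ab (Reach-trans (Reach-sym r) q))

  cycle-negative : ∀ {H} → Good H → ∀ x → compCycleSign H x ≡ Sign.-
  cycle-negative {H} gd x with hasCycle x (unicyclic gd x)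
  ... | e , c , r with compCycleSign H x in eq
  ...   | Sign.- = refl
  ...   | Sign.+ = ⊥-elim (full gd x (treePotential (H ∖ e) (src e)) (cycle-+⇒potential (unicyclic gd x) c r eq))

  Good⇒unbalanced : ∀ {H} → Good H → ∀ x → compUnbalancedUnicyclic H x ≡ true
  Good⇒unbalanced {H} gd x = cong₂ _∧_ (≡ᵇ-complete (sym (unicyclic gd x)))
    (cong (not ∘ isPlus) (cycle-negative gd x))

  Good⇒TU : ∀ {H} → Good H → isTU H ≡ true
  Good⇒TU {H} gd = cong₂ _∧_ (≡ᵇ-complete (size gd))
    (all-intro _ (allFin n) (λ x → ∨-introʳ {a = compIsTree H x} (Good⇒unbalanced gd x)))

  -- The components partition the `n` vertices and the `n` edges, so the excesses cancel.
  excess-sum : ∀ {H} → count m (lookup H) ≡ n →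
    ∑ (allFin n) (λ r → ι (isRep H r) * (ℕtoℚ (∣V∣ H r) - ℕtoℚ (∣E∣ H r))) ≡ 0ℚ
  excess-sum {H} sz = trans
    (∑-cong (allFin n) (λ r → solve 3 (λ a b c → a :* (b :- c) := a :* b :- a :* c) refl
       (ι (isRep H r)) (ℕtoℚ (∣V∣ H r)) (ℕtoℚ (∣E∣ H r))))
    (trans (∑-minus (allFin n) (λ r → ι (isRep H r) * ℕtoℚ (∣V∣ H r)) (λ r → ι (isRep H r) * ℕtoℚ (∣E∣ H r)))
    (trans (cong₂ _-_ (∑-representatives H (λ _ → true) id) (∑-representatives H (lookup H) src))
    (trans (cong₂ (λ a b → ℕtoℚ a - ℕtoℚ b) (count-all n) sz) (ℚP.+-inverseʳ (ℕtoℚ n)))))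
    where
    count-all : ∀ k → count k (λ _ → true) ≡ k
    count-all k = trans (filter-true (allFin k)) (LP.length-tabulate id)
      where
      filter-true : (xs : List (Fin k)) → length (filterᵇ (λ _ → true) xs) ≡ length xs
      filter-true []       = refl
      filter-true (x ∷ xs) = cong suc (filter-true xs)

  ∣V∣-move : ∀ {H x y} → Reach H x y → ∣V∣ H x ≡ ∣V∣ H y
  ∣V∣-move r = count-cong n (λ v → bool-≡ (Reach-trans (Reach-sym r)) (Reach-trans r))

  ∣E∣-move : ∀ {H x y} → Reach H x y → ∣E∣ H x ≡ ∣E∣ H y
  ∣E∣-move {H} r = count-cong m (λ e → cong (lookup H e ∧_) (bool-≡ (Reach-trans (Reach-sym r)) (Reach-trans r)))

  scaled-nonNeg : ∀ b {q} → 0ℚ ℚ.≤ q → 0ℚ ℚ.≤ ι b * q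
  scaled-nonNeg true  h = subst (0ℚ ℚ.≤_) (sym (ℚP.*-identityˡ _)) h
  scaled-nonNeg false {q} h = subst (0ℚ ℚ.≤_) (sym (ℚP.*-zeroˡ q)) ℚP.≤-refl

  ℕtoℚ-∸-nonNeg : ∀ {a b} → a ≤ b → 0ℚ ℚ.≤ ℕtoℚ b - ℕtoℚ a
  ℕtoℚ-∸-nonNeg {a} {b} h = subst (0ℚ ℚ.≤_)
    (trans (solve 2 (λ x y → x := (y :+ x) :- y) refl (ℕtoℚ (b ℕ.∸ a)) (ℕtoℚ a))
      (cong (_- ℕtoℚ a) (trans (sym (ℕtoℚ-+ a (b ℕ.∸ a))) (cong ℕtoℚ (ℕP.m+[n∸m]≡n h)))))
    (ℕtoℚ-nonNeg (b ℕ.∸ a))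

  difference-zero : ∀ {a b} → ℕtoℚ a - ℕtoℚ b ≡ 0ℚ → a ≡ b
  difference-zero {a} {b} h = ℕtoℚ-injective (trans
    (solve 2 (λ x y → x := (x :- y) :+ y) refl (ℕtoℚ a) (ℕtoℚ b))
    (trans (cong (_+ ℕtoℚ b) h) (ℚP.+-identityˡ (ℕtoℚ b))))

  unicyclic-from-representatives : ∀ {H} → (∀ r → isRep H r ≡ true → ∣V∣ H r ≡ ∣E∣ H r) →
    ∀ x → ∣V∣ H x ≡ ∣E∣ H x
  unicyclic-from-representatives {H} h x with representative H x
  ... | r , hr , q = trans (∣V∣-move q) (trans (h r hr) (sym (∣E∣-move q)))

  -- A tree has a potential, so no component is a tree and each has at least as many edges as
  -- vertices; the total excess being zero, equality holds everywhere.
  full⇒Good : ∀ {H} → count m (lookup H) ≡ n → (∀ x g → ¬ Potential H x g) → Good H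
  full⇒Good {H} sz fl = record { size = sz ; unicyclic = unicyclic-from-representatives uni ; full = fl }
    where
    E≥V : ∀ x → ∣V∣ H x ≤ ∣E∣ H x
    E≥V x with tree-or-cycle H x
    ... | inj₁ (t , _) = ⊥-elim (fl x (treePotential H x) (treePotential-potential t))
    ... | inj₂ (_ , q) = q
    excess : Fin n → ℚ
    excess r = ι (isRep H r) * (ℕtoℚ (∣E∣ H r) - ℕtoℚ (∣V∣ H r))
    total : ∑ (allFin n) excess ≡ 0ℚ
    total = trans (∑-cong (allFin n) (λ r → solve 3 (λ a b c → a :* (c :- b) := :- (a :* (b :- c))) refl
              (ι (isRep H r)) (ℕtoℚ (∣V∣ H r)) (ℕtoℚ (∣E∣ H r))))
      (trans (∑-neg (allFin n) (λ r → ι (isRep H r) * (ℕtoℚ (∣V∣ H r) - ℕtoℚ (∣E∣ H r)))) (cong -_ (excess-sum sz)))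
    uni : ∀ r → isRep H r ≡ true → ∣V∣ H r ≡ ∣E∣ H r
    uni r hr = sym (difference-zero (trans (sym (ℚP.*-identityˡ _)) (trans
      (cong (λ b → ι b * (ℕtoℚ (∣E∣ H r) - ℕtoℚ (∣V∣ H r))) (sym hr))
      (∑-nonNeg-zero (allFin n) (λ r → scaled-nonNeg (isRep H r) (ℕtoℚ-∸-nonNeg (E≥V r))) total (MemP.∈-allFin r)))))

  -- Now the count runs the other way: trees and unicyclic components have at least as many vertices
  -- as edges, so the zero total excess rules out trees, and what remains has a negative cycle and
  -- hence no potential.
  TU⇒Good : ∀ {H} → isTU H ≡ true → Good H
  TU⇒Good {H} h = record { size = sz ; unicyclic = uni ; full = fl }
    where
    sz : count m (lookup H) ≡ n
    sz = ≡ᵇ-sound (proj₁ (∧-true {length (filterᵇ (lookup H) (allFin m)) ℕ.≡ᵇ n} h))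
    component : ∀ x → Tree H x ⊎ (∣V∣ H x ≡ ∣E∣ H x × compCycleSign H x ≡ Sign.-)
    component x = cases (∨-elim (all-elim (λ x → compIsTree H x ∨ compUnbalancedUnicyclic H x)
        (proj₂ (∧-true {length (filterᵇ (lookup H) (allFin m)) ℕ.≡ᵇ n} h)) (MemP.∈-allFin x)))
      where
      cases : compIsTree H x ≡ true ⊎ compUnbalancedUnicyclic H x ≡ true →
        Tree H x ⊎ (∣V∣ H x ≡ ∣E∣ H x × compCycleSign H x ≡ Sign.-)
      cases (inj₁ t) = inj₁ (λ e e∈ r → ¬true⇒false (λ c → true≢false (cong₂ _∧_ (compEdge-intro {H} e∈ r) c)
        (any-false (λ e → compEdgeᵇ H x e ∧ onCycle Γ H e) (not-true t) (MemP.∈-allFin e))))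
      cases (inj₂ u) = inj₂ (sym (≡ᵇ-sound (proj₁ (∧-true {∣E∣ H x ℕ.≡ᵇ ∣V∣ H x} u))) ,
        minus (proj₂ (∧-true {∣E∣ H x ℕ.≡ᵇ ∣V∣ H x} u)))
    V≥E : ∀ x → ∣E∣ H x ≤ ∣V∣ H x
    V≥E x with component x | tree-or-cycle H x
    ... | inj₂ (q , _) | _            = ℕP.≤-reflexive (sym q)
    ... | inj₁ _       | inj₁ (_ , q) = subst (∣E∣ H x ≤_) (sym q) (ℕP.n≤1+n _)
    ... | inj₁ t       | inj₂ ((e , c , r) , _) = true≢false c (t e (proj₁ (onCycle-elim {H} c)) r)
    uni : ∀ x → ∣V∣ H x ≡ ∣E∣ H x
    uni = unicyclic-from-representatives (λ r hr → difference-zero (trans (sym (ℚP.*-identityˡ _)) (trans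
      (cong (λ b → ι b * (ℕtoℚ (∣V∣ H r) - ℕtoℚ (∣E∣ H r))) (sym hr))
      (∑-nonNeg-zero (allFin n) (λ r → scaled-nonNeg (isRep H r) (ℕtoℚ-∸-nonNeg (V≥E r)))
        (excess-sum sz) (MemP.∈-allFin r)))))
    fl : ∀ x g → ¬ Potential H x g
    fl x g pg = cases (component x) (hasCycle x (uni x))
      where
      cases : Tree H x ⊎ (∣V∣ H x ≡ ∣E∣ H x × compCycleSign H x ≡ Sign.-) → HasCycle H x → ⊥
      cases (inj₁ t)       (e , c , r) = true≢false c (t e (proj₁ (onCycle-elim {H} c)) r)
      cases (inj₂ (q , s)) (e , c , r) = case trans (sym s) (potential⇒cycle-+ q c r g pg) of λ ()

  -- The equations make `y` constant up to sign on each component. If `y v` were nonzero, the signs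
  -- relative to `y v` would form a potential, against `full`.
  Good⇒nondegenerate : ∀ {H} → Good H → ∀ y → (∀ e → lookup H e ≡ true → y ·ν e ≡ 0ℚ) → ∀ v → y v ≡ 0ℚ
  Good⇒nondegenerate {H} gd y h v = decide (y v ℚP.≟ 0ℚ)
    where
    g : Fin n → Sign
    g z = signOf (y z ℚP.≟ y v)
    step : ∀ e → lookup H e ≡ true → ∀ s → y (src e) ≡ signℚ s * y v → y (dst e) ≡ signℚ (s Sign.* σ e) * y v
    step e e∈ s q = *-cancelˡ (signℚ-≢0 (σ e)) (trans (sym (·ν-zero y e (h e e∈))) (trans q
      (trans (cong (λ t → t * y v) (trans (sym (ℚP.*-identityʳ (signℚ s))) (cong (signℚ s *_) (sym (signℚ-square (σ e))))))
        (trans (solve 3 (λ a b c → a :* (b :* b) :* c := b :* ((a :* b) :* c)) refl (signℚ s) (signℚ (σ e)) (y v))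
          (cong (λ t → signℚ (σ e) * (t * y v)) (sym (signℚ-* s (σ e))))))))
    reached : ∀ {z} → Reach H v z → ∃ λ s → y z ≡ signℚ s * y v
    reached = Reach-ind (λ z → ∃ λ s → y z ≡ signℚ s * y v)
      (λ e e∈ _ (s , q) → s Sign.* σ e , step e e∈ s q)
      (λ e e∈ _ (s , q) → σ e Sign.* s , trans (·ν-zero y e (h e e∈)) (trans (cong (signℚ (σ e) *_) q)
          (trans (sym (ℚP.*-assoc (signℚ (σ e)) (signℚ s) (y v))) (cong (_* y v) (sym (signℚ-* (σ e) s))))))
      (Sign.+ , sym (ℚP.*-identityˡ (y v)))
    decide : Dec (y v ≡ 0ℚ) → y v ≡ 0ℚ
    decide (yes p) = p
    decide (no ¬p) = ⊥-elim (full gd v g pot)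
      where
      g-value : ∀ {z} s → y z ≡ signℚ s * y v → g z ≡ s
      g-value {z} s q = signOf-value (y z ℚP.≟ y v) ¬p s q
      pot : Potential H v g
      pot e e∈ r = trans (cong (Sign._* σ e) (g-value {src e} (proj₁ (reached r)) (proj₂ (reached r))))
        (sym (g-value {dst e} (proj₁ (reached r) Sign.* σ e) (step e e∈ (proj₁ (reached r)) (proj₂ (reached r)))))

  -- The shape of all rows of N_H†: for a potential `g` this is a left null vector of the columns in
  -- `S`, supported on a single component.
  supported : EdgeSet m → Fin n → ℚ → (Fin n → Sign) → Fin n → ℚ
  supported S A α g v = if reach Γ S A v then α * signℚ (g v) else 0ℚ

  supported-on : ∀ {S A α g v} → Reach S A v → supported S A α g v ≡ α * signℚ (g v)
  supported-on {α = α} {g} {v} r = cong (λ b → if b then α * signℚ (g v) else 0ℚ) r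

  supported-off : ∀ {S A α g v} → ¬ Reach S A v → supported S A α g v ≡ 0ℚ
  supported-off {α = α} {g} {v} r = cong (λ b → if b then α * signℚ (g v) else 0ℚ) (¬true⇒false r)

  supported-·ν : ∀ {S A α g} → Potential S A g → ∀ e → lookup S e ≡ true → supported S A α g ·ν e ≡ 0ℚ
  supported-·ν {S} {A} {α} {g} pot e e∈ = zero-·ν (supported S A α g) e eq
    where
    eq : supported S A α g (src e) ≡ signℚ (σ e) * supported S A α g (dst e)
    eq with reach Γ S A (src e) in r
    ... | true  = trans (cong (α *_) (trans (sym (ℚP.*-identityʳ (signℚ (g (src e))))) (cong (signℚ (g (src e)) *_) (sym (signℚ-square (σ e))))))
        (trans (solve 3 (λ a g s → a :* (g :* (s :* s)) := s :* (a :* (g :* s))) refl α (signℚ (g (src e))) (signℚ (σ e)))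
          (cong (signℚ (σ e) *_) (trans (cong (α *_) (trans (sym (signℚ-* (g (src e)) (σ e))) (cong signℚ (pot e e∈ r))))
            (sym (supported-on {S} {A} {α} {g} (Reach-trans r (Reach-edge e e∈)))))))
    ... | false = sym (trans (cong (signℚ (σ e) *_) (supported-off {S} {A} {α} {g}
        (λ q → true≢false (Reach-trans q (Reach-edge˘ e e∈)) r))) (ℚP.*-zeroʳ (signℚ (σ e))))

  -- A potential, extended by zero outside its component, would be a nonzero left null vector.
  nondegenerate⇒full : ∀ {H} → (∀ y → (∀ e → lookup H e ≡ true → y ·ν e ≡ 0ℚ) → ∀ v → y v ≡ 0ℚ) →
    ∀ x g → ¬ Potential H x g
  nondegenerate⇒full {H} nd x g pot = signℚ-≢0 (g x) (trans (sym (ℚP.*-identityˡ (signℚ (g x))))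
    (trans (sym (supported-on {H} {x} {1ℚ} {g} Reach-refl))
      (nd (supported H x 1ℚ g) (supported-·ν {α = 1ℚ} {g} pot) x)))

-- Rows of N_H† for unbalanced graphs and their exchange

-- The origin of the base 4 in the weights: distinct signs differ by ±2.
signℚ-∓ : ∀ s t → signℚ s - signℚ t ≢ 0ℚ → (signℚ s - signℚ t) * (signℚ s - signℚ t) ≡ 4ℚ
signℚ-∓ Sign.+ Sign.+ h = contradiction refl h
signℚ-∓ Sign.+ Sign.- h = refl
signℚ-∓ Sign.- Sign.+ h = refl
signℚ-∓ Sign.- Sign.- h = contradiction refl h

module UnbalancedRows {n m} (Γ : SignedGraph n m) (N : Fin n → Fin m → ℤ) (inc : IsIncidence Γ N) where
  open SignedGraph Γ
  open Unicyclic Γ N inc public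
  open Formulas Γ N using (isRep; compUnbalancedUnicyclic; weight; NHdag; sgnToEdge)
  open Good

  weight-Good : ∀ {H} → Good H → weight H ≡ ℕtoℚ (4 ℕ.^ components H)
  weight-Good {H} gd = cong (λ c → ℕtoℚ (4 ℕ.^ c)) (count-cong n {λ x → isRep H x ∧ compUnbalancedUnicyclic H x} {isRep H}
    (λ x → trans (cong (isRep H x ∧_) (Good⇒unbalanced gd x)) (BP.∧-identityʳ (isRep H x))))

  cycleSide : EdgeSet m → Fin m → Fin n → Bool
  cycleSide H k v =
    any (λ e → compEdgeᵇ H (tail k) e ∧ onCycle Γ H e ∧ reach Γ (H ∖ k) (src e) v) (allFin m)

  -- The tests inside `NHdag` become arguments, so that their known values can be substituted one by
  -- one.
  entry : (inU onC inC flip : Bool) (p s wk : ℚ) → ℚ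
  entry inU onC inC flip p s wk = if not inU then 0ℚ
    else wk * (if onC then ½ * p else if inC then 0ℚ else if flip then - s else s)

  NHdag-entry : ∀ H k v {inU onC inC flip} → reach Γ H (tail k) v ≡ inU → onCycle Γ H k ≡ onC →
    cycleSide H k v ≡ inC → isPlus (σ k) ∧ reach Γ (H ∖ k) (head k) v ≡ flip →
    NHdag H k v ≡ entry inU onC inC flip (pathSign Γ (H ∖ k) (tail k) v) (sgnToEdge H k v) (w k)
  NHdag-entry H k v refl refl refl refl = refl

  NHdag-outside : ∀ H k v → reach Γ H (tail k) v ≡ false → NHdag H k v ≡ 0ℚ
  NHdag-outside H k v h = NHdag-entry H k v h refl refl refl

  oriented-elim : ∀ e (P : Fin n → Fin n → Set) → P (src e) (dst e) → P (dst e) (src e) → P (tail e) (head e)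
  oriented-elim e P p q with orientation e
  ... | forward t h _  = subst₂ P (sym t) (sym h) p
  ... | backward t h _ = subst₂ P (sym t) (sym h) q

  Reach-tail-head : ∀ {S} e → Reach S (src e) (dst e) → Reach S (tail e) (head e)
  Reach-tail-head {S} e r = oriented-elim e (Reach S) r (Reach-sym r)

  Reach-tail-src : ∀ {S} e → Reach S (src e) (dst e) → Reach S (tail e) (src e)
  Reach-tail-src {S} e r = oriented-elim e (λ a _ → Reach S a (src e)) Reach-refl (Reach-sym r)

  bridge-tail-head : ∀ {S} e → ¬ Reach S (src e) (dst e) → ¬ Reach S (tail e) (head e)
  bridge-tail-head {S} e ¬r = oriented-elim e (λ a b → ¬ Reach S a b) ¬r (¬r ∘ Reach-sym)

  Reach-sides-tail : ∀ {H} e {v} → lookup H e ≡ true → Reach H (tail e) v →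
    Reach (H ∖ e) (tail e) v ⊎ Reach (H ∖ e) (head e) v
  Reach-sides-tail {H} e {v} e∈ r = oriented-elim e
    (λ a b → Reach (H ∖ e) a v ⊎ Reach (H ∖ e) b v) sides (swap sides)
    where
    sides : Reach (H ∖ e) (src e) v ⊎ Reach (H ∖ e) (dst e) v
    sides = Reach-sides e (Reach-trans (Reach-sym (Reach-tail-src e (Reach-edge e e∈))) r)

  tree-root-sign : ∀ {S A v} → Tree S A → Reach S A v → pathSign Γ S A v ≡ signℚ (treePotential S A v)
  tree-root-sign {S} {A} {v} t r = trans (pathSign-potential r (treePotential S A) (treePotential-potential t))
    (cong (λ s → signℚ (s Sign.* treePotential S A v)) (treePotential-root S A))

  -- `scale` expresses the weight through `S` alone, uniformly for both kinds of edges: a cycle edge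
  -- has α = ±1/2 and its deletion keeps the number of components, a bridge has α = ±1 and its
  -- deletion adds one. `S` is a separate parameter so that `add S k₀ ∖ k₀` can be replaced by `S`.
  record Row (H : EdgeSet m) (k : Fin m) (S : EdgeSet m) : Set where
    field
      A         : Fin n
      α         : ℚ
      g         : Fin n → Sign
      potential : Potential S A g
      value     : ∀ v → NHdag H k v ≡ supported S A α g v
      unit      : NHdag H k ·ν k ≡ 1ℚ
      scale     : 4ℚ * (α * α) * weight H ≡ ℕtoℚ (4 ℕ.^ components S)

  ·ν-cong : ∀ {y z} → (∀ v → y v ≡ z v) → ∀ e → y ·ν e ≡ z ·ν e
  ·ν-cong h e = ∑-cong (allFin n) (λ v → cong (_* ν v e) (h v))

  Row-killed : ∀ {H k S} → Row H k S → ∀ e → lookup S e ≡ true → NHdag H k ·ν e ≡ 0ℚ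
  Row-killed r e e∈ = trans (·ν-cong value e) (supported-·ν {α = α} {g} potential e e∈)
    where open Row r

  -- Since the cycle is negative, the ends of `k` carry α at the tail and -σα at the head. Column
  -- `k` therefore collects α twice, and `unit` forces the factor 1/2.
  cycleRow : ∀ {H k} → Good H → OnCycle H k → Row H k (H ∖ k)
  cycleRow {H} {k} gd c = record
    { A = tail k ; α = w k * ½ ; g = g ; potential = pot ; value = value ; unit = unit ; scale = scale }
    where
    S : EdgeSet m
    S = H ∖ k
    k∈ : lookup H k ≡ true
    k∈ = proj₁ (onCycle-elim {H} c)
    ab : Reach S (src k) (dst k)
    ab = proj₂ (onCycle-elim {H} c)
    tree : Tree S (tail k)
    tree = unicyclic-∖ (unicyclic gd (tail k)) c (Reach-tail-src k (Reach-edge k k∈))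
    g : Fin n → Sign
    g = treePotential S (tail k)
    pot : Potential S (tail k) g
    pot = treePotential-potential tree
    value : ∀ v → NHdag H k v ≡ supported S (tail k) (w k * ½) g v
    value v = cases (reach Γ S (tail k) v) refl
      where
      cases : ∀ b → reach Γ S (tail k) v ≡ b → NHdag H k v ≡ supported S (tail k) (w k * ½) g v
      cases true r = trans (NHdag-entry H k v (Reach-∖ k r) c refl refl)
        (trans (cong (λ q → w k * (½ * q)) (tree-root-sign tree r))
        (trans (sym (ℚP.*-assoc (w k) ½ (signℚ (g v)))) (sym (supported-on {S} {tail k} {w k * ½} {g} r))))
      cases false r = trans (NHdag-outside H k v (¬true⇒false (λ q → true≢false (Reach-reroute k ab q) r)))
        (sym (supported-off {S} {tail k} {w k * ½} {g} (λ q → true≢false q r)))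
    root : g (tail k) ≡ Sign.+
    root = treePotential-root S (tail k)
    -- Equality would extend the tree potential across `k` to the whole component in `H`, against
    -- `full`.
    g-head : g (head k) ≢ σ k
    g-head q = full gd (tail k) g potH
      where
      at-k : Oriented k → g (src k) Sign.* σ k ≡ g (dst k)
      at-k (forward t h _) = trans (cong (Sign._* σ k) (trans (cong g (sym t)) root))
        (trans (sym q) (cong g h))
      at-k (backward t h _) = trans (cong (Sign._* σ k) (trans (cong g (sym h)) q))
        (trans (SP.s*s≡+ (σ k)) (trans (sym root) (cong g t)))
      potH : Potential H (tail k) g
      potH f f∈ r with f ≟ k
      ... | yes refl = at-k (orientation k)
      ... | no  f≢k  = pot f (trans (lookup-∖-≢ H f≢k) f∈) (Reach-reroute k ab r)
    unit : NHdag H k ·ν k ≡ 1ℚ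
    unit = trans (·ν-cong value k) (trans (·ν-oriented (supported S (tail k) (w k * ½) g) k)
      (trans (cong₂ (λ a b → w k * (a - signℚ (σ k) * b))
        (trans (supported-on {S} {tail k} {w k * ½} {g} Reach-refl) (cong (λ s → w k * ½ * signℚ s) root))
        (trans (supported-on {S} {tail k} {w k * ½} {g} (Reach-tail-head k ab)) (cong (w k * ½ *_) (signℚ-≢ g-head))))
      (trans (solve 2 (λ w s → w :* (w :* con ½ :* con 1ℚ :- s :* (w :* con ½ :* (:- s))) :=
           w :* w :* (con ½ :* (con 1ℚ :+ s :* s))) refl (w k) (signℚ (σ k)))
        (cong₂ (λ a b → a * (½ * (1ℚ + b))) (w² k) (signℚ-square (σ k))))))
    scale : 4ℚ * (w k * ½ * (w k * ½)) * weight H ≡ ℕtoℚ (4 ℕ.^ components S)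
    scale = trans (solve 2 (λ w x → con 4ℚ :* (w :* con ½ :* (w :* con ½)) :* x := w :* w :* x) refl (w k) (weight H))
      (trans (cong (_* weight H) (w² k)) (trans (ℚP.*-identityˡ (weight H)) (trans (weight-Good gd)
        (cong (λ c → ℕtoℚ (4 ℕ.^ c)) (trans (cong components (sym (add-remove Γ k∈))) (components-same k ab))))))

  -- A detour around `e` that uses the bridge `k` would, together with `e` itself, reconnect the
  -- ends of `k`.
  onCycle-survives : ∀ {H k e} → lookup H k ≡ true → onCycle Γ H k ≡ false → OnCycle H e → OnCycle (H ∖ k) e
  onCycle-survives {H} {k} {e} k∈ nc c = onCycle-intro e∈S (join (Reach-split k (proj₂ (onCycle-elim {H} c))))
    where
    e≢k : e ≢ k
    e≢k refl = true≢false c nc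
    e∈S : lookup (H ∖ k) e ≡ true
    e∈S = trans (lookup-∖-≢ H e≢k) (proj₁ (onCycle-elim {H} c))
    across : ∀ {u v} → Reach (H ∖ e ∖ k) u v → Reach (H ∖ k ∖ e) u v
    across = Reach-mono (∖-comm-⊆ H e k)
    br : ¬ Reach (H ∖ k) (src k) (dst k)
    br = bridge k∈ nc
    join : Reach (H ∖ e ∖ k) (src e) (dst e) ⊎
      (Reach (H ∖ e ∖ k) (src e) (src k) × Reach (H ∖ e ∖ k) (dst k) (dst e)) ⊎
      (Reach (H ∖ e ∖ k) (src e) (dst k) × Reach (H ∖ e ∖ k) (src k) (dst e)) →
      Reach (H ∖ k ∖ e) (src e) (dst e)
    join (inj₁ r) = across r
    join (inj₂ (inj₁ (r , s))) = contradiction (Reach-trans (Reach-sym (Reach-∖ e (across r)))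
      (Reach-trans (Reach-edge e e∈S) (Reach-sym (Reach-∖ e (across s))))) br
    join (inj₂ (inj₂ (r , s))) = contradiction (Reach-trans (Reach-∖ e (across s))
      (Reach-trans (Reach-edge˘ e e∈S) (Reach-∖ e (across r)))) br

  cycleSide-tree : ∀ {H k z v} → lookup H k ≡ true → onCycle Γ H k ≡ false →
    Tree (H ∖ k) z → Reach (H ∖ k) z v → cycleSide H k v ≡ false
  cycleSide-tree {H} {k} {z} {v} k∈ nc tree r = ¬true⇒false λ a → found
      (any-elim (λ e → compEdgeᵇ H (tail k) e ∧ onCycle Γ H e ∧ reach Γ (H ∖ k) (src e) v) (allFin m) a)
    where
    found : ∃ (λ e → compEdgeᵇ H (tail k) e ∧ onCycle Γ H e ∧ reach Γ (H ∖ k) (src e) v ≡ true) → ⊥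
    found (e , h) = true≢false cS (tree e (proj₁ (onCycle-elim {H ∖ k} cS)) (Reach-trans r (Reach-sym (proj₂ hs))))
      where
      hs : OnCycle H e × Reach (H ∖ k) (src e) v
      hs = ∧-true {onCycle Γ H e} (proj₂ (∧-true {compEdgeᵇ H (tail k) e} h))
      cS : OnCycle (H ∖ k) e
      cS = onCycle-survives {H} k∈ nc (proj₁ hs)

  cycleSide-cycle : ∀ {H k z v} → Reach H (tail k) z →
    HasCycle (H ∖ k) z → Reach (H ∖ k) z v → cycleSide H k v ≡ true
  cycleSide-cycle {H} {k} {z} {v} tz (e , c , q) r =
    any-intro (λ e → compEdgeᵇ H (tail k) e ∧ onCycle Γ H e ∧ reach Γ (H ∖ k) (src e) v) (MemP.∈-allFin e)
      (cong₂ _∧_ (compEdge-intro {H} (∖-⊆ H k (proj₁ (onCycle-elim {H ∖ k} c))) (Reach-trans tz (Reach-∖ k q)))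
        (cong₂ _∧_ (onCycle-mono (∖-⊆ H k) c) (Reach-trans (Reach-sym q) r)))

  -- Both sides together have one vertex more than they have edges. Two trees would give an excess
  -- of two, two sides with cycles none, so exactly one side is a tree.
  bridge-sides : ∀ {H k} → Good H → lookup H k ≡ true → onCycle Γ H k ≡ false →
    (Tree (H ∖ k) (tail k) × HasCycle (H ∖ k) (head k)) ⊎ (HasCycle (H ∖ k) (tail k) × Tree (H ∖ k) (head k))
  bridge-sides {H} {k} gd k∈ nc = oriented-elim k
    (λ a b → (Tree S a × HasCycle S b) ⊎ (HasCycle S a × Tree S b)) atEnds (flip atEnds)
    where
    S : EdgeSet m
    S = H ∖ k
    flip : (Tree S (src k) × HasCycle S (dst k)) ⊎ (HasCycle S (src k) × Tree S (dst k)) →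
           (Tree S (dst k) × HasCycle S (src k)) ⊎ (HasCycle S (dst k) × Tree S (src k))
    flip (inj₁ (t , c)) = inj₂ (c , t)
    flip (inj₂ (c , t)) = inj₁ (t , c)
    balance : ∣V∣ S (src k) ℕ.+ ∣V∣ S (dst k) ≡ suc (∣E∣ S (src k) ℕ.+ ∣E∣ S (dst k))
    balance = trans (sym (∣V∣-bridge k k∈ (bridge k∈ nc) Reach-refl))
      (trans (unicyclic gd (src k)) (∣E∣-bridge k k∈ (bridge k∈ nc) Reach-refl))
    atEnds : (Tree S (src k) × HasCycle S (dst k)) ⊎ (HasCycle S (src k) × Tree S (dst k))
    atEnds with tree-or-cycle S (src k) | tree-or-cycle S (dst k)
    ... | inj₁ (t , _) | inj₂ (c , _) = inj₁ (t , c)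
    ... | inj₂ (c , _) | inj₁ (t , _) = inj₂ (c , t)
    ... | inj₁ (_ , p) | inj₁ (_ , q) = contradiction
          (trans (sym (trans (cong₂ ℕ._+_ p q) (cong suc (ℕP.+-suc (∣E∣ S (src k)) (∣E∣ S (dst k)))))) balance) ℕP.1+n≢n
    ... | inj₂ (_ , p) | inj₂ (_ , q) = contradiction
          (subst (_≤ ∣E∣ S (src k) ℕ.+ ∣E∣ S (dst k)) balance (ℕP.+-mono-≤ p q)) ℕP.1+n≰n

  bridge-scale : ∀ {H k} α → Good H → lookup H k ≡ true → onCycle Γ H k ≡ false → α * α ≡ 1ℚ →
    4ℚ * (α * α) * weight H ≡ ℕtoℚ (4 ℕ.^ components (H ∖ k))
  bridge-scale {H} {k} α gd k∈ nc α² = trans (cong (λ q → 4ℚ * q * weight H) α²)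
    (trans (cong (4ℚ * 1ℚ *_) (weight-Good gd))
    (trans (cong (_* ℕtoℚ (4 ℕ.^ components H)) (ℚP.*-identityʳ 4ℚ))
    (trans (sym (ℕtoℚ-4* (4 ℕ.^ components H)))
      (cong (λ c → ℕtoℚ (4 ℕ.^ c)) (sym (trans (components-merge k (bridge k∈ nc))
        (cong (suc ∘ components) (add-remove Γ k∈))))))))

  tailRow : ∀ {H k} → Good H → lookup H k ≡ true → onCycle Γ H k ≡ false →
    Tree (H ∖ k) (tail k) → HasCycle (H ∖ k) (head k) → Row H k (H ∖ k)
  tailRow {H} {k} gd k∈ nc tree cyc = record
    { A = tail k ; α = w k ; g = g ; potential = treePotential-potential tree ; value = value
    ; unit = unit ; scale = bridge-scale (w k) gd k∈ nc (w² k) }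
    where
    S : EdgeSet m
    S = H ∖ k
    g : Fin n → Sign
    g = treePotential S (tail k)
    ¬th : ¬ Reach S (tail k) (head k)
    ¬th = bridge-tail-head k (bridge k∈ nc)
    th : Reach H (tail k) (head k)
    th = Reach-tail-head k (Reach-edge k k∈)
    value : ∀ v → NHdag H k v ≡ supported S (tail k) (w k) g v
    value v = cases (reach Γ S (tail k) v) refl
      where
      outside : ∀ b → reach Γ H (tail k) v ≡ b → reach Γ S (tail k) v ≡ false → NHdag H k v ≡ 0ℚ
      outside false q r = NHdag-outside H k v q
      outside true  q r = trans (NHdag-entry H k v q nc (cycleSide-cycle th cyc head-v) refl) (ℚP.*-zeroʳ (w k))
        where
        head-v : Reach S (head k) v
        head-v = [ (λ p → true≢false p r) , id ]′ (Reach-sides-tail k k∈ q)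
      cases : ∀ b → reach Γ S (tail k) v ≡ b → NHdag H k v ≡ supported S (tail k) (w k) g v
      cases true r = trans (NHdag-entry H k v (Reach-∖ k r) nc (cycleSide-tree k∈ nc tree r)
          (trans (cong (isPlus (σ k) ∧_) (¬true⇒false (λ q → ¬th (Reach-trans r (Reach-sym q))))) (BP.∧-zeroʳ (isPlus (σ k)))))
        (trans (cong (w k *_) (trans (cong (λ b → if b then pathSign Γ S (tail k) v else pathSign Γ S (head k) v) r)
                                     (tree-root-sign tree r)))
          (sym (supported-on {S} {tail k} {w k} {g} r)))
      cases false r = trans (outside (reach Γ H (tail k) v) refl r)
        (sym (supported-off {S} {tail k} {w k} {g} (λ q → true≢false q r)))
    unit : NHdag H k ·ν k ≡ 1ℚ
    unit = trans (·ν-cong value k) (trans (·ν-oriented (supported S (tail k) (w k) g) k)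
      (trans (cong₂ (λ a b → w k * (a - signℚ (σ k) * b))
        (trans (supported-on {S} {tail k} {w k} {g} Reach-refl) (cong (λ s → w k * signℚ s) (treePotential-root S (tail k))))
        (supported-off {S} {tail k} {w k} {g} ¬th))
      (trans (solve 2 (λ w s → w :* (w :* con 1ℚ :- s :* con 0ℚ) := w :* w) refl (w k) (signℚ (σ k))) (w² k))))

  -- Column `k` meets the support only at the head, where its entry is -wσ, so `unit` forces this
  -- `α`.
  headRow : ∀ {H k} → Good H → lookup H k ≡ true → onCycle Γ H k ≡ false →
    HasCycle (H ∖ k) (tail k) → Tree (H ∖ k) (head k) → Row H k (H ∖ k)
  headRow {H} {k} gd k∈ nc cyc tree = record
    { A = head k ; α = α ; g = g ; potential = treePotential-potential tree ; value = value
    ; unit = unit ; scale = bridge-scale α gd k∈ nc α² }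
    where
    S : EdgeSet m
    S = H ∖ k
    g : Fin n → Sign
    g = treePotential S (head k)
    α : ℚ
    α = - (w k * signℚ (σ k))
    α² : α * α ≡ 1ℚ
    α² = trans (solve 2 (λ w s → (:- (w :* s)) :* (:- (w :* s)) := (w :* w) :* (s :* s)) refl (w k) (signℚ (σ k)))
      (cong₂ _*_ (w² k) (signℚ-square (σ k)))
    ¬th : ¬ Reach S (tail k) (head k)
    ¬th = bridge-tail-head k (bridge k∈ nc)
    th : Reach H (tail k) (head k)
    th = Reach-tail-head k (Reach-edge k k∈)
    -- The sign test in the formula, which negates for positive edges only, is multiplication by -σ.
    flipped : ∀ s q → w k * (if isPlus s ∧ true then - q else q) ≡ - (w k * signℚ s) * q
    flipped Sign.+ q = solve 2 (λ w q → w :* (:- q) := (:- (w :* con 1ℚ)) :* q) refl (w k) q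
    flipped Sign.- q = solve 2 (λ w q → w :* q := (:- (w :* con (- 1ℚ))) :* q) refl (w k) q
    value : ∀ v → NHdag H k v ≡ supported S (head k) α g v
    value v = cases (reach Γ S (head k) v) refl
      where
      outside : ∀ b → reach Γ H (tail k) v ≡ b → reach Γ S (head k) v ≡ false → NHdag H k v ≡ 0ℚ
      outside false q r = NHdag-outside H k v q
      outside true  q r = trans (NHdag-entry H k v q nc (cycleSide-cycle Reach-refl cyc tail-v) refl) (ℚP.*-zeroʳ (w k))
        where
        tail-v : Reach S (tail k) v
        tail-v = [ id , (λ p → true≢false p r) ]′ (Reach-sides-tail k k∈ q)
      cases : ∀ b → reach Γ S (head k) v ≡ b → NHdag H k v ≡ supported S (head k) α g v
      cases true r = trans (NHdag-entry H k v (Reach-trans th (Reach-∖ k r)) nc (cycleSide-tree k∈ nc tree r)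
          (cong (isPlus (σ k) ∧_) r))
        (trans (flipped (σ k) (sgnToEdge H k v))
        (trans (cong (α *_) (trans (cong (λ b → if b then pathSign Γ S (tail k) v else pathSign Γ S (head k) v)
                                         (¬true⇒false (λ q → ¬th (Reach-trans q (Reach-sym r)))))
                                     (tree-root-sign tree r)))
          (sym (supported-on {S} {head k} {α} {g} r))))
      cases false r = trans (outside (reach Γ H (tail k) v) refl r)
        (sym (supported-off {S} {head k} {α} {g} (λ q → true≢false q r)))
    unit : NHdag H k ·ν k ≡ 1ℚ
    unit = trans (·ν-cong value k) (trans (·ν-oriented (supported S (head k) α g) k)
      (trans (cong₂ (λ a b → w k * (a - signℚ (σ k) * b))
        (supported-off {S} {head k} {α} {g} (¬th ∘ Reach-sym))
        (trans (supported-on {S} {head k} {α} {g} Reach-refl) (cong (λ s → α * signℚ s) (treePotential-root S (head k)))))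
      (trans (solve 2 (λ w s → w :* (con 0ℚ :- s :* ((:- (w :* s)) :* con 1ℚ)) := (w :* w) :* (s :* s)) refl
          (w k) (signℚ (σ k)))
        (cong₂ _*_ (w² k) (signℚ-square (σ k))))))

  row : ∀ {H k} → Good H → lookup H k ≡ true → Row H k (H ∖ k)
  row {H} {k} gd k∈ = cases (onCycle Γ H k) refl
    where
    cases : ∀ b → onCycle Γ H k ≡ b → Row H k (H ∖ k)
    cases true  c  = cycleRow gd c
    cases false nc = [ (λ (t , c) → tailRow gd k∈ nc t c) , (λ (c , t) → headRow gd k∈ nc c t) ]′
      (bridge-sides gd k∈ nc)

  NHdag-dual : ∀ {H k e} → Good H → lookup H k ≡ true → lookup H e ≡ true → NHdag H k ·ν e ≡ ι (k == e)
  NHdag-dual {H} {k} {e} gd k∈ e∈ = cases (k ≟ e)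
    where
    cases : Dec (k ≡ e) → NHdag H k ·ν e ≡ ι (k == e)
    cases (yes refl) = trans (Row.unit (row gd k∈)) (sym (cong ι (==-refl k)))
    cases (no k≢e)   = trans (Row-killed (row gd k∈) e (trans (lookup-∖-≢ H (k≢e ∘ sym)) e∈))
      (sym (cong ι (==-≢ k≢e)))

  module _ {S : EdgeSet m} {k₀ k : Fin m} (k₀∉ : lookup S k₀ ≡ false) (k∉ : lookup S k ≡ false) (gd : Good (add S k₀)) where
    private
      φ : Fin n → ℚ
      φ = NHdag (add S k₀) k₀
      p : ℚ
      p = φ ·ν k
      r : Row (add S k₀) k₀ S
      r = subst (Row (add S k₀) k₀) (remove-add Γ k₀∉) (row gd (lookup-add S k₀))
      open Row r

      φ-S : ∀ e → lookup S e ≡ true → φ ·ν e ≡ 0ℚ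
      φ-S = Row-killed r

    -- Subtracting `c` times `φ`, with `c` the value of `y` on column `k₀`, leaves a vector
    -- annihilated by the good set `add S k₀`. Hence y = cφ, and column `k` gives c p = 0.
    exchange-nondegenerate : p ≢ 0ℚ → ∀ y → (∀ e → lookup (add S k) e ≡ true → y ·ν e ≡ 0ℚ) → ∀ v → y v ≡ 0ℚ
    exchange-nondegenerate p≢0 y h v = trans (y≡cφ v) (trans (cong (_* φ v) c≡0) (ℚP.*-zeroˡ (φ v)))
      where
      c : ℚ
      c = y ·ν k₀
      z : Fin n → ℚ
      z v = 1ℚ * y v + (- c) * φ v
      z-killed : ∀ e → lookup (add S k₀) e ≡ true → z ·ν e ≡ 0ℚ
      z-killed e e∈ = trans (·ν-linear 1ℚ (- c) y φ e) (cases (e ≟ k₀))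
        where
        cases : Dec (e ≡ k₀) → 1ℚ * (y ·ν e) + (- c) * (φ ·ν e) ≡ 0ℚ
        cases (yes refl) = trans (cong (λ q → 1ℚ * c + (- c) * q) unit)
          (solve 1 (λ c → con 1ℚ :* c :+ (:- c) :* con 1ℚ := con 0ℚ) refl c)
        cases (no e≢) = trans (cong₂ (λ a b → 1ℚ * a + (- c) * b) (h e (lookup-add-⊇ S e∈S)) (φ-S e e∈S))
          (solve 1 (λ c → con 1ℚ :* con 0ℚ :+ (:- c) :* con 0ℚ := con 0ℚ) refl c)
          where
          e∈S : lookup S e ≡ true
          e∈S = trans (sym (lookup-add-≢ S e≢)) e∈
      y≡cφ : ∀ v → y v ≡ c * φ v
      y≡cφ v = trans (solve 3 (λ y c f → y := (con 1ℚ :* y :+ (:- c) :* f) :+ c :* f) refl (y v) c (φ v))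
        (trans (cong (_+ c * φ v) (Good⇒nondegenerate gd z z-killed v)) (ℚP.+-identityˡ (c * φ v)))
      c≡0 : c ≡ 0ℚ
      c≡0 = *-cancelˡ p≢0 (trans (ℚP.*-comm p c) (trans
        (trans (∑-*ˡ (allFin n) c (λ v → φ v * ν v k)) (∑-cong (allFin n) (λ v →
          trans (sym (ℚP.*-assoc c (φ v) (ν v k))) (cong (_* ν v k) (sym (y≡cφ v))))))
        (trans (h k (lookup-add S k)) (sym (ℚP.*-zeroʳ p)))))

    -- Exchanging one edge keeps the size, so by `full⇒Good` it is enough that no potential exists;
    -- linear algebra replaces any inspection of the cycles of `add S k`.
    exchange-Good : p ≢ 0ℚ → Good (add S k)
    exchange-Good p≢0 = full⇒Good
      (trans (size-add {k} k∉) (trans (sym (size-add {k₀} k₀∉)) (size gd)))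
      (nondegenerate⇒full (exchange-nondegenerate p≢0))
      where
      size-add : ∀ {k} → lookup S k ≡ false → count m (lookup (add S k)) ≡ suc (count m (lookup S))
      size-add {k} k∉ = trans (size-∖ {add S k} k (lookup-add S k)) (cong (λ T → suc (count m (lookup T))) (remove-add Γ {S} {k} k∉))

    private
      y : Fin n → ℚ
      y = supported S A α g

      p² : p * p ≡ (y (src k) - signℚ (σ k) * y (dst k)) * (y (src k) - signℚ (σ k) * y (dst k))
      p² = trans (cong (λ q → q * q) (trans (·ν-cong value k) (·ν-formula y k)))
        (trans (solve 2 (λ t q → (t :* q) :* (t :* q) := (t :* t) :* (q :* q)) refl (ν (src k) k)
            (y (src k) - signℚ (σ k) * y (dst k)))
          (trans (cong (_* ((y (src k) - signℚ (σ k) * y (dst k)) * (y (src k) - signℚ (σ k) * y (dst k)))) (ν-src² k))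
            (ℚP.*-identityˡ _)))

      p-zero : y (src k) - signℚ (σ k) * y (dst k) ≡ 0ℚ → p ≡ 0ℚ
      p-zero h = trans (·ν-cong value k) (trans (·ν-formula y k) (trans (cong (ν (src k) k *_) h) (ℚP.*-zeroʳ (ν (src k) k))))

      w₀ w₁ : ℚ
      w₀ = weight (add S k₀)
      w₁ = weight (add S k)

      joined : ¬ Reach S (src k) (dst k) → Good (add S k) → p * p ≡ α * α → w₁ ≡ p * p * w₀
      joined ¬r g' q = *-cancelˡ {4ℚ} (λ ()) (trans (cong (4ℚ *_) (weight-Good g'))
        (trans (sym (ℕtoℚ-4* (4 ℕ.^ components (add S k))))
        (trans (cong (λ c → ℕtoℚ (4 ℕ.^ c)) (sym (components-merge k ¬r)))
        (trans (sym scale) (trans (ℚP.*-assoc 4ℚ (α * α) w₀) (cong (λ x → 4ℚ * (x * w₀)) (sym q)))))))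

      on : ∀ {v} → Reach S A v → y v ≡ α * signℚ (g v)
      on = supported-on {S} {A} {α} {g}
      off : ∀ {v} → ¬ Reach S A v → y v ≡ 0ℚ
      off = supported-off {S} {A} {α} {g}

    -- The cases are the ways in which `k` meets the support of `φ`. With both ends inside, the
    -- number of components stays and p² = 4α²; with one end inside, two components merge and p² =
    -- α²; with none, p would be zero. Both nonzero cases match `scale`.
    exchange-weight : p ≢ 0ℚ → w₁ ≡ p * p * w₀
    exchange-weight p≢0 = cases (reach Γ S A (src k)) (reach Γ S A (dst k)) refl refl
      where
      good' : Good (add S k)
      good' = exchange-Good p≢0
      cases : ∀ b c → reach Γ S A (src k) ≡ b → reach Γ S A (dst k) ≡ c → w₁ ≡ p * p * w₀
      cases true true rs rd = trans (weight-Good good')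
        (trans (cong (λ c → ℕtoℚ (4 ℕ.^ c)) (components-same k (Reach-trans (Reach-sym rs) rd)))
        (trans (sym scale) (trans (solve 3 (λ f a w → f :* (a :* a) :* w := (a :* a :* f) :* w) refl 4ℚ α w₀)
          (cong (_* w₀) (sym p²-value)))))
        where
        s t : Sign
        s = g (src k)
        t = σ k Sign.* g (dst k)
        diff : y (src k) - signℚ (σ k) * y (dst k) ≡ α * (signℚ s - signℚ t)
        diff = trans (cong₂ (λ a b → a - signℚ (σ k) * b) (on rs) (on rd))
          (trans (solve 4 (λ a x y z → a :* x :- y :* (a :* z) := a :* (x :- y :* z)) refl α (signℚ s) (signℚ (σ k)) (signℚ (g (dst k))))
            (cong (λ q → α * (signℚ s - q)) (sym (signℚ-* (σ k) (g (dst k))))))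
        p²-value : p * p ≡ α * α * 4ℚ
        p²-value = trans p² (trans (cong (λ q → q * q) diff)
          (trans (solve 2 (λ a d → (a :* d) :* (a :* d) := a :* a :* (d :* d)) refl α (signℚ s - signℚ t))
            (cong (α * α *_) (signℚ-∓ s t (λ z → p≢0 (p-zero (trans diff (trans (cong (α *_) z) (ℚP.*-zeroʳ α)))))))))
      cases true false rs rd = joined (λ q → true≢false (Reach-trans rs q) rd) good'
        (trans p² (trans (cong₂ (λ a b → (a - signℚ (σ k) * b) * (a - signℚ (σ k) * b)) (on rs) (off (λ q → true≢false q rd)))
          (trans (solve 3 (λ a x s → (a :* x :- s :* con 0ℚ) :* (a :* x :- s :* con 0ℚ) := a :* a :* (x :* x)) refl
              α (signℚ (g (src k))) (signℚ (σ k)))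
            (trans (cong (α * α *_) (signℚ-square (g (src k)))) (ℚP.*-identityʳ (α * α))))))
      cases false true rs rd = joined (λ q → true≢false (Reach-trans rd (Reach-sym q)) rs) good'
        (trans p² (trans (cong₂ (λ a b → (a - signℚ (σ k) * b) * (a - signℚ (σ k) * b)) (off (λ q → true≢false q rs)) (on rd))
          (trans (solve 3 (λ a x s → (con 0ℚ :- s :* (a :* x)) :* (con 0ℚ :- s :* (a :* x)) := a :* a :* ((x :* x) :* (s :* s))) refl
              α (signℚ (g (dst k))) (signℚ (σ k)))
            (trans (cong (α * α *_) (cong₂ _*_ (signℚ-square (g (dst k))) (signℚ-square (σ k)))) (ℚP.*-identityʳ (α * α))))))
      cases false false rs rd = contradiction (p-zero
        (trans (cong₂ (λ a b → a - signℚ (σ k) * b) (off (λ q → true≢false q rs)) (off (λ q → true≢false q rd)))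
          (solve 1 (λ s → con 0ℚ :- s :* con 0ℚ := con 0ℚ) refl (signℚ (σ k))))) p≢0

-- Spanning trees of a balanced graph

idMat-sym : ∀ {n} (i j : Fin n) → idMat i j ≡ idMat j i
idMat-sym i j = cong (if_then 1ℚ else 0ℚ) (==-sym i j)

∑-one : ∀ {A : Set} (xs : List A) → ∑ xs (λ _ → 1ℚ) ≡ ℕtoℚ (length xs)
∑-one []       = refl
∑-one (x ∷ xs) = trans (cong (1ℚ +_) (∑-one xs)) (sym (ℕtoℚ-suc (length xs)))

∑-const : ∀ n (c : ℚ) → ∑ (allFin n) (λ _ → c) ≡ ℕtoℚ n * c
∑-const n c = trans (∑-cong (allFin n) (λ _ → sym (ℚP.*-identityˡ c)))
  (trans (sym (∑-*ʳ (allFin n) c (λ _ → 1ℚ)))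
    (cong (_* c) (trans (∑-one (allFin n)) (cong ℕtoℚ (LP.length-tabulate {n = n} id)))))

module BalancedRows {n m} (Γ : SignedGraph n m) (N : Fin n → Fin m → ℤ) (inc : IsIncidence Γ N)
  (n≢0 : ℕtoℚ n ≢ 0ℚ) where
  open SignedGraph Γ
  open UnbalancedRows Γ N inc public
  open Formulas Γ N using (sgnToEdge; Ψ; treesWith; formulaA)

  record SpanningTree (T : EdgeSet m) : Set where
    field
      connected : ∀ x y → Reach T x y
      acyclic   : ∀ e → onCycle Γ T e ≡ false
  open SpanningTree

  spanningTree-elim : ∀ {T} → isSpanningTree Γ T ≡ true → SpanningTree T
  spanningTree-elim {T} h = record
    { connected = λ x y → all-elim (reach Γ T x) (all-elim (λ x → all (reach Γ T x) (allFin n)) (proj₁ hs) (MemP.∈-allFin x)) (MemP.∈-allFin y)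
    ; acyclic   = λ e → any-false (onCycle Γ T) (not-true (proj₂ hs)) (MemP.∈-allFin e) }
    where
    hs : all (λ x → all (reach Γ T x) (allFin n)) (allFin n) ≡ true × not (any (onCycle Γ T) (allFin m)) ≡ true
    hs = ∧-true {all (λ x → all (reach Γ T x) (allFin n)) (allFin n)} h

  spanningTree-intro : ∀ {T} → SpanningTree T → isSpanningTree Γ T ≡ true
  spanningTree-intro {T} t = cong₂ _∧_
    (all-intro (λ x → all (reach Γ T x) (allFin n)) (allFin n) (λ x → all-intro (reach Γ T x) (allFin n) (connected t x)))
    (cong not (¬true⇒false (λ h → no-cycle (any-elim (onCycle Γ T) (allFin m) h))))
    where
    no-cycle : ∃ (λ e → OnCycle T e) → ⊥
    no-cycle (e , c) = true≢false c (acyclic t e)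

  connected-size : ∀ {T} → (∀ x y → Reach T x y) → ∀ x → ∣V∣ T x ≡ n
  connected-size {T} conn x = ℕtoℚ-injective (trans (ℕtoℚ-count n (reach Γ T x))
    (trans (∑-cong (allFin n) (λ v → cong ι (conn x v))) (trans (∑-const n 1ℚ) (ℚP.*-identityʳ (ℕtoℚ n)))))

  headSize tailSize : EdgeSet m → Fin m → ℚ
  headSize T k = ℕtoℚ (∣V∣ (T ∖ k) (head k))
  tailSize T k = ℕtoℚ (∣V∣ (T ∖ k) (tail k))

  -- One of the two factors into which the four cases of `Ψ` separate; it is `n` times a row of the
  -- pseudoinverse of the columns in `T`. The factor `w k` squares to 1 in `Ψ` and orients the row
  -- so that its product with column `k` is `n`.
  treeRow : EdgeSet m → Fin m → Fin n → ℚ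
  treeRow T k i = sgnToEdge T k i *
    (w k * (if reach Γ (T ∖ k) (tail k) i then headSize T k else - signℚ (σ k) * tailSize T k))

  Ψ-factors : ∀ k i j Tr Ts →
    sgnToEdge Tr k i * sgnToEdge Ts k j * Ψ k i j Tr Ts ≡ treeRow Tr k i * treeRow Ts k j
  Ψ-factors k i j Tr Ts = trans
    (cong (a * b *_) (cases (reach Γ (Tr ∖ k) (tail k) i) (reach Γ (Ts ∖ k) (tail k) j)))
    (solve 4 (λ a b x y → a :* b :* (x :* y) := (a :* x) :* (b :* y)) refl a b _ _)
    where
    a b s hr tr hs ts : ℚ
    a = sgnToEdge Tr k i
    b = sgnToEdge Ts k j
    s = signℚ (σ k)
    hr = headSize Tr k
    tr = tailSize Tr k
    hs = headSize Ts k
    ts = tailSize Ts k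
    with-w² : ∀ {x} y → x ≡ y → x ≡ (w k * w k) * y
    with-w² y h = trans h (trans (sym (ℚP.*-identityˡ y)) (cong (_* y) (sym (w² k))))
    cases : ∀ p q → (if p then (if q then hr * hs else - s * hr * ts) else (if q then - s * tr * hs else tr * ts)) ≡
      (w k * (if p then hr else - s * tr)) * (w k * (if q then hs else - s * ts))
    cases true  true  = trans (with-w² (hr * hs) refl)
      (solve 3 (λ w x y → (w :* w) :* (x :* y) := (w :* x) :* (w :* y)) refl (w k) hr hs)
    cases true  false = trans (with-w² (- s * hr * ts) refl)
      (solve 4 (λ w s x y → (w :* w) :* ((:- s) :* x :* y) := (w :* x) :* (w :* ((:- s) :* y))) refl (w k) s hr ts)
    cases false true  = trans (with-w² (- s * tr * hs) refl)
      (solve 4 (λ w s x y → (w :* w) :* ((:- s) :* x :* y) := (w :* ((:- s) :* x)) :* (w :* y)) refl (w k) s tr hs)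
    cases false false = trans (with-w² ((s * s) * (tr * ts)) (sym (trans (cong (_* (tr * ts)) (signℚ-square (σ k))) (ℚP.*-identityˡ (tr * ts)))))
      (solve 4 (λ w s x y → (w :* w) :* ((s :* s) :* (x :* y)) := (w :* ((:- s) :* x)) :* (w :* ((:- s) :* y))) refl (w k) s tr ts)

  module _ (θ : Fin n → Sign) (θ-potential : ∀ e → θ (src e) Sign.* σ e ≡ θ (dst e)) where

    θℚ : Fin n → ℚ
    θℚ v = signℚ (θ v)

    θ-src : ∀ e → θℚ (src e) ≡ signℚ (σ e) * θℚ (dst e)
    θ-src e = trans (cong signℚ (trans (sym (s*s*t (θ (src e)) (σ e)))
      (trans (cong (Sign._* σ e) (θ-potential e)) (SP.*-comm (θ (dst e)) (σ e))))) (signℚ-* (σ e) (θ (dst e)))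

    θ-tail : ∀ e → θℚ (tail e) ≡ signℚ (σ e) * θℚ (head e)
    θ-tail e = oriented-elim e (λ a b → θℚ a ≡ signℚ (σ e) * θℚ b) (θ-src e)
      (trans (sym (trans (cong (_* θℚ (dst e)) (signℚ-square (σ e))) (ℚP.*-identityˡ (θℚ (dst e)))))
        (trans (ℚP.*-assoc (signℚ (σ e)) (signℚ (σ e)) (θℚ (dst e))) (cong (signℚ (σ e) *_) (sym (θ-src e)))))

    pathSign-θ : ∀ {S x y} → Reach S x y → pathSign Γ S x y ≡ θℚ x * θℚ y
    pathSign-θ {S} {x} {y} r = trans (pathSign-potential r θ (λ e _ _ → θ-potential e)) (signℚ-* (θ x) (θ y))

    -- The row after switching by `θ`, up to a unit. Its two values differ by `n`, which normalises
    -- the product with column `k`, and they sum to zero over all vertices, which is orthogonality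
    -- to `θ`.
    sideWeight : EdgeSet m → Fin m → Fin n → ℚ
    sideWeight T k i = if reach Γ (T ∖ k) (tail k) i then headSize T k else - tailSize T k

    module _ {T : EdgeSet m} {k : Fin m} (t : SpanningTree T) (k∈ : lookup T k ≡ true) where
      private
        S : EdgeSet m
        S = T ∖ k
        br : ¬ Reach S (src k) (dst k)
        br = bridge k∈ (acyclic t k)
        u : ℚ
        u = w k * θℚ (tail k)

      side : ∀ i → Reach S (tail k) i ⊎ Reach S (head k) i
      side i = Reach-sides-tail k k∈ (connected t (tail k) i)

      head-side : ∀ {i} → reach Γ S (tail k) i ≡ false → Reach S (head k) i
      head-side {i} r = [ (λ p → true≢false p r) , id ]′ (side i)

      u² : u * u ≡ 1ℚ
      u² = trans (solve 2 (λ w t → (w :* t) :* (w :* t) := (w :* w) :* (t :* t)) refl (w k) (θℚ (tail k)))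
        (cong₂ _*_ (w² k) (signℚ-square (θ (tail k))))

      sizes : headSize T k + tailSize T k ≡ ℕtoℚ n
      sizes = oriented-elim k (λ a b → ℕtoℚ (∣V∣ S b) + ℕtoℚ (∣V∣ S a) ≡ ℕtoℚ n)
        (trans (ℚP.+-comm (ℕtoℚ (∣V∣ S (dst k))) (ℕtoℚ (∣V∣ S (src k)))) total) total
        where
        total : ℕtoℚ (∣V∣ S (src k)) + ℕtoℚ (∣V∣ S (dst k)) ≡ ℕtoℚ n
        total = trans (sym (ℕtoℚ-+ (∣V∣ S (src k)) (∣V∣ S (dst k))))
          (cong ℕtoℚ (trans (sym (∣V∣-bridge k k∈ br Reach-refl)) (connected-size (connected t) (src k))))

      -- Path signs are products of two values of `θ`. On the head side the factor -σ turns the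
      -- value at the head into minus the value at the tail, so the same unit `u` serves both sides.
      treeRow-θ : ∀ i → treeRow T k i ≡ u * (θℚ i * sideWeight T k i)
      treeRow-θ i = cases (reach Γ S (tail k) i) refl
        where
        value : Bool → ℚ
        value b = (if b then pathSign Γ S (tail k) i else pathSign Γ S (head k) i) *
          (w k * (if b then headSize T k else - signℚ (σ k) * tailSize T k))
        target : Bool → ℚ
        target b = u * (θℚ i * (if b then headSize T k else - tailSize T k))
        cases : ∀ b → reach Γ S (tail k) i ≡ b → treeRow T k i ≡ u * (θℚ i * sideWeight T k i)
        cases true r = trans (cong value r) (trans
          (trans (cong (_* (w k * headSize T k)) (pathSign-θ r))
            (solve 4 (λ a b w h → (a :* b) :* (w :* h) := (w :* a) :* (b :* h)) refl (θℚ (tail k)) (θℚ i) (w k) (headSize T k)))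
          (cong target (sym r)))
        cases false r = trans (cong value r) (trans
          (trans (cong (_* (w k * (- signℚ (σ k) * tailSize T k))) (pathSign-θ (head-side r)))
            (trans (solve 5 (λ a b w s t → (a :* b) :* (w :* ((:- s) :* t)) := (w :* (s :* a)) :* (b :* (:- t))) refl
                (θℚ (head k)) (θℚ i) (w k) (signℚ (σ k)) (tailSize T k))
              (cong (λ q → (w k * q) * (θℚ i * - tailSize T k)) (sym (θ-tail k)))))
          (cong target (sym r)))

      treeRow-·ν : ∀ e → treeRow T k ·ν e ≡
        (u * θℚ (src e)) * ν (src e) e * (sideWeight T k (src e) - sideWeight T k (dst e))
      treeRow-·ν e = trans (·ν-formula (treeRow T k) e) (trans
        (cong₂ (λ a b → ν (src e) e * (a - signℚ (σ e) * b)) (treeRow-θ (src e)) (treeRow-θ (dst e)))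
        (trans (cong (λ q → ν (src e) e * (u * (q * cs) - signℚ (σ e) * (u * (θℚ (dst e) * cd)))) (θ-src e))
        (trans (solve 6 (λ v u s d x y → v :* (u :* ((s :* d) :* x) :- s :* (u :* (d :* y))) := (u :* (s :* d)) :* v :* (x :- y)) refl
            (ν (src e) e) u (signℚ (σ e)) (θℚ (dst e)) cs cd)
          (cong (λ q → u * q * ν (src e) e * (cs - cd)) (sym (θ-src e))))))
        where
        cs cd : ℚ
        cs = sideWeight T k (src e)
        cd = sideWeight T k (dst e)

      side-same : ∀ {x y} → reach Γ S (tail k) x ≡ reach Γ S (tail k) y → sideWeight T k x - sideWeight T k y ≡ 0ℚ
      side-same {x} {y} h = trans (cong (λ b → (if b then headSize T k else - tailSize T k) - sideWeight T k y) h)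
        (ℚP.+-inverseʳ (sideWeight T k y))

      treeRow-killed : ∀ e → reach Γ S (tail k) (src e) ≡ reach Γ S (tail k) (dst e) → treeRow T k ·ν e ≡ 0ℚ
      treeRow-killed e h = trans (treeRow-·ν e) (trans
        (cong ((u * θℚ (src e)) * ν (src e) e *_) (side-same h)) (ℚP.*-zeroʳ ((u * θℚ (src e)) * ν (src e) e)))

      treeRow-unit : treeRow T k ·ν k ≡ ℕtoℚ n
      treeRow-unit = trans (·ν-oriented (treeRow T k) k) (trans
        (cong₂ (λ a b → w k * (a - signℚ (σ k) * b))
          (trans (treeRow-θ (tail k)) (cong (λ b → u * (θℚ (tail k) * (if b then headSize T k else - tailSize T k))) Reach-refl))
          (trans (treeRow-θ (head k)) (cong (λ b → u * (θℚ (head k) * (if b then headSize T k else - tailSize T k)))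
            (¬true⇒false (bridge-tail-head k br)))))
        (trans fin sizes))
        where
        fin : w k * (u * (θℚ (tail k) * headSize T k) - signℚ (σ k) * (u * (θℚ (head k) * - tailSize T k))) ≡
              headSize T k + tailSize T k
        fin = trans (solve 7 (λ w u t s d h z → w :* (u :* (t :* h) :- s :* (u :* (d :* (:- z)))) :=
                 w :* u :* (t :* h :+ (s :* d) :* z)) refl (w k) u (θℚ (tail k)) (signℚ (σ k)) (θℚ (head k)) (headSize T k) (tailSize T k))
          (trans (cong (λ q → w k * u * (θℚ (tail k) * headSize T k + q * tailSize T k)) (sym (θ-tail k)))
          (trans (solve 5 (λ w u t h z → w :* u :* (t :* h :+ t :* z) := (w :* t) :* u :* (h :+ z)) refl
             (w k) u (θℚ (tail k)) (headSize T k) (tailSize T k))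
          (trans (cong (_* (headSize T k + tailSize T k)) u²) (ℚP.*-identityˡ (headSize T k + tailSize T k)))))

      -- There are `tailSize` vertices of weight `headSize` on one side and `headSize` vertices of
      -- weight minus `tailSize` on the other.
      treeRow-⊥θ : ∑ (allFin n) (λ i → treeRow T k i * θℚ i) ≡ 0ℚ
      treeRow-⊥θ = trans (∑-cong (allFin n) term)
        (trans (sym (∑-*ˡ (allFin n) u (λ i → ι (reach Γ S (tail k) i) * headSize T k - ι (reach Γ S (head k) i) * tailSize T k)))
        (trans (cong (u *_) (trans
            (∑-minus (allFin n) (λ i → ι (reach Γ S (tail k) i) * headSize T k) (λ i → ι (reach Γ S (head k) i) * tailSize T k))
            (trans (cong₂ _-_ (side-sum (tail k) (headSize T k)) (side-sum (head k) (tailSize T k)))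
              (solve 2 (λ x y → x :* y :- y :* x := con 0ℚ) refl (tailSize T k) (headSize T k)))))
          (ℚP.*-zeroʳ u)))
        where
        side-sum : ∀ z c → ∑ (allFin n) (λ i → ι (reach Γ S z i) * c) ≡ ℕtoℚ (∣V∣ S z) * c
        side-sum z c = trans (sym (∑-*ʳ (allFin n) c (λ i → ι (reach Γ S z i)))) (cong (_* c) (sym (ℕtoℚ-count n (reach Γ S z))))
        sideWeight-ι : ∀ i → sideWeight T k i ≡ ι (reach Γ S (tail k) i) * headSize T k - ι (reach Γ S (head k) i) * tailSize T k
        sideWeight-ι i = cases (reach Γ S (tail k) i) refl
          where
          weightOf : Bool → ℚ
          weightOf b = if b then headSize T k else - tailSize T k
          cases : ∀ b → reach Γ S (tail k) i ≡ b →
            weightOf (reach Γ S (tail k) i) ≡ ι (reach Γ S (tail k) i) * headSize T k - ι (reach Γ S (head k) i) * tailSize T k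
          cases true r = trans (cong weightOf r) (trans
            (solve 2 (λ h z → h := con 1ℚ :* h :- con 0ℚ :* z) refl (headSize T k) (tailSize T k))
            (sym (cong₂ (λ a b → ι a * headSize T k - ι b * tailSize T k) r
              (¬true⇒false (λ q → bridge-tail-head k br (Reach-trans r (Reach-sym q)))))))
          cases false r = trans (cong weightOf r) (trans
            (solve 2 (λ h z → :- z := con 0ℚ :* h :- con 1ℚ :* z) refl (headSize T k) (tailSize T k))
            (sym (cong₂ (λ a b → ι a * headSize T k - ι b * tailSize T k) r (head-side r))))
        term : ∀ i → treeRow T k i * θℚ i ≡ u * (ι (reach Γ S (tail k) i) * headSize T k - ι (reach Γ S (head k) i) * tailSize T k)
        term i = trans (cong (_* θℚ i) (treeRow-θ i))
          (trans (solve 3 (λ u t c → u :* (t :* c) :* t := u :* ((t :* t) :* c)) refl u (θℚ i) (sideWeight T k i))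
          (trans (cong (λ q → u * (q * sideWeight T k i)) (signℚ-square (θ i)))
            (cong (u *_) (trans (ℚP.*-identityˡ (sideWeight T k i)) (sideWeight-ι i)))))

      private
        R₀ : Fin n → ℚ
        R₀ i = inv (ℕtoℚ n) * treeRow T k i

        R₀-·ν : ∀ e → R₀ ·ν e ≡ inv (ℕtoℚ n) * (treeRow T k ·ν e)
        R₀-·ν e = trans (∑-cong (allFin n) (λ v → ℚP.*-assoc (inv (ℕtoℚ n)) (treeRow T k v) (ν v e)))
          (sym (∑-*ˡ (allFin n) (inv (ℕtoℚ n)) (λ v → treeRow T k v * ν v e)))

      normalizedRow-unit : R₀ ·ν k ≡ 1ℚ
      normalizedRow-unit = trans (R₀-·ν k) (trans (cong (inv (ℕtoℚ n) *_) treeRow-unit)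
        (trans (ℚP.*-comm (inv (ℕtoℚ n)) (ℕtoℚ n)) (inv-* n≢0)))

      normalizedRow-S : ∀ e → reach Γ S (tail k) (src e) ≡ reach Γ S (tail k) (dst e) → R₀ ·ν e ≡ 0ℚ
      normalizedRow-S e h = trans (R₀-·ν e) (trans (cong (inv (ℕtoℚ n) *_) (treeRow-killed e h)) (ℚP.*-zeroʳ (inv (ℕtoℚ n))))

      -- Between the two sides `sideWeight` jumps by ±n, which the division by `n` turns into ±1.
      -- This is why the exchange rule holds for trees with all weights equal to 1.
      normalizedRow-across : ∀ e → reach Γ S (tail k) (src e) ≢ reach Γ S (tail k) (dst e) → (R₀ ·ν e) * (R₀ ·ν e) ≡ 1ℚ
      normalizedRow-across e h = trans (cong (λ q → q * q) (trans (R₀-·ν e) (cong (inv (ℕtoℚ n) *_) (treeRow-·ν e))))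
        (trans (solve 5 (λ i u t v d → (i :* (u :* t :* v :* d)) :* (i :* (u :* t :* v :* d)) :=
                   (u :* u) :* (t :* t) :* (v :* v) :* ((i :* i) :* (d :* d))) refl
                 (inv (ℕtoℚ n)) u (θℚ (src e)) (ν (src e) e) D)
        (trans (cong₂ _*_ (cong₂ _*_ (cong₂ _*_ u² (signℚ-square (θ (src e)))) (ν-src² e)) (cong (inv (ℕtoℚ n) * inv (ℕtoℚ n) *_) D²))
        (trans (solve 2 (λ i n → con 1ℚ :* con 1ℚ :* con 1ℚ :* ((i :* i) :* (n :* n)) := (n :* i) :* (n :* i)) refl (inv (ℕtoℚ n)) (ℕtoℚ n))
          (cong₂ _*_ (inv-* n≢0) (inv-* n≢0)))))
        where
        D : ℚ
        D = sideWeight T k (src e) - sideWeight T k (dst e)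
        diff : ∀ a b → a ≢ b → ((if a then headSize T k else - tailSize T k) - (if b then headSize T k else - tailSize T k)) *
          ((if a then headSize T k else - tailSize T k) - (if b then headSize T k else - tailSize T k)) ≡
          (headSize T k + tailSize T k) * (headSize T k + tailSize T k)
        diff true  true  h = contradiction refl h
        diff true  false h = solve 2 (λ x y → (x :- :- y) :* (x :- :- y) := (x :+ y) :* (x :+ y)) refl (headSize T k) (tailSize T k)
        diff false true  h = solve 2 (λ x y → (:- y :- x) :* (:- y :- x) := (x :+ y) :* (x :+ y)) refl (headSize T k) (tailSize T k)
        diff false false h = contradiction refl h
        D² : D * D ≡ ℕtoℚ n * ℕtoℚ n
        D² = trans (diff (reach Γ S (tail k) (src e)) (reach Γ S (tail k) (dst e)) h) (cong (λ q → q * q) sizes)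

    row₀ : EdgeSet m → Rect m n
    row₀ T k i = inv (ℕtoℚ n) * treeRow T k i

    row₀-dual : ∀ {T k e} → SpanningTree T → lookup T k ≡ true → lookup T e ≡ true → row₀ T k ·ν e ≡ ι (k == e)
    row₀-dual {T} {k} {e} t k∈ e∈ = cases (k ≟ e)
      where
      cases : Dec (k ≡ e) → row₀ T k ·ν e ≡ ι (k == e)
      cases (yes refl) = trans (normalizedRow-unit t k∈) (sym (cong ι (==-refl k)))
      cases (no k≢e)   = trans (normalizedRow-S t k∈ e (bool-≡ (λ r → Reach-trans r (Reach-edge e e∈S))
                                                                 (λ r → Reach-trans r (Reach-edge˘ e e∈S))))
                           (sym (cong ι (==-≢ k≢e)))
        where
        e∈S : lookup (T ∖ k) e ≡ true
        e∈S = trans (lookup-∖-≢ T (k≢e ∘ sym)) e∈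

    module _ {S : EdgeSet m} {k₀ k : Fin m} (k₀∉ : lookup S k₀ ≡ false) (t : SpanningTree (add S k₀)) where
      private
        S₀ : EdgeSet m
        S₀ = add S k₀ ∖ k₀
        S₀⊆ : ∀ {e} → lookup S₀ e ≡ true → lookup S e ≡ true
        S₀⊆ = add-∖-⊆ S k₀
        ⊆S₀ : ∀ {e} → lookup S e ≡ true → lookup S₀ e ≡ true
        ⊆S₀ {e} h = subst (λ U → lookup U e ≡ true) (sym (remove-add Γ {S} {k₀} k₀∉)) h
        k₀∈ : lookup (add S k₀) k₀ ≡ true
        k₀∈ = lookup-add S k₀

      module _ (across : reach Γ S₀ (tail k₀) (src k) ≢ reach Γ S₀ (tail k₀) (dst k)) where
        private
          apart : ¬ Reach S (src k) (dst k)
          apart r = across (bool-≡ (λ p → Reach-trans p (Reach-mono ⊆S₀ r)) (λ p → Reach-trans p (Reach-sym (Reach-mono ⊆S₀ r))))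

          S' : EdgeSet m
          S' = add S k
          up : ∀ {x y} → Reach S₀ x y → Reach S' x y
          up r = Reach-add k (Reach-mono S₀⊆ r)

          tail-to-head : ∀ b c → reach Γ S₀ (tail k₀) (src k) ≡ b → reach Γ S₀ (tail k₀) (dst k) ≡ c → Reach S' (tail k₀) (head k₀)
          tail-to-head true  true  p q = contradiction (trans p (sym q)) across
          tail-to-head false false p q = contradiction (trans p (sym q)) across
          tail-to-head true  false p q = Reach-trans (up p) (Reach-trans (Reach-edge k (lookup-add S k)) (Reach-sym (up (head-side t k₀∈ q))))
          tail-to-head false true  p q = Reach-trans (up q) (Reach-trans (Reach-edge˘ k (lookup-add S k)) (Reach-sym (up (head-side t k₀∈ p))))

          from-tail : ∀ x → Reach S' (tail k₀) x
          from-tail x = [ up , (λ p → Reach-trans (tail-to-head _ _ refl refl) (up p)) ]′ (side t k₀∈ x)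

          -- A cycle of `add S k` either avoids `k` and lies in the tree `add S k₀`, or uses `k` and
          -- thereby connects the ends of `k` inside `S`.
          acyclic' : ∀ e → ¬ OnCycle S' e
          acyclic' e c = cases (e ≟ k)
            where
            cases : Dec (e ≡ k) → ⊥
            cases (yes refl) = apart (Reach-mono (add-∖-⊆ S k) (proj₂ (onCycle-elim {S'} c)))
            cases (no e≢k)   = join (Reach-split k (proj₂ (onCycle-elim {S'} c)))
              where
              e∈S : lookup S e ≡ true
              e∈S = trans (sym (lookup-add-≢ S e≢k)) (proj₁ (onCycle-elim {S'} c))
              inside : ∀ {f} → lookup (S' ∖ e ∖ k) f ≡ true → lookup (S ∖ e) f ≡ true
              inside h = ∖-mono (S' ∖ k) S e (add-∖-⊆ S k) (∖-comm-⊆ S' e k h)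
              down : ∀ {x y} → Reach (S' ∖ e ∖ k) x y → Reach (S ∖ e) x y
              down = Reach-mono inside
              join : Reach (S' ∖ e ∖ k) (src e) (dst e) ⊎
                (Reach (S' ∖ e ∖ k) (src e) (src k) × Reach (S' ∖ e ∖ k) (dst k) (dst e)) ⊎
                (Reach (S' ∖ e ∖ k) (src e) (dst k) × Reach (S' ∖ e ∖ k) (src k) (dst e)) → ⊥
              join (inj₁ r) = true≢false (onCycle-mono (lookup-add-⊇ S) (onCycle-intro {S} e∈S (down r))) (acyclic t e)
              join (inj₂ (inj₁ (r , s))) = apart (Reach-trans (Reach-sym (Reach-∖ e (down r)))
                (Reach-trans (Reach-edge e e∈S) (Reach-sym (Reach-∖ e (down s)))))
              join (inj₂ (inj₂ (r , s))) = apart (Reach-trans (Reach-∖ e (down s))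
                (Reach-trans (Reach-edge˘ e e∈S) (Reach-∖ e (down r))))

        exchange-tree : SpanningTree (add S k)
        exchange-tree = record
          { connected = λ x y → Reach-trans (Reach-sym (from-tail x)) (from-tail y)
          ; acyclic   = λ e → ¬true⇒false (acyclic' e) }

      tree-exchange : row₀ (add S k₀) k₀ ·ν k ≢ 0ℚ → isSpanningTree Γ (add S k) ≡ true ×
        1ℚ ≡ (row₀ (add S k₀) k₀ ·ν k) * (row₀ (add S k₀) k₀ ·ν k) * 1ℚ
      tree-exchange p≢0 = spanningTree-intro (exchange-tree across) ,
        sym (trans (ℚP.*-identityʳ ((row₀ (add S k₀) k₀ ·ν k) * (row₀ (add S k₀) k₀ ·ν k))) (normalizedRow-across t k₀∈ k across))
        where
        across : reach Γ S₀ (tail k₀) (src k) ≢ reach Γ S₀ (tail k₀) (dst k)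
        across h = p≢0 (normalizedRow-S t k₀∈ k h)

    -- The orthogonal projection onto the complement of θ, which spans the kernel of νᵗ.
    P : Mat n
    P i j = idMat i j - inv (ℕtoℚ n) * (θℚ i * θℚ j)

    ∙P : ∀ (y : Fin n → ℚ) v → ∑ (allFin n) (λ u → y u * P u v) ≡
      y v - inv (ℕtoℚ n) * (∑ (allFin n) (λ u → y u * θℚ u) * θℚ v)
    ∙P y v = trans (∑-cong (allFin n) (λ u → solve 5 (λ y d i a b → y :* (d :- i :* (a :* b)) := y :* d :- (i :* b) :* (y :* a)) refl
                (y u) (idMat u v) (inv (ℕtoℚ n)) (θℚ u) (θℚ v)))
      (trans (∑-minus (allFin n) (λ u → y u * idMat u v) (λ u → inv (ℕtoℚ n) * θℚ v * (y u * θℚ u)))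
        (cong₂ _-_ (∙-idMat {1} (λ _ → y) zero v) (trans (sym (∑-*ˡ (allFin n) (inv (ℕtoℚ n) * θℚ v) (λ u → y u * θℚ u)))
          (solve 3 (λ i t s → i :* t :* s := i :* (s :* t)) refl (inv (ℕtoℚ n)) (θℚ v) (∑ (allFin n) (λ u → y u * θℚ u))))))

    P-sym : P ᵗ ≈ P
    P-sym i j = cong₂ (λ a b → a - inv (ℕtoℚ n) * b) (idMat-sym j i) (ℚP.*-comm (θℚ j) (θℚ i))

    Pν : P ∙ ν ≈ ν
    Pν v e = trans (∑-cong (allFin n) (λ u → solve 5 (λ d i a b x → (d :- i :* (a :* b)) :* x := d :* x :- (i :* a) :* (b :* x)) refl
               (idMat v u) (inv (ℕtoℚ n)) (θℚ v) (θℚ u) (ν u e)))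
      (trans (∑-minus (allFin n) (λ u → idMat v u * ν u e) (λ u → inv (ℕtoℚ n) * θℚ v * (θℚ u * ν u e)))
      (trans (cong₂ _-_ (idMat-∙ ν v e) (trans (sym (∑-*ˡ (allFin n) (inv (ℕtoℚ n) * θℚ v) (λ u → θℚ u * ν u e)))
          (trans (cong (inv (ℕtoℚ n) * θℚ v *_) (zero-·ν θℚ e (θ-src e))) (ℚP.*-zeroʳ (inv (ℕtoℚ n) * θℚ v)))))
        (solve 1 (λ x → x :- con 0ℚ := x) refl (ν v e))))

    row₀-P : ∀ {T k} → SpanningTree T → lookup T k ≡ true → ∀ v → ∑ (allFin n) (λ u → row₀ T k u * P u v) ≡ row₀ T k v
    row₀-P {T} {k} t k∈ v = trans (∙P (row₀ T k) v) (trans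
      (cong (λ q → row₀ T k v - inv (ℕtoℚ n) * (q * θℚ v)) (trans
        (∑-cong (allFin n) (λ u → ℚP.*-assoc (inv (ℕtoℚ n)) (treeRow T k u) (θℚ u)))
        (trans (sym (∑-*ˡ (allFin n) (inv (ℕtoℚ n)) (λ u → treeRow T k u * θℚ u)))
          (trans (cong (inv (ℕtoℚ n) *_) (treeRow-⊥θ t k∈)) (ℚP.*-zeroʳ (inv (ℕtoℚ n)))))))
      (solve 3 (λ r i x → r :- i :* (con 0ℚ :* x) := r) refl (row₀ T k v) (inv (ℕtoℚ n)) (θℚ v)))

    -- Along the edges of a spanning tree the products of `y` with `θ` are constant, so `y` is a
    -- multiple of `θ`, which `P` annihilates.
    tree-nondegenerate : ∀ {T} → SpanningTree T → ∀ y → (∀ e → lookup T e ≡ true → y ·ν e ≡ 0ℚ) →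
      ∀ v → ∑ (allFin n) (λ u → y u * P u v) ≡ 0ℚ
    tree-nondegenerate {T} t y h v = trans (∙P y v) (trans
      (cong (λ q → y v - inv (ℕtoℚ n) * (q * θℚ v)) (trans (∑-cong (allFin n) const) (∑-const n (y v * θℚ v))))
      (trans (solve 4 (λ y i n t → y :- i :* (n :* (y :* t) :* t) := y :- (n :* i) :* ((t :* t) :* y)) refl
          (y v) (inv (ℕtoℚ n)) (ℕtoℚ n) (θℚ v))
        (trans (cong₂ (λ a b → y v - a * (b * y v)) (inv-* n≢0) (signℚ-square (θ v)))
          (solve 1 (λ y → y :- con 1ℚ :* (con 1ℚ :* y) := con 0ℚ) refl (y v)))))
      where
      step : ∀ e → lookup T e ≡ true → y (src e) * θℚ (src e) ≡ y (dst e) * θℚ (dst e)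
      step e e∈ = trans (cong₂ _*_ (·ν-zero y e (h e e∈)) (θ-src e))
        (trans (solve 3 (λ s y t → (s :* y) :* (s :* t) := (s :* s) :* (y :* t)) refl (signℚ (σ e)) (y (dst e)) (θℚ (dst e)))
          (trans (cong (_* (y (dst e) * θℚ (dst e))) (signℚ-square (σ e))) (ℚP.*-identityˡ (y (dst e) * θℚ (dst e)))))
      const : ∀ u → y u * θℚ u ≡ y v * θℚ v
      const u = Reach-ind (λ u → y u * θℚ u ≡ y v * θℚ v)
        (λ e e∈ _ p → trans (sym (step e e∈)) p) (λ e e∈ _ p → trans (step e e∈) p) refl (connected t v u)

    module BalancedAverage = Averaging ν P (isSpanningTree Γ) (λ _ → 1ℚ) row₀ P-sym Pν
      (λ g k∈ e∈ → row₀-dual (spanningTree-elim g) k∈ e∈)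
      (λ g k∈ → row₀-P (spanningTree-elim g) k∈)
      (λ g → tree-nondegenerate (spanningTree-elim g))
      (λ k₀∉ _ g → tree-exchange k₀∉ (spanningTree-elim g))

    -- The prefactor splits: 1/τ² is the normalisation of the average with unit weights, and each of
    -- the two factors 1/n turns a `treeRow` into a `row₀`.
    formulaA-average : ℕtoℚ (τ Γ) ≢ 0ℚ → ∀ i j → formulaA i j ≡ BalancedAverage.Y i j
    formulaA-average τ≢0 i j = trans
      (cong₂ _*_ (trans (cong inv (solve 2 (λ n t → n :* n :* t :* t := (t :* t) :* (n :* n)) refl (ℕtoℚ n) (ℕtoℚ (τ Γ))))
                   (trans (inv-*-distrib (*-≢0 τ≢0 τ≢0) (*-≢0 n≢0 n≢0))
                          (cong (inv (ℕtoℚ (τ Γ) * ℕtoℚ (τ Γ)) *_) (inv-*-distrib n≢0 n≢0))))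
        (∑-cong (allFin m) (λ k → trans
          (∑-cong (treesWith k) (λ Tr → ∑-cong (treesWith k) (λ Ts → Ψ-factors k i j Tr Ts)))
          (∑-product (treesWith k) (treesWith k) (λ T → treeRow T k i) (λ T → treeRow T k j)))))
      (trans (ℚP.*-assoc (inv (ℕtoℚ (τ Γ) * ℕtoℚ (τ Γ))) _ _)
      (cong₂ (λ W s → inv (W * W) * s) (sym (∑-one (spanningTrees Γ)))
        (trans (∑-*ˡ (allFin m) (inv (ℕtoℚ n) * inv (ℕtoℚ n)) (λ k → total k i * total k j))
          (∑-cong (allFin m) (λ k → trans
            (solve 3 (λ c a b → (c :* c) :* (a :* b) := (c :* a) :* (c :* b)) refl (inv (ℕtoℚ n)) (total k i) (total k j))
            (cong₂ _*_ (scaled k i) (scaled k j)))))))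
      where
      total : Fin m → Fin n → ℚ
      total k i = ∑ (treesWith k) (λ T → treeRow T k i)
      scaled : ∀ k i → inv (ℕtoℚ n) * total k i ≡ BalancedAverage.numerator k i
      scaled k i = trans (∑-*ˡ (treesWith k) (inv (ℕtoℚ n)) (λ T → treeRow T k i))
        (∑-cong (treesWith k) (λ T → sym (ℚP.*-identityˡ (inv (ℕtoℚ n) * treeRow T k i))))

-- Existence of the subgraphs

allSets-complete : ∀ m (S : EdgeSet m) → S ∈ allSets m
allSets-complete zero    Vec.[]            = here refl
allSets-complete (suc m) (true  Vec.∷ S) = MemP.∈-++⁺ˡ (MemP.∈-map⁺ (true Vec.∷_) (allSets-complete m S))
allSets-complete (suc m) (false Vec.∷ S) = MemP.∈-++⁺ʳ (List.map (true Vec.∷_) (allSets m))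
  (MemP.∈-map⁺ (false Vec.∷_) (allSets-complete m S))

∈-filterᵇ : {A : Set} (p : A → Bool) {xs : List A} {x : A} → x ∈ xs → p x ≡ true → x ∈ filterᵇ p xs
∈-filterᵇ p x∈ h = MemP.∈-filter⁺ (λ x → T? (p x)) x∈ (subst T (sym h) _)

∑-pos : {A : Set} (xs : List A) {f : A → ℚ} → (∀ x → 0ℚ ℚ.< f x) → ∀ {x} → x ∈ xs → ∑ xs f ≢ 0ℚ
∑-pos xs h {x} x∈ s = ℚP.<⇒≢ (h x) (sym (∑-nonNeg-zero xs (λ x → ℚP.<⇒≤ (h x)) s x∈))

-- Balance and global potentials

module ClosedWalks {n m} (Γ : SignedGraph n m) where
  open SignedGraph Γ
  open Reachability Γ

  sgnEdges-++ : ∀ es fs → sgnEdges Γ (es ++ fs) ≡ sgnEdges Γ es Sign.* sgnEdges Γ fs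
  sgnEdges-++ []       fs = sym (SP.*-identityˡ (sgnEdges Γ fs))
  sgnEdges-++ (e ∷ es) fs = trans (cong (σ e Sign.*_) (sgnEdges-++ es fs)) (sym (SP.*-assoc (σ e) (sgnEdges Γ es) (sgnEdges Γ fs)))

  reverseWalk : ∀ {x y es vs} → Walk Γ x y es vs → ∃ λ fs → WalkOn fs y x × sgnEdges Γ fs ≡ sgnEdges Γ es
  reverseWalk stop = [] , (_ , stop) , refl
  reverseWalk (fwd {es = es} e p) with reverseWalk p
  ... | fs , w , q = fs ++ e ∷ [] , w ++ʷ (_ , bwd e stop) ,
        trans (sgnEdges-++ fs (e ∷ [])) (trans (cong₂ Sign._*_ q (SP.*-identityʳ (σ e))) (SP.*-comm (sgnEdges Γ es) (σ e)))
  reverseWalk (bwd {es = es} e p) with reverseWalk p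
  ... | fs , w , q = fs ++ e ∷ [] , w ++ʷ (_ , fwd e stop) ,
        trans (sgnEdges-++ fs (e ∷ [])) (trans (cong₂ Sign._*_ q (SP.*-identityʳ (σ e))) (SP.*-comm (sgnEdges Γ es) (σ e)))

  Step : Fin n → Fin m → Fin n → Set
  Step x e z = (x ≡ src e × z ≡ dst e) ⊎ (x ≡ dst e × z ≡ src e)

  first-step : ∀ {x y e es vs} → Walk Γ x y (e ∷ es) vs → ∃ λ z → Step x e z × WalkOn es z y
  first-step (fwd e p) = dst e , inj₁ (refl , refl) , (_ , p)
  first-step (bwd e p) = src e , inj₂ (refl , refl) , (_ , p)

  no-steps : ∀ {x y vs} → Walk Γ x y [] vs → x ≡ y
  no-steps stop = refl

  not-loop : ∀ {x e} → ¬ Step x e x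
  not-loop {e = e} (inj₁ (p , q)) = src≢dst e (trans (sym p) q)
  not-loop {e = e} (inj₂ (p , q)) = src≢dst e (trans (sym q) p)

  -- Simplicity of the graph enters here: a closed walk of length two retraces one edge, so its sign
  -- is positive.
  back-and-forth : ∀ {x z e f} → Step x e z → Step z f x → e ≡ f
  back-and-forth {e = e} {f} (inj₁ (p , q)) (inj₁ (r , s)) =
    contradiction (ℕP.<-trans (ordered e) (subst₂ Fin._<_ (trans (sym r) q) (trans (sym s) p) (ordered f))) (ℕP.<-irrefl refl)
  back-and-forth {e = e} {f} (inj₁ (p , q)) (inj₂ (r , s)) =
    simple e f (cong₂ _,_ (trans (sym p) s) (trans (sym q) r))
  back-and-forth {e = e} {f} (inj₂ (p , q)) (inj₁ (r , s)) =
    simple e f (cong₂ _,_ (trans (sym q) r) (trans (sym p) s))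
  back-and-forth {e = e} {f} (inj₂ (p , q)) (inj₂ (r , s)) =
    contradiction (ℕP.<-trans (ordered e) (subst₂ Fin._<_ (trans (sym s) p) (trans (sym r) q) (ordered f))) (ℕP.<-irrefl refl)

  module _ (bal : Balanced Γ) where

    -- `Balanced` speaks of cycles without repeated vertices and of length at least 3. A closed walk
    -- with a repetition is cut into two shorter closed walks; shorter lengths reduce to `not-loop`
    -- and `back-and-forth`.
    closed-+ : ∀ fuel {x} es {vs} → length es ≤ fuel → Walk Γ x x es vs → sgnEdges Γ es ≡ Sign.+
    unique-+ : ∀ {x} es {vs} → Walk Γ x x es vs → Unique vs → sgnEdges Γ es ≡ Sign.+
    unique-+ [] w u = refl
    unique-+ (e ∷ []) w u with first-step w
    ... | z , s , (_ , w') with no-steps w'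
    ... | refl = contradiction s not-loop
    unique-+ (e ∷ f ∷ []) w u with first-step w
    ... | z , s , (_ , w') with first-step w'
    ... | y , t , (_ , w'') with no-steps w''
    ... | refl with back-and-forth s t
    ... | refl = trans (cong (σ e Sign.*_) (SP.*-identityʳ (σ e))) (SP.s*s≡+ (σ e))
    unique-+ (e ∷ f ∷ g ∷ es) w u = bal _ _ _ w (s≤s (s≤s (s≤s z≤n))) u

    closed-+ zero       []       le w = refl
    closed-+ (suc fuel) es       le w with unique-or-detour w
    ... | inj₁ u = unique-+ es w u
    ... | inj₂ (detour {as} {bs} {cs} w₁ w₂ w₃ refl lb lc) = trans (sgnEdges-++ as (bs ++ cs))
          (trans (cong (sgnEdges Γ as Sign.*_) (trans (sgnEdges-++ bs cs)
              (cong (Sign._* sgnEdges Γ cs) (closed-+ fuel bs loop-shorter (proj₂ w₂)))))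
            (trans (sym (sgnEdges-++ as cs)) (closed-+ fuel (as ++ cs)
              (ℕP.≤-pred (ℕP.≤-trans (detour-length as bs cs lb) le)) (proj₂ (w₁ ++ʷ w₃)))))
      where
      loop-shorter : length bs ≤ fuel
      loop-shorter = ℕP.≤-pred (ℕP.≤-trans (subst (suc (length bs) ≤_) (sym (trans (LP.length-++ as) (cong (length as ℕ.+_) (LP.length-++ bs))))
        (ℕP.≤-trans (subst (_≤ length bs ℕ.+ length cs) (ℕP.+-comm (length bs) 1) (ℕP.+-monoʳ-≤ (length bs) lc))
          (ℕP.m≤n+m (length bs ℕ.+ length cs) (length as)))) le)

    -- The value at `v` is the sign of a chosen walk from `x₀`. The walk to `src e`, then `e`, then
    -- the reversed walk from `dst e` is closed, so its sign is positive.
    balanced-potential : Connected Γ → Fin n → ∃ λ θ → ∀ e → θ (src e) Sign.* σ e ≡ θ (dst e)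
    balanced-potential conn x₀ = θ , step
      where
      θ : Fin n → Sign
      θ v = sgnEdges Γ (proj₁ (conn x₀ v))
      step : ∀ e → θ (src e) Sign.* σ e ≡ θ (dst e)
      step e with conn x₀ (src e) | conn x₀ (dst e)
      ... | as , va , wa | bs , vb , wb with reverseWalk wb
      ... | cs , wc , q = sign-product-+ (trans (SP.*-assoc (sgnEdges Γ as) (σ e) (sgnEdges Γ bs))
            (trans (sym (trans (sgnEdges-++ as (e ∷ cs)) (cong (λ s → sgnEdges Γ as Sign.* (σ e Sign.* s)) q)))
              (closed-+ _ (as ++ e ∷ cs) ℕP.≤-refl (proj₂ ((va , wa) ++ʷ (_ , fwd e (proj₂ wc)))))))

  walk-sign : ∀ (g : Fin n → Sign) → (∀ e → g (src e) Sign.* σ e ≡ g (dst e)) → ∀ {x y es vs} → Walk Γ x y es vs →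
    g x Sign.* sgnEdges Γ es ≡ g y
  walk-sign g h {x} stop = SP.*-identityʳ (g x)
  walk-sign g h (fwd {es = es} e p) = trans (sym (SP.*-assoc (g (src e)) (σ e) (sgnEdges Γ es)))
    (trans (cong (Sign._* sgnEdges Γ es) (h e)) (walk-sign g h p))
  walk-sign g h (bwd {es = es} e p) = trans (sym (SP.*-assoc (g (dst e)) (σ e) (sgnEdges Γ es)))
    (trans (cong (Sign._* sgnEdges Γ es) (trans (cong (Sign._* σ e) (sym (h e))) (s*s*t (g (src e)) (σ e)))) (walk-sign g h p))

  potential-balanced : ∀ (g : Fin n → Sign) → (∀ e → g (src e) Sign.* σ e ≡ g (dst e)) → Balanced Γ
  potential-balanced g h x es vs w _ _ = SP.*-cancelˡ-≡ (g x) (sgnEdges Γ es) Sign.+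
    (trans (walk-sign g h w) (sym (SP.*-identityʳ (g x))))

-- Assembling the two cases

pseudoInverse-cong : ∀ {n} {A B X : Mat n} → A ≈ B → IsPseudoInverse A X → IsPseudoInverse B X
pseudoInverse-cong {A = A} {B} {X} h (axa , xax , ax , xa) =
    ≈-trans (∙-cong (∙-congʳ X (≈-sym h)) (≈-sym h)) (≈-trans axa h)
  , ≈-trans (∙-congʳ X (∙-congˡ X (≈-sym h))) xax
  , ≈-trans (λ i j → ∙-congʳ X (≈-sym h) j i) (≈-trans ax (∙-congʳ X h))
  , ≈-trans (λ i j → ∙-congˡ X (≈-sym h) j i) (≈-trans xa (∙-congˡ X h))

inverse-pseudoInverse : ∀ {n} {A X : Mat n} → IsInverse A X → IsPseudoInverse A X
inverse-pseudoInverse {A = A} {X} (ax , xa) =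
    ≈-trans (∙-congʳ A ax) (idMat-∙ A)
  , ≈-trans (∙-congʳ X xa) (idMat-∙ X)
  , ≈-trans (λ i j → trans (ax j i) (idMat-sym j i)) (≈-sym ax)
  , ≈-trans (λ i j → trans (xa j i) (idMat-sym j i)) (≈-sym xa)

module Conclusion {n m} (Γ : SignedGraph n m) (N : Fin n → Fin m → ℤ) (inc : IsIncidence Γ N)
  (2≤n : 2 ≤ n) (conn : Connected Γ) where
  open SignedGraph Γ

  root : Fin n
  root = Fin.fromℕ< (ℕP.≤-trans (s≤s z≤n) 2≤n)

  n≢0 : ℕtoℚ n ≢ 0ℚ
  n≢0 h with ℕtoℚ-injective {n} {0} h
  ... | refl = case 2≤n of λ ()

  open BalancedRows Γ N inc n≢0
  open ClosedWalks Γ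
  open Formulas Γ N using (c; isTU; weight; NHdag; TU; formulaA; formulaB)
  open SpanningTree

  -- Edges on cycles are deleted from the full edge set one at a time; each can be bypassed, so
  -- connectivity persists, and the edge count bounds the process.
  spanningTree-exists : ∃ SpanningTree
  spanningTree-exists = go (count m (lookup full-set)) full-set refl
      (λ x y → walk⇒Reach {full-set} (proj₂ (conn x y)) (All.universal (λ e → VP.lookup-replicate e true) _))
    where
    full-set : EdgeSet m
    full-set = Vec.replicate m true
    go : ∀ d S → count m (lookup S) ≡ d → (∀ x y → Reach S x y) → ∃ SpanningTree
    go d S h c = cases d h (any (onCycle Γ S) (allFin m)) refl
      where
      cases : ∀ d → count m (lookup S) ≡ d → ∀ b → any (onCycle Γ S) (allFin m) ≡ b → ∃ SpanningTree
      cases d h false q = S , record { connected = c ; acyclic = λ e → any-false (onCycle Γ S) q (MemP.∈-allFin e) }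
      cases zero h true q = remove-cycle (any-elim (onCycle Γ S) (allFin m) q)
        where
        remove-cycle : ∃ (OnCycle S) → ∃ SpanningTree
        remove-cycle (e , ce) = case trans (sym h) (size-∖ {S} e (proj₁ (onCycle-elim {S} ce))) of λ ()
      cases (suc d) h true q = remove-cycle (any-elim (onCycle Γ S) (allFin m) q)
        where
        remove-cycle : ∃ (OnCycle S) → ∃ SpanningTree
        remove-cycle (e , ce) = go d (S ∖ e)
          (ℕP.suc-injective (trans (sym (size-∖ {S} e (proj₁ (onCycle-elim {S} ce)))) h))
          (λ x y → Reach-reroute e (proj₂ (onCycle-elim {S} ce)) (c x y))

  τ≢0 : ∑ (spanningTrees Γ) (λ _ → 1ℚ) ≢ 0ℚ
  τ≢0 = ∑-pos (spanningTrees Γ) (λ _ → ℚP.positive⁻¹ 1ℚ)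
    (∈-filterᵇ (isSpanningTree Γ) (allSets-complete m (proj₁ spanningTree-exists))
      (spanningTree-intro (proj₂ spanningTree-exists)))

  balancedCase : Balanced Γ → ∀ (X : Mat n) → IsPseudoInverse (laplacian Γ) X → ∀ i j → X i j ≡ formulaA i j
  balancedCase bal X isX i j = trans
    (pseudoInverse-unique (pseudoInverse-cong laplacian-νν isX) (BalancedAverage.isPseudoInverse θ pθ τ≢0) i j)
    (sym (formulaA-average θ pθ (λ h → τ≢0 (trans (∑-one (spanningTrees Γ)) h)) i j))
    where
    θ : Fin n → Sign
    θ = proj₁ (balanced-potential bal conn root)
    pθ : ∀ e → θ (src e) Sign.* σ e ≡ θ (dst e)
    pθ = proj₂ (balanced-potential bal conn root)

  -- For unbalanced Γ the matrix `ν` has full row rank, so the projection onto its range is the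
  -- identity.
  module UnbalancedAverage = Averaging ν idMat isTU weight NHdag (λ i j → idMat-sym j i) (idMat-∙ ν)
    (λ g k∈ e∈ → NHdag-dual (TU⇒Good g) k∈ e∈)
    (λ {H} {k} _ _ v → ∙-idMat (NHdag H) k v)
    (λ g y h v → trans (∙-idMat {1} (λ _ → y) zero v) (Good⇒nondegenerate (TU⇒Good g) y h v))
    (λ k₀∉ k∉ g p≢0 → Good⇒TU (exchange-Good k₀∉ k∉ (TU⇒Good g) p≢0) , exchange-weight k₀∉ k∉ (TU⇒Good g) p≢0)

  -- A spanning tree together with an edge that violates the potential of the tree.
  TU-exists : ¬ Balanced Γ → ∃ Good
  TU-exists ¬bal = search (any (λ e → not ⌊ g (src e) Sign.* σ e SP.≟ g (dst e) ⌋) (allFin m)) refl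
    where
    T₀ : EdgeSet m
    T₀ = proj₁ spanningTree-exists
    t : SpanningTree T₀
    t = proj₂ spanningTree-exists
    tree : Tree T₀ root
    tree e _ _ = acyclic t e
    g : Fin n → Sign
    g = treePotential T₀ root
    pot : Potential T₀ root g
    pot = treePotential-potential tree
    violated : ∀ e → not ⌊ g (src e) Sign.* σ e SP.≟ g (dst e) ⌋ ≡ true → g (src e) Sign.* σ e ≢ g (dst e)
    violated e h with g (src e) Sign.* σ e SP.≟ g (dst e)
    ... | no ¬p = ¬p
    respected : ∀ e → not ⌊ g (src e) Sign.* σ e SP.≟ g (dst e) ⌋ ≡ false → g (src e) Sign.* σ e ≡ g (dst e)
    respected e h with g (src e) Sign.* σ e SP.≟ g (dst e)
    ... | yes p = p
    tree-size : n ≡ suc (count m (lookup T₀))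
    tree-size = [ (λ (_ , q) → trans (sym (connected-size (connected t) root)) (trans q (cong suc edges))) ,
                  (λ ((e , c , _) , _) → true≢false c (acyclic t e)) ]′ (tree-or-cycle T₀ root)
      where
      edges : ∣E∣ T₀ root ≡ count m (lookup T₀)
      edges = count-cong m (λ e → trans (cong (lookup T₀ e ∧_) (connected t root (src e))) (BP.∧-identityʳ (lookup T₀ e)))
    extend : ∀ e → g (src e) Sign.* σ e ≢ g (dst e) → ∃ Good
    extend e v = H , full⇒Good size full
      where
      H : EdgeSet m
      H = add T₀ e
      e∉ : lookup T₀ e ≡ false
      e∉ = ¬true⇒false (λ e∈ → v (pot e e∈ (connected t root (src e))))
      size : count m (lookup H) ≡ n
      size = trans (size-∖ {H} e (lookup-add T₀ e))
        (trans (cong (λ U → suc (count m (lookup U))) (remove-add Γ {T₀} {e} e∉)) (sym tree-size))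
      full : ∀ x g' → ¬ Potential H x g'
      -- On the spanning tree any potential agrees with `g` up to one sign, so a potential of `H`
      -- would make `e` respect `g`.
      full x g' pot' = v (SP.*-cancelʳ-≡ (g' (dst e)) _ _ (trans
        (cong (g (src e) Sign.* σ e Sign.*_) (sym (pot' e (lookup-add T₀ e) (Reach-add e (connected t x (src e))))))
        (trans (sign-cancelʳ (g (src e)) (g' (src e)) (σ e)) (trans (agree (src e)) (sym (agree (dst e)))))))
        where
        agree : ∀ y → g y Sign.* g' y ≡ g x Sign.* g' x
        agree y = potential-unique g g' (Potential-⊆ g id (connected t root x) pot)
          (Potential-⊆ g' (lookup-add-⊇ T₀) Reach-refl pot') (connected t x y)
    search : ∀ b → any (λ e → not ⌊ g (src e) Sign.* σ e SP.≟ g (dst e) ⌋) (allFin m) ≡ b → ∃ Good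
    search true  q = extend (proj₁ found) (violated (proj₁ found) (proj₂ found))
      where
      found : ∃ λ e → not ⌊ g (src e) Sign.* σ e SP.≟ g (dst e) ⌋ ≡ true
      found = any-elim (λ e → not ⌊ g (src e) Sign.* σ e SP.≟ g (dst e) ⌋) (allFin m) q
    -- If every edge respects `g`, then `g` is a global potential and Γ would be balanced.
    search false q = contradiction (potential-balanced g (λ e → respected e
      (any-false (λ e → not ⌊ g (src e) Sign.* σ e SP.≟ g (dst e) ⌋) q (MemP.∈-allFin e)))) ¬bal

  weights≢0 : ¬ Balanced Γ → ∑ TU weight ≢ 0ℚ
  weights≢0 ¬bal = ∑-pos TU {weight} positive
    (∈-filterᵇ isTU (allSets-complete m (proj₁ (TU-exists ¬bal))) (Good⇒TU (proj₂ (TU-exists ¬bal))))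
    where
    power-pos : ∀ c → 0ℚ ℚ.< ℕtoℚ (4 ℕ.^ c)
    power-pos c with 4 ℕ.^ c | ℕP.m^n>0 4 c
    ... | suc q | _ = ℕtoℚ-pos q
    positive : ∀ H → 0ℚ ℚ.< weight H
    positive H = power-pos (c H)

  -- An inverse satisfies the Penrose conditions, so uniqueness of the pseudoinverse identifies it
  -- with the average; `P` being the identity, the average is itself an inverse.
  unbalancedCase : ¬ Balanced Γ → Σ (Mat n) (IsInverse (laplacian Γ)) ×
    (∀ (X : Mat n) → IsInverse (laplacian Γ) X → ∀ i j → X i j ≡ formulaB i j)
  unbalancedCase ¬bal =
      (UnbalancedAverage.Y , ≈-trans (∙-congʳ UnbalancedAverage.Y laplacian-νν) (UnbalancedAverage.LY W≢0)
                           , ≈-trans (∙-congˡ UnbalancedAverage.Y laplacian-νν) (UnbalancedAverage.YL W≢0))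
    , λ X isX → pseudoInverse-unique (pseudoInverse-cong laplacian-νν (inverse-pseudoInverse isX))
        (UnbalancedAverage.isPseudoInverse W≢0)
    where
    W≢0 : ∑ TU weight ≢ 0ℚ
    W≢0 = weights≢0 ¬bal

theorem5p1 : ∀ {n m} (Γ : SignedGraph n m) (N : Fin n → Fin m → ℤ) →
    2 ≤ n → Connected Γ → IsIncidence Γ N →
    ((Balanced Γ → ∀ (X : Mat n) → IsPseudoInverse (laplacian Γ) X →
        ∀ i j → X i j ≡ Formulas.formulaA Γ N i j)
    × (¬ Balanced Γ →
        Σ (Mat n) (IsInverse (laplacian Γ))
        × (∀ (X : Mat n) → IsInverse (laplacian Γ) X →
             ∀ i j → X i j ≡ Formulas.formulaB Γ N i j)))
theorem5p1 Γ N 2≤n conn inc = balancedCase , unbalancedCase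
  where open Conclusion Γ N inc 2≤n conn
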